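{- Let $r\geq 3$ and $k\geq 1$ be integers. There exists $n_0=n_0(r,k)$ such that for every integer $n\geq n_0$, writing $n=qr+p$ with integers $q$ and $0\leq p\leq r-1$, the following hold. (a) ${\rm ex}_{r+1}(n,B_{r,k})=\left(1-\frac{1}{r}\right)\frac{n^2}{2}-\frac{n}{r}+\frac{p(p+2)}{2r}-\frac{p}{2}+1$. (b) ${\rm Ex}_{r+1}(n,B_{r,k})$ equals $\mathcal{G}_1[n]\cup\mathcal{G}_2[n]$ if $p=0$; equals $\mathcal{G}_1[n]\cup\mathcal{G}_2[n]\cup\mathcal{G}_3[n]$ if $1\leq p\leq r-3$; equals $\mathcal{G}_2[n]\cup\mathcal{G}_3[n]$ if $p=r-2$; and equals $\mathcal{G}_3[n]$ if $p=r-1$.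
   Context: All graphs are finite and simple. For $r\geq 3$, $k\geq1$, the generalized book graph $B_{r,k}=K_r\vee kK_1$ is obtained by joining every vertex of $K_r$ to every vertex of an independent set of size $k$. A graph is $H$-free if it has no subgraph isomorphic to $H$. A graph is $r$-partite if its vertex set can be partitioned into $r$ (possibly empty) independent sets; non-$r$-partite otherwise. For a graph $H$ with chromatic number $r+1$, ${\rm ex}_{r+1}(n,H)$ is the maximum number of edges of a non-$r$-partite $H$-free graph on $n$ vertices, and ${\rm Ex}_{r+1}(n,H)$ is the set of all non-$r$-partite $H$-free $n$-vertex graphs with exactly ${\rm ex}_{r+1}(n,H)$ edges. $T_m(N)$ denotes the Turán graph: the complete $m$-partite graph on $N$ vertices with part sizes differing by at most one. $H_1\vee H_2$ denotes the join (disjoint union plus all edges between $H_1$ and $H_2$). For nonnegative integers $n_1,\dots,n_5$, $C_5[n_1,n_2,n_3,n_4,n_5]$ is the blow-up of the 5-cycle $v_1v_2v_3v_4v_5v_1$: each $v_i$ is replaced by an independent set $I_i$ of size $n_i$, and all edges are added between $I_i$ and $I_{i+1}$ for $1\leq i\leq 4$ and between $I_1$ and $I_5$. For even $m\geq 6$: $\mathcal{C}_5^1[m]=\{C_5[\frac m2-2,t,1,1,\frac m2-t]:1\leq t\leq \frac m2-1\}$ and $\mathcal{C}_5^2[m]=\{C_5[\frac m2-1,t,1,1,\frac m2-t-1]:1\leq t\leq \frac m2-2\}$. For odd $m\geq5$: $\mathcal{C}_5^3[m]=\{C_5[\frac{m-1}2-1,t,1,1,\frac{m-1}2-t]:1\leq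 t\leq \frac{m-1}2-1\}$. With $n=qr+p$, $0\le p\le r-1$: $\mathcal{G}_1[n]=\{F\vee T_{r-2}(q(r-2)+p+1):F\in\mathcal{C}_5^3[2q-1]\}$; $\mathcal{G}_2[n]=\{F\vee T_{r-2}(q(r-2)+p):F\in\mathcal{C}_5^1[2q]\cup\mathcal{C}_5^2[2q]\}$; $\mathcal{G}_3[n]=\{F\vee T_{r-2}(q(r-2)+p-1):F\in\mathcal{C}_5^3[2q+1]\}$. -}

module Defs where

open import Data.Nat using (ℕ; zero; suc; _+_; _*_; _∸_; _≤_; _<_; _<?_; _/_; _%_; _≡ᵇ_)
open import Data.Bool using (Bool; true; false; not; _∨_)
open import Data.Fin using (Fin; toℕ)
import Data.Fin as Fin
open import Data.List using (List; length; filter; cartesianProduct; allFin)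
open import Data.Product using (Σ; _×_; _,_; ∃)
open import Data.Sum using (_⊎_; inj₁; inj₂)
import Data.Sum.Properties as SumP
open import Relation.Binary.PropositionalEquality using (_≡_; _≢_; refl; sym)
open import Relation.Nullary using (yes; no)
open import Relation.Nullary.Decidable using (⌊_⌋)
open import Data.Empty using (⊥-elim)
open import Data.Bool.Properties using (∨-comm)
open import Data.Integer using (ℤ; +_) renaming (_+_ to _+ℤ_; _-_ to _-ℤ_)
open import Function.Bundles using (_⇔_)
import Data.Nat as N
open import Relation.Nullary using (¬_)
open import Relation.Nullary.Decidable using (_×-dec_)
open import Data.Bool.Properties using () renaming (_≟_ to _≟ᵇ_)
open import Function.Definitions using (Injective)

record Graph (n : ℕ) : Set where
  field
    adj    : Fin n → Fin n → Bool
    adjSym : ∀ u v → adj u v ≡ adj v u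
    adjIrrefl : ∀ u → adj u u ≡ false
open Graph public

edges : ∀ {n} → Graph n → ℕ
edges {n} G = length (filter (λ uv → (toℕ (Data.Product.proj₁ uv) <? toℕ (Data.Product.proj₂ uv))
                                      ×-dec (adj G (Data.Product.proj₁ uv) (Data.Product.proj₂ uv) ≟ᵇ true))
                             (cartesianProduct (allFin n) (allFin n)))

Contains : ∀ {m n} → Graph n → Graph m → Set
Contains {m} {n} G H = Σ (Fin m → Fin n) λ f →
  Injective _≡_ _≡_ f × (∀ a b → adj H a b ≡ true → adj G (f a) (f b) ≡ true)

Free : ∀ {m n} → Graph m → Graph n → Set
Free H G = ¬ Contains G H

Partite : ∀ {n} → ℕ → Graph n → Set
Partite {n} r G = Σ (Fin n → Fin r) λ c → ∀ u v → adj G u v ≡ true → c u ≢ c v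

-- Generalized book graph B_{r,k} = K_r ∨ kK_1 on Fin (r + k):
-- vertices with index < r form the clique K_r, the others the independent set.
bookAdj : ∀ r k → Fin (r + k) → Fin (r + k) → Bool
bookAdj r k u v with toℕ u N.≟ toℕ v
... | yes _ = false
... | no _ = ⌊ toℕ u <? r ⌋ ∨ ⌊ toℕ v <? r ⌋

bookSym : ∀ r k u v → bookAdj r k u v ≡ bookAdj r k v u
bookSym r k u v with toℕ u N.≟ toℕ v | toℕ v N.≟ toℕ u
... | yes _ | yes _ = refl
... | no _  | no _  = ∨-comm ⌊ toℕ u <? r ⌋ ⌊ toℕ v <? r ⌋
... | yes e | no ne = ⊥-elim (ne (sym e))
... | no ne | yes e = ⊥-elim (ne (sym e))

bookIrrefl : ∀ r k u → bookAdj r k u u ≡ false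
bookIrrefl r k u with toℕ u N.≟ toℕ u
... | yes _ = refl
... | no ne = ⊥-elim (ne refl)

Book : ∀ r k → Graph (r + k)
Book r k = record { adj = bookAdj r k ; adjSym = bookSym r k ; adjIrrefl = bookIrrefl r k }

Admissible : ∀ {m n} → ℕ → Graph m → Graph n → Set
Admissible r H G = ¬ Partite r G × Free H G

IsEx : ∀ {m} → ℕ → Graph m → ℕ → ℕ → Set
IsEx r H n e = (Σ (Graph n) λ G → Admissible r H G × edges G ≡ e)
             × (∀ (G : Graph n) → Admissible r H G → edges G ≤ e)

InEx : ∀ {m n} → ℕ → Graph m → Graph n → Set
InEx {n = n} r H G = Admissible r H G × (∀ (G' : Graph n) → Admissible r H G' → edges G' ≤ edges G)

c5Adj : Fin 5 → Fin 5 → Bool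
c5Adj i j = ((suc (toℕ i)) % 5 ≡ᵇ toℕ j) ∨ ((suc (toℕ j)) % 5 ≡ᵇ toℕ i)

-- adjacency pattern of C5[...] ∨ T_m(N): labels inj₁ i are the C5 classes I_i,
-- labels inj₂ j are the parts of the Turán graph.
joinPat : ∀ m → Fin 5 ⊎ Fin m → Fin 5 ⊎ Fin m → Bool
joinPat m (inj₁ i) (inj₁ j) = c5Adj i j
joinPat m (inj₁ i) (inj₂ j) = true
joinPat m (inj₂ i) (inj₁ j) = true
joinPat m (inj₂ i) (inj₂ j) = not ⌊ i Fin.≟ j ⌋

classSize : ∀ {n m} → (Fin n → Fin 5 ⊎ Fin m) → Fin 5 ⊎ Fin m → ℕ
classSize {n} π x = length (filter (λ u → SumP.≡-dec Fin._≟_ Fin._≟_ (π u) x) (allFin n))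

sumFin : ∀ {m} → (Fin m → ℕ) → ℕ
sumFin {zero} s = 0
sumFin {suc m} s = s Fin.zero + sumFin (λ j → s (Fin.suc j))

-- G is isomorphic to C5[a_1,...,a_5] ∨ T_m(N): the vertex set of G is partitioned
-- into classes I_1..I_5 of sizes a_i and m classes (the Turán parts) whose sizes
-- sum to N and differ by at most one, with adjacency given exactly by joinPat.
IsC5JoinTuran : ∀ {n} → Graph n → (Fin 5 → ℕ) → (m N : ℕ) → Set
IsC5JoinTuran {n} G a m N =
  Σ (Fin n → Fin 5 ⊎ Fin m) λ π →
    (∀ i → classSize π (inj₁ i) ≡ a i)
  × (sumFin (λ j → classSize π (inj₂ j)) ≡ N)
  × (∀ j j' → classSize π (inj₂ j) ≤ suc (classSize π (inj₂ j')))
  × (∀ u v → adj G u v ≡ joinPat m (π u) (π v))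

vec5 : ℕ → ℕ → ℕ → ℕ → ℕ → Fin 5 → ℕ
vec5 a b c d e Fin.zero = a
vec5 a b c d e (Fin.suc Fin.zero) = b
vec5 a b c d e (Fin.suc (Fin.suc Fin.zero)) = c
vec5 a b c d e (Fin.suc (Fin.suc (Fin.suc Fin.zero))) = d
vec5 a b c d e (Fin.suc (Fin.suc (Fin.suc (Fin.suc Fin.zero)))) = e

-- Parameter vectors of the families C_5^1[m], C_5^2[m] (m even), C_5^3[m] (m odd).
C51 C52 C53 : ℕ → ℕ → Fin 5 → ℕ
C51 m t = vec5 (m / 2 ∸ 2) t 1 1 (m / 2 ∸ t)
C52 m t = vec5 (m / 2 ∸ 1) t 1 1 (m / 2 ∸ t ∸ 1)
C53 m t = vec5 ((m ∸ 1) / 2 ∸ 1) t 1 1 ((m ∸ 1) / 2 ∸ t)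

InC51 InC52 InC53 : ∀ {n} → Graph n → (M m N : ℕ) → Set
InC51 G M m N = Σ ℕ λ t → 1 ≤ t × t ≤ M / 2 ∸ 1 × IsC5JoinTuran G (C51 M t) m N
InC52 G M m N = Σ ℕ λ t → 1 ≤ t × t ≤ M / 2 ∸ 2 × IsC5JoinTuran G (C52 M t) m N
InC53 G M m N = Σ ℕ λ t → 1 ≤ t × t ≤ (M ∸ 1) / 2 ∸ 1 × IsC5JoinTuran G (C53 M t) m N

InG1 InG2 InG3 : ∀ {n} → Graph n → (r q p : ℕ) → Set
InG1 G r q p = InC53 G (2 * q ∸ 1) (r ∸ 2) (q * (r ∸ 2) + p + 1)
InG2 G r q p = InC51 G (2 * q) (r ∸ 2) (q * (r ∸ 2) + p) ⊎ InC52 G (2 * q) (r ∸ 2) (q * (r ∸ 2) + p)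
InG3 G r q p = InC53 G (2 * q + 1) (r ∸ 2) (q * (r ∸ 2) + p ∸ 1)

-- 2r times the claimed value of ex_{r+1}(n, B_{r,k}):
-- 2r[(1-1/r)n²/2 - n/r + p(p+2)/(2r) - p/2 + 1] = (r-1)n² - 2n + p(p+2) - rp + 2r
exFormula2r : ℕ → ℕ → ℕ → ℤ
exFormula2r r n p = (((+ ((r ∸ 1) * n * n) -ℤ + (2 * n)) +ℤ + (p * (p + 2))) -ℤ + (r * p)) +ℤ + (2 * r)

{-# OPTIONS --safe #-}
module Submission where

open import Defs
open import Data.Nat using (_≡ᵇ_; ℕ; zero; suc; _+_; _*_; _∸_; _≤_; _<_; z≤n; s≤s; s≤s⁻¹; _<?_; _≤?_; _≤ᵇ_; _<ᵇ_; _/_; _%_; NonZero; >-nonZero) renaming (_≟_ to _≟ⁿ_)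
open import Data.Nat.Properties hiding (_≟_)
open import Data.Nat.DivMod using (m≡m%n+[m/n]*n; m%n<n; m*n/n≡m; /-monoˡ-≤; m/n*n≤m)
open import Data.Nat.Induction using (<-wellFounded)
open import Data.Nat.Tactic.RingSolver using (solve-∀)
open import Induction.WellFounded using (Acc; acc)
open import Data.Bool using (Bool; true; false; not; _∧_; _∨_; if_then_else_)
open import Data.Bool.Properties using (∧-comm; ∨-comm) renaming (_≟_ to _≟ᵇ_)
open import Data.Fin using (Fin; zero; suc; toℕ; punchIn; punchOut; splitAt; _↑ˡ_; _↑ʳ_; inject≤) renaming (_≟_ to _≟ᶠ_)
import Data.Fin as Fin
import Data.Fin.Properties as Finₚ
open import Data.Fin.Patterns using (0F; 1F; 2F; 3F; 4F)
open import Data.List using (_++_; length; filter; map; cartesianProduct; allFin; tabulate)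
open import Data.List.Properties using (length-++; filter-++)
open import Data.Vec.Functional using () renaming (_∷_ to _◂_; [] to ∅)
open import Data.Product using (Σ; Σ-syntax; ∃; ∃-syntax; _×_; _,_; proj₁; proj₂)
open import Data.Sum using (_⊎_; inj₁; inj₂; [_,_]′)
import Data.Sum.Properties as Sumₚ
open import Data.Empty using (⊥; ⊥-elim)
open import Function using (_∘_; id; case_of_)
open import Function.Bundles using (_⇔_; mk⇔)
open import Function.Definitions using (Injective)
open import Relation.Nullary using (¬_; Dec; yes; no; contradiction)
open import Relation.Nullary.Decidable using (⌊_⌋; _×-dec_; _⊎-dec_; _→-dec_; toWitness)
open import Relation.Binary.Definitions using (tri<; tri≈; tri>)
open import Relation.Binary.PropositionalEquality using (_≡_; _≢_; refl; sym; trans; cong; cong₂; subst; subst₂; module ≡-Reasoning)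
import Algebra.Properties.Semiring.Sum +-*-semiring as Sumₛ

-- Let G be B_{r,k}-free and not r-partite with at least the claimed number of edges. Füredi's greedy argument
-- gives an r-colouring with O(n) monochromatic edges: picking vertices of maximal degree in successive common
-- neighbourhoods must stop after r steps, since fewer than k vertices remain. Recolour single vertices until no
-- move lowers the number of monochromatic edges; then all parts V_l have about n/r vertices, all but O(n) cross
-- pairs are edges, and every vertex has few neighbours in its own part, as otherwise its neighbourhood contains
-- a K_{r-1} that extends it to a book. For the same reason the ends u, w ∈ V_i of a monochromatic edge have few
-- common neighbours in some V_j, so u and w together miss almost all of V_j. The density leaves no room for
-- further misses of linear order, and so V_i ∪ V_j is triangle-free: a triangle in it would extend to a book
-- (here r ≥ 3 enters). Comparing missing cross pairs with monochromatic edges shows that uw is the only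
-- monochromatic edge and that every y ∈ V_j misses exactly one of u and w, while nothing else is missing.
-- This is C₅[...] joined to a complete multipartite graph, and it has |V_j| − 1 edges fewer than the complete
-- r-partite graph on the same parts. With b_l = |V_l| for l ≠ j and b_j = |V_j| + 1 the count is maximal exactly when all b_l
-- lie in {q, q + 1}, because Σ (b_l − q)(b_l − q − 1) ≥ 0.

-- The budget for missing cross pairs is linear in `q`, not constant, and this shapes the estimates:
-- Markov's inequality bounds the number of vertices with many misses by a constant only if "many"
-- is itself linear in `q`. Two such thresholds, `s` and `h`, are used. At most `N` vertices miss
-- `s` or more, so a greedy pick needs just over `N` candidates and costs at most `s` of each later
-- part; this fixes `T`, the number of candidates per part that guarantees a book. A monochromatic
-- edge whose ends have fewer than `T` common neighbours in some part has an end missing `h` or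
-- more, and at most `H` vertices do, so there are at most `H * T` monochromatic edges. As `H` does
-- not depend on `s`, the threshold `s` can be taken so small compared with `h` that `H * T` is far
-- below the size of a part. From there on the error terms vanish by integrality.
--
-- All pairs are counted in both orders, so counts are doubled, and identities are written
-- additively to avoid truncated subtraction.

⟦_⟧ : Bool → ℕ
⟦ true ⟧ = 1
⟦ false ⟧ = 0

⟦⟧≤1 : ∀ b → ⟦ b ⟧ ≤ 1
⟦⟧≤1 true = ≤-refl
⟦⟧≤1 false = z≤n

infix 4 _==_
_==_ : ∀ {n} → Fin n → Fin n → Bool
x == y = ⌊ x ≟ᶠ y ⌋

==-true : ∀ {n} {x y : Fin n} → x ≡ y → (x == y) ≡ true
==-true {x = x} {y} e with x ≟ᶠ y
... | yes _ = refl
... | no ne = contradiction e ne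

==-false : ∀ {n} {x y : Fin n} → x ≢ y → (x == y) ≡ false
==-false {x = x} {y} ne with x ≟ᶠ y
... | yes e = contradiction e ne
... | no _ = refl

==-sound : ∀ {n} {x y : Fin n} → (x == y) ≡ true → x ≡ y
==-sound {x = x} {y} e with x ≟ᶠ y
... | yes p = p

==-comm : ∀ {n} (x y : Fin n) → (x == y) ≡ (y == x)
==-comm x y with x ≟ᶠ y
... | yes p = sym (==-true (sym p))
... | no ne = sym (==-false (ne ∘ sym))

∧-true : ∀ {a b} → a ∧ b ≡ true → a ≡ true × b ≡ true
∧-true {true} {true} _ = refl , refl

-- Linear arithmetic by certificate: a hypothesis L ≤ R yields a ≤ b as soon as b − a = (R − L) + x.
lin : ∀ {L R a b} x → L ≤ R → a + R + x ≡ b + L → a ≤ b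
lin {L} {R} {a} {b} x h e = +-cancelʳ-≤ R a b (≤-trans (m≤m+n (a + R) x) (≤-trans (≤-reflexive e) (+-monoʳ-≤ b h)))

-- Sums over finite index types

-- Abstract, so that unification never unfolds a sum and can always infer the summand.
abstract
  sum : ∀ {n} → (Fin n → ℕ) → ℕ
  sum = Sumₛ.sum

  sum-empty : (f : Fin 0 → ℕ) → sum f ≡ 0
  sum-empty f = refl

  sum-suc : ∀ {n} (f : Fin (suc n) → ℕ) → sum f ≡ f zero + sum (f ∘ suc)
  sum-suc f = refl

  sum-cong : ∀ {n} {f g : Fin n → ℕ} → (∀ i → f i ≡ g i) → sum f ≡ sum g
  sum-cong = Sumₛ.sum-cong-≗

  sum-+ : ∀ {n} (f g : Fin n → ℕ) → sum (λ i → f i + g i) ≡ sum f + sum g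
  sum-+ = Sumₛ.∑-distrib-+

  sum-comm : ∀ {m n} (f : Fin m → Fin n → ℕ) → sum (λ i → sum (f i)) ≡ sum (λ j → sum (λ i → f i j))
  sum-comm = Sumₛ.∑-comm

  sum-*ˡ : ∀ {n} x (f : Fin n → ℕ) → x * sum f ≡ sum (λ i → x * f i)
  sum-*ˡ = Sumₛ.*-distribˡ-sum

  sum-*ʳ : ∀ {n} x (f : Fin n → ℕ) → sum f * x ≡ sum (λ i → f i * x)
  sum-*ʳ = Sumₛ.*-distribʳ-sum

  sum-sumFin : ∀ {n} (f : Fin n → ℕ) → sum f ≡ sumFin f
  sum-sumFin {zero} f = refl
  sum-sumFin {suc n} f = cong (f zero +_) (sum-sumFin (f ∘ suc))

sum-mono : ∀ {n} {f g : Fin n → ℕ} → (∀ i → f i ≤ g i) → sum f ≤ sum g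
sum-mono {zero} {f} {g} h = ≤-reflexive (trans (sum-empty f) (sym (sum-empty g)))
sum-mono {suc n} {f} {g} h = subst₂ _≤_ (sym (sum-suc f)) (sym (sum-suc g)) (+-mono-≤ (h zero) (sum-mono (h ∘ suc)))

sum-const : ∀ n x → sum {n} (λ _ → x) ≡ n * x
sum-const zero x = sum-empty _
sum-const (suc n) x = trans (sum-suc _) (cong (x +_) (sum-const n x))

sum-zero : ∀ {n} {f : Fin n → ℕ} → (∀ i → f i ≡ 0) → sum f ≡ 0
sum-zero {n} h = trans (sum-cong h) (trans (sum-const n 0) (*-zeroʳ n))

sum-≥ : ∀ {n} (f : Fin n → ℕ) i → f i ≤ sum f
sum-≥ f zero = ≤-trans (m≤m+n _ _) (≤-reflexive (sym (sum-suc f)))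
sum-≥ f (suc i) = ≤-trans (≤-trans (sum-≥ (f ∘ suc) i) (m≤n+m _ (f zero))) (≤-reflexive (sym (sum-suc f)))

δ : ∀ {n} → Fin n → Fin n → ℕ
δ i x = ⟦ x == i ⟧

δ-refl : ∀ {n} (i : Fin n) → δ i i ≡ 1
δ-refl i = cong ⟦_⟧ (==-true {x = i} refl)

δ-≢ : ∀ {n} {i x : Fin n} → x ≢ i → δ i x ≡ 0
δ-≢ ne = cong ⟦_⟧ (==-false ne)

δ-suc : ∀ {n} (i x : Fin n) → δ (suc i) (suc x) ≡ δ i x
δ-suc i x with x ≟ᶠ i
... | yes refl = refl
... | no _ = refl

sum-δ : ∀ {n} (i : Fin n) (f : Fin n → ℕ) → sum (λ x → δ i x * f x) ≡ f i
sum-δ zero f = trans (sum-suc _) (trans (cong₂ _+_ (+-identityʳ _) (sum-zero λ _ → refl)) (+-identityʳ _))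
sum-δ (suc i) f = trans (sum-suc _) (trans (sum-cong λ x → cong (_* f (suc x)) (δ-suc i x)) (sum-δ i (f ∘ suc)))

sum-δ₁ : ∀ {n} (i : Fin n) → sum (δ i) ≡ 1
sum-δ₁ i = trans (sum-cong λ x → sym (*-identityʳ _)) (sum-δ i (λ _ → 1))

sum₂ : ∀ {m n} → (Fin m → Fin n → ℕ) → ℕ
sum₂ f = sum λ u → sum (f u)

sum₂-cong : ∀ {m n} {f g : Fin m → Fin n → ℕ} → (∀ u v → f u v ≡ g u v) → sum₂ f ≡ sum₂ g
sum₂-cong h = sum-cong λ u → sum-cong (h u)

sum₂-mono : ∀ {m n} {f g : Fin m → Fin n → ℕ} → (∀ u v → f u v ≤ g u v) → sum₂ f ≤ sum₂ g
sum₂-mono h = sum-mono λ u → sum-mono (h u)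

sum₂-+ : ∀ {m n} (f g : Fin m → Fin n → ℕ) → sum₂ (λ u v → f u v + g u v) ≡ sum₂ f + sum₂ g
sum₂-+ f g = trans (sum-cong λ u → sum-+ (f u) (g u)) (sum-+ (λ u → sum (f u)) (λ u → sum (g u)))

sum₂-const : ∀ m n x → sum₂ {m} {n} (λ _ _ → x) ≡ m * (n * x)
sum₂-const m n x = trans (sum-cong {m} λ _ → sum-const n x) (sum-const m (n * x))

sum₂-* : ∀ {m n} (f : Fin m → ℕ) (g : Fin n → ℕ) → sum₂ (λ u v → f u * g v) ≡ sum f * sum g
sum₂-* f g = trans (sum-cong λ u → sym (sum-*ˡ (f u) g)) (sym (sum-*ʳ (sum g) f))

count : ∀ {n} → (Fin n → Bool) → ℕ
count P = sum λ v → ⟦ P v ⟧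

choose : ∀ {n} k (P : Fin n → Bool) → k ≤ count P →
         Σ (Fin k → Fin n) λ f → Injective _≡_ _≡_ f × (∀ i → P (f i) ≡ true)
choose zero P h = (λ ()) , (λ {}) , λ ()
choose {zero} (suc k) P h = contradiction (≤-trans h (≤-reflexive (sum-empty _))) λ ()
choose {suc n} (suc k) P h with P zero in P0 | ≤-trans h (≤-reflexive (sum-suc _))
... | true | h′ = let f , inj , sound = choose k (P ∘ suc) (s≤s⁻¹ h′) in
  (zero ◂ (suc ∘ f)) ,
  (λ { {zero} {zero} _ → refl ; {suc i} {suc j} e → cong suc (inj (Finₚ.suc-injective e)) }) ,
  (λ { zero → P0 ; (suc i) → sound i })
... | false | h′ = let f , inj , sound = choose (suc k) (P ∘ suc) h′ in
  suc ∘ f , inj ∘ Finₚ.suc-injective , sound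

count-witness : ∀ {n} (P : Fin n → Bool) → 1 ≤ count P → ∃[ v ] P v ≡ true
count-witness P h = let f , _ , sound = choose 1 P h in f zero , sound zero

-- Each counted index contributes at least `s` to the sum. This turns a bound on all missing pairs
-- into a bound on the number of exceptional vertices.
markov : ∀ {n} (f : Fin n → ℕ) s N → .{{NonZero s}} → sum f ≤ N * s → count (λ v → s ≤ᵇ f v) ≤ N
markov {n} f s N h = *-cancelʳ-≤ _ N s (≤-trans (≤-reflexive (sum-*ʳ s _)) (≤-trans (sum-mono large) h))
  where
  large : ∀ v → ⟦ s ≤ᵇ f v ⟧ * s ≤ f v
  large v with s ≤ᵇ f v in eq
  ... | true = ≤-trans (≤-reflexive (+-identityʳ s)) (≤ᵇ⇒≤ s (f v) (subst Data.Bool.T (sym eq) _))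
  ... | false = z≤n

length-filter-tabulate : ∀ {a} {A : Set a} {P : A → Set} (P? : ∀ x → Dec (P x)) {n} (f : Fin n → A) →
                         length (filter P? (tabulate f)) ≡ count (λ i → ⌊ P? (f i) ⌋)
length-filter-tabulate P? {zero} f = sym (sum-empty _)
length-filter-tabulate P? {suc n} f rewrite sum-suc (λ i → ⟦ ⌊ P? (f i) ⌋ ⟧) with P? (f zero)
... | yes _ = cong suc (length-filter-tabulate P? (f ∘ suc))
... | no _ = length-filter-tabulate P? (f ∘ suc)

-- Translates the list-based count in `edges` into a double sum, the form in which all counting is
-- done.
length-filter-product : ∀ {n} {P : Fin n × Fin n → Set} (P? : ∀ x → Dec (P x)) →
  length (filter P? (cartesianProduct (allFin n) (allFin n))) ≡ sum₂ (λ u v → ⟦ ⌊ P? (u , v) ⌋ ⟧)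
length-filter-product {n} {P} P? = go id
  where
  row : ∀ u {m} (g : Fin m → Fin n) → length (filter P? (map (u ,_) (tabulate g))) ≡ count (λ v → ⌊ P? (u , g v) ⌋)
  row u {zero} g = sym (sum-empty _)
  row u {suc m} g rewrite sum-suc (λ v → ⟦ ⌊ P? (u , g v) ⌋ ⟧) with P? (u , g zero)
  ... | yes _ = cong suc (row u (g ∘ suc))
  ... | no _ = row u (g ∘ suc)
  go : ∀ {m} (f : Fin m → Fin n) →
       length (filter P? (cartesianProduct (tabulate f) (allFin n))) ≡ sum₂ (λ u v → ⟦ ⌊ P? (f u , v) ⌋ ⟧)
  go {zero} f = sym (sum-empty _)
  go {suc m} f = begin
    length (filter P? (map (f zero ,_) (allFin n) ++ rest))                          ≡⟨ cong length (filter-++ P? (map (f zero ,_) (allFin n)) rest) ⟩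
    length (filter P? (map (f zero ,_) (allFin n)) ++ filter P? rest)                ≡⟨ length-++ (filter P? (map (f zero ,_) (allFin n))) ⟩
    length (filter P? (map (f zero ,_) (allFin n))) + length (filter P? rest)        ≡⟨ cong₂ _+_ (row (f zero) id) (go (f ∘ suc)) ⟩
    count (λ v → ⌊ P? (f zero , v) ⌋) + sum₂ (λ u v → ⟦ ⌊ P? (f (suc u) , v) ⌋ ⟧)     ≡⟨ sym (sum-suc (λ u → count (λ v → ⌊ P? (f u , v) ⌋))) ⟩
    sum₂ (λ u v → ⟦ ⌊ P? (f u , v) ⌋ ⟧)                                              ∎
    where
    open ≡-Reasoning
    rest = cartesianProduct (tabulate (f ∘ suc)) (allFin n)

sum₂-sym : ∀ {n} (f : Fin n → Fin n → ℕ) → sum₂ (λ u v → f u v + f v u) ≡ sum₂ f + sum₂ f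
sum₂-sym f = trans (sum₂-+ f (λ u v → f v u)) (cong (sum₂ f +_) (sum-comm (λ u v → f v u)))

sum-strict : ∀ {n} {f g : Fin n → ℕ} → (∀ x → f x ≤ g x) → ∀ i → f i < g i → suc (sum f) ≤ sum g
sum-strict {f = f} {g} h i lt = begin
  suc (sum f)                   ≡⟨ trans (+-comm 1 (sum f)) (sym (cong (sum f +_) (sum-δ₁ i))) ⟩
  sum f + sum (δ i)             ≡⟨ sym (sum-+ f (δ i)) ⟩
  sum (λ x → f x + δ i x)       ≤⟨ sum-mono pointwise ⟩
  sum g                         ∎
  where
  open ≤-Reasoning
  pointwise : ∀ x → f x + δ i x ≤ g x
  pointwise x with x ≟ᶠ i
  ... | yes refl = ≤-trans (≤-reflexive (+-comm (f x) 1)) lt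
  ... | no _ = ≤-trans (≤-reflexive (+-identityʳ _)) (h x)

-- Serves for symmetric weights: one additional missing pair shows up in the rows of both its ends.
sum-strict₂ : ∀ {n} {f g : Fin n → ℕ} → (∀ x → f x ≤ g x) → ∀ {i j} → i ≢ j → f i < g i → f j < g j → 2 + sum f ≤ sum g
sum-strict₂ {f = f} {g} h {i} {j} i≢j lti ltj = begin
  2 + sum f                     ≡⟨ cong suc (trans (+-comm 1 (sum f)) (sym (cong (sum f +_) (sum-δ₁ i)))) ⟩
  suc (sum f + sum (δ i))       ≡⟨ cong suc (sym (sum-+ f (δ i))) ⟩
  suc (sum (λ x → f x + δ i x)) ≤⟨ sum-strict pointwise j at-j ⟩
  sum g                         ∎
  where
  open ≤-Reasoning
  pointwise : ∀ x → f x + δ i x ≤ g x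
  pointwise x with x ≟ᶠ i
  ... | yes refl = ≤-trans (≤-reflexive (+-comm (f x) 1)) lti
  ... | no _ = ≤-trans (≤-reflexive (+-identityʳ _)) (h x)
  at-j : f j + δ i j < g j
  at-j rewrite δ-≢ (i≢j ∘ sym) = ≤-trans (s≤s (≤-reflexive (+-identityʳ _))) ltj

sum-two : ∀ {n} (f : Fin n → ℕ) {u w} → u ≢ w → f u + f w ≤ sum f
sum-two f {u} {w} u≢w = ≤-trans (≤-reflexive (sym (trans (sum-+ _ _) (cong₂ _+_ (sum-δ u f) (sum-δ w f))))) (sum-mono pointwise)
  where
  pointwise : ∀ x → δ u x * f x + δ w x * f x ≤ f x
  pointwise x with x ≟ᶠ u | x ≟ᶠ w
  ... | yes refl | yes refl = contradiction refl u≢w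
  ... | yes refl | no _ = ≤-reflexive (trans (+-identityʳ _) (+-identityʳ _))
  ... | no _ | yes refl = ≤-reflexive (+-identityʳ _)
  ... | no _ | no _ = z≤n

sum-three : ∀ {n} (f : Fin n → ℕ) {u w z} → u ≢ w → u ≢ z → w ≢ z → f u + f w + f z ≤ sum f
sum-three f {u} {w} {z} u≢w u≢z w≢z =
  ≤-trans (≤-reflexive (sym (trans (sum-+ _ _) (cong₂ _+_ (trans (sum-+ _ _) (cong₂ _+_ (sum-δ u f) (sum-δ w f))) (sum-δ z f))))) (sum-mono pointwise)
  where
  pointwise : ∀ x → δ u x * f x + δ w x * f x + δ z x * f x ≤ f x
  pointwise x with x ≟ᶠ u | x ≟ᶠ w | x ≟ᶠ z
  ... | yes refl | yes refl | _ = contradiction refl u≢w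
  ... | yes refl | _ | yes refl = contradiction refl u≢z
  ... | _ | yes refl | yes refl = contradiction refl w≢z
  ... | yes refl | no _ | no _ = ≤-reflexive (trans (+-identityʳ _) (trans (+-identityʳ _) (+-identityʳ _)))
  ... | no _ | yes refl | no _ = ≤-reflexive (trans (+-identityʳ _) (+-identityʳ _))
  ... | no _ | no _ | yes refl = ≤-reflexive (+-identityʳ _)
  ... | no _ | no _ | no _ = z≤n

⟦∧⟧≤ : ∀ {a b m} → (a ≡ true → b ≡ true → 1 ≤ m) → ⟦ a ∧ b ⟧ ≤ m
⟦∧⟧≤ {true} {true} h = h refl refl
⟦∧⟧≤ {true} {false} h = z≤n
⟦∧⟧≤ {false} h = z≤n

-- Finding book graphs

module _ {n} (G : Graph n) where

  Clique : ∀ {m} → (Fin m → Fin n) → Set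
  Clique Q = ∀ a b → a ≢ b → adj G (Q a) (Q b) ≡ true

  Joined : ∀ {m} → (Fin m → Fin n) → (Fin n → Bool) → Set
  Joined Q A = ∀ v → A v ≡ true → ∀ a → adj G (Q a) v ≡ true

  clique-∅ : Clique {0} (λ ())
  clique-∅ ()

  clique-cons : ∀ {m x} {Q : Fin m → Fin n} → Clique Q → (∀ a → adj G (Q a) x ≡ true) → Clique (x ◂ Q)
  clique-cons K j zero zero ne = contradiction refl ne
  clique-cons {x = x} {Q} K j zero (suc b) ne = trans (adjSym G x (Q b)) (j b)
  clique-cons K j (suc a) zero ne = j a
  clique-cons K j (suc a) (suc b) ne = K a b (ne ∘ cong suc)

  joined-cons : ∀ {m x} {Q : Fin m → Fin n} {A} → Joined Q A → Joined (x ◂ Q) (λ v → A v ∧ adj G x v)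
  joined-cons j v e zero = proj₂ (∧-true e)
  joined-cons j v e (suc a) = j v (proj₁ (∧-true e)) a

  adj-≢ : ∀ {u v} → adj G u v ≡ true → u ≢ v
  adj-≢ {u} e refl with trans (sym e) (adjIrrefl G u)
  ... | ()

  -- Adjacent vertices are distinct, so the spine is injective because it is a clique, and the pages
  -- avoid it because they are joined to it; only the pages have to be chosen injectively. Two pages
  -- are never adjacent in the book.
  book-embedding : ∀ {m} k (Q : Fin m → Fin n) → Clique Q → (A : Fin n → Bool) → Joined Q A → k ≤ count A →
                   Contains G (Book m k)
  book-embedding {m} k Q K A j h = f , f-inj , f-hom
    where
    pages = choose k A h
    g = proj₁ pages
    f : Fin (m + k) → Fin n
    f x = [ Q , g ]′ (splitAt m x)
    Qg : ∀ a b → adj G (Q a) (g b) ≡ true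
    Qg a b = j (g b) (proj₂ (proj₂ pages) b) a
    no-edge : ∀ a b → bookAdj m k (m ↑ʳ a) (m ↑ʳ b) ≡ false
    no-edge a b with toℕ (m ↑ʳ a) ≟ⁿ toℕ (m ↑ʳ b)
    ... | yes _ = refl
    ... | no _ with toℕ (m ↑ʳ a) <? m | toℕ (m ↑ʳ b) <? m
    ... | yes p | _ = contradiction (≤-trans (≤-reflexive (cong suc (sym (Finₚ.toℕ-↑ʳ m a)))) p) (m+n≮m m (toℕ a))
    ... | no _ | yes p = contradiction (≤-trans (≤-reflexive (cong suc (sym (Finₚ.toℕ-↑ʳ m b)))) p) (m+n≮m m (toℕ b))
    ... | no _ | no _ = refl
    f-inj : Injective _≡_ _≡_ f
    f-inj {x} {y} e with splitAt m x in ex | splitAt m y in ey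
    ... | inj₁ a | inj₁ b with a ≟ᶠ b
    ...   | yes refl = trans (sym (Finₚ.splitAt⁻¹-↑ˡ ex)) (Finₚ.splitAt⁻¹-↑ˡ ey)
    ...   | no ne = contradiction e (adj-≢ (K a b ne))
    f-inj e | inj₁ a | inj₂ b = contradiction e (adj-≢ (Qg a b))
    f-inj e | inj₂ a | inj₁ b = contradiction (sym e) (adj-≢ (Qg b a))
    f-inj e | inj₂ a | inj₂ b =
      trans (sym (Finₚ.splitAt⁻¹-↑ʳ ex)) (trans (cong (m ↑ʳ_) (proj₁ (proj₂ pages) e)) (Finₚ.splitAt⁻¹-↑ʳ ey))
    f-hom : ∀ x y → bookAdj m k x y ≡ true → adj G (f x) (f y) ≡ true
    f-hom x y e with splitAt m x in ex | splitAt m y in ey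
    ... | inj₁ a | inj₁ b = K a b λ { refl → case trans (sym e) (trans (cong (bookAdj m k x) (trans (sym
        (Finₚ.splitAt⁻¹-↑ˡ ey)) (Finₚ.splitAt⁻¹-↑ˡ ex))) (bookIrrefl m k x)) of λ () }
    ... | inj₁ a | inj₂ b = Qg a b
    ... | inj₂ a | inj₁ b = trans (adjSym G (g a) (Q b)) (Qg b a)
    ... | inj₂ a | inj₂ b = case trans (sym e) (trans (sym (cong₂ (bookAdj m k) (Finₚ.splitAt⁻¹-↑ʳ ex) (Finₚ.splitAt⁻¹-↑ʳ ey))) (no-edge a b)) of λ ()

module Coloured {n r} (G : Graph n) (c : Fin n → Fin r) where

  inn mis : Fin n → Fin n → ℕ
  inn x y = ⟦ (c x == c y) ∧ adj G x y ⟧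
  mis x y = ⟦ not (c x == c y) ∧ not (adj G x y) ⟧

  -- Twice the number of monochromatic edges and twice the number of missing cross pairs, since both
  -- orders are counted.
  I₂ M₂ : ℕ
  I₂ = sum₂ inn
  M₂ = sum₂ mis

  miss : Fin n → ℕ
  miss x = sum (mis x)

  size : Fin r → ℕ
  size j = count λ v → c v == j

  deg : Fin r → Fin n → ℕ
  deg j v = count λ y → (c y == j) ∧ adj G v y

  -- Vertices are picked one colour at a time; each pick costs at most s of every later colour,
  -- and a pick is possible while more than N vertices are left, as at most N miss s or more.
  greedy-book : ∀ {k} s N → 1 ≤ k → count (λ v → s ≤ᵇ miss v) ≤ N →
    ∀ t {m} (Q : Fin m → Fin n) → Clique G Q → (A : Fin n → Bool) → Joined G Q A →
    (js : Fin (suc t) → Fin r) → Injective _≡_ _≡_ js →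
    (∀ a → t * s + (N + k) ≤ count (λ v → A v ∧ (c v == js a))) → m + t ≡ r → Contains G (Book r k)
  -- There is one colour more in `js` than there are vertices to pick: the last colour supplies the
  -- pages.
  greedy-book {k} s N 1≤k few zero {m} Q K A j js inj large e =
    subst (λ r → Contains G (Book r k)) (trans (sym (+-identityʳ m)) e)
      (book-embedding G k Q K (λ v → A v ∧ (c v == js zero)) (λ v h → j v (proj₁ (∧-true h)))
        (≤-trans (m≤n+m k N) (large zero)))
  greedy-book {k} s N 1≤k few (suc t) {m} Q K A j js inj large e
    with Finₚ.any? (λ v → (A v ∧ (c v == js zero)) ∧ not (s ≤ᵇ miss v) ≟ᵇ true)
  ... | no none = contradiction (≤-trans (+-monoʳ-≤ N 1≤k) (≤-trans (m≤n+m _ (suc t * s)) (≤-trans (large zero) (≤-trans (sum-mono all-heavy) few)))) (m+1+n≰m N)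
    where
    all-heavy : ∀ v → ⟦ A v ∧ (c v == js zero) ⟧ ≤ ⟦ s ≤ᵇ miss v ⟧
    all-heavy v with A v ∧ (c v == js zero) in e₁ | s ≤ᵇ miss v in e₂
    ... | false | _ = z≤n
    ... | true | true = ≤-refl
    ... | true | false = contradiction (v , cong₂ _∧_ e₁ (cong not e₂)) none
  ... | yes (x , Px) = greedy-book s N 1≤k few t (x ◂ Q) (clique-cons G K (j x Ax)) (λ v → A v ∧ adj G x v) (joined-cons G j)
                         (js ∘ suc) (Finₚ.suc-injective ∘ inj) large′ (trans (sym (+-suc m t)) e)
    where
    Ax = proj₁ (∧-true (proj₁ (∧-true Px)))
    cx = ==-sound (proj₂ (∧-true {A x} (proj₁ (∧-true Px))))
    light : miss x ≤ s
    light with s ≤ᵇ miss x in eq | proj₂ (∧-true {A x ∧ _} Px)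
    ... | false | _ = ≰⇒≥ λ h → subst Data.Bool.T eq (≤⇒≤ᵇ h)
    large′ : ∀ a → t * s + (N + k) ≤ count (λ v → (A v ∧ adj G x v) ∧ (c v == js (suc a)))
    large′ a = +-cancelˡ-≤ s _ _ (begin
      s + (t * s + (N + k))                                                             ≡⟨ sym (+-assoc s (t * s) _) ⟩
      suc t * s + (N + k)                                                               ≤⟨ large (suc a) ⟩
      count (λ v → A v ∧ (c v == js (suc a)))                                           ≤⟨ sum-mono pointwise ⟩
      sum (λ v → mis x v + ⟦ (A v ∧ adj G x v) ∧ (c v == js (suc a)) ⟧)                ≡⟨ sum-+ (mis x) _ ⟩
      miss x + count (λ v → (A v ∧ adj G x v) ∧ (c v == js (suc a)))                    ≤⟨ +-monoˡ-≤ _ light ⟩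
      s + count (λ v → (A v ∧ adj G x v) ∧ (c v == js (suc a)))                         ∎)
      where
      open ≤-Reasoning
      pointwise : ∀ v → ⟦ A v ∧ (c v == js (suc a)) ⟧ ≤ mis x v + ⟦ (A v ∧ adj G x v) ∧ (c v == js (suc a)) ⟧
      pointwise v with A v | c v ≟ᶠ js (suc a) | adj G x v
      ... | false | _ | _ = z≤n
      ... | true | no _ | _ = z≤n
      ... | true | yes _ | true = m≤n+m 1 _
      ... | true | yes cv | false rewrite ==-false {x = c x} {c v} (λ h → case inj (trans (sym cx) (trans h cv)) of λ ()) = ≤-refl

-- A colouring with few monochromatic edges

argmax : ∀ {n} (f : Fin n → ℕ) (A : Fin n → Bool) →
         (Σ[ x ∈ Fin n ] A x ≡ true × (∀ y → A y ≡ true → f y ≤ f x)) ⊎ (∀ y → A y ≡ false)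
argmax {zero} f A = inj₂ λ ()
argmax {suc n} f A with argmax (f ∘ suc) (A ∘ suc) | A zero in A₀
... | inj₂ none | true = inj₁ (zero , A₀ , λ { zero _ → ≤-refl ; (suc y) Ay → case trans (sym Ay) (none y) of λ () })
... | inj₂ none | false = inj₂ λ { zero → A₀ ; (suc y) → none y }
... | inj₁ (x , Ax , max) | false = inj₁ (suc x , Ax , λ { zero A0 → case trans (sym A0) A₀ of λ () ; (suc y) → max y })
... | inj₁ (x , Ax , max) | true with ≤-total (f zero) (f (suc x))
...   | inj₁ f0≤ = inj₁ (suc x , Ax , λ { zero _ → f0≤ ; (suc y) → max y })
...   | inj₂ ≤f0 = inj₁ (zero , A₀ , λ { zero _ → ≤-refl ; (suc y) Ay → ≤-trans (max y Ay) ≤f0 })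

==-suc : ∀ {n} (x y : Fin n) → (Fin.suc x == suc y) ≡ (x == y)
==-suc x y with x ≟ᶠ y
... | yes refl = refl
... | no _ = refl

module Füredi {n r k} (G : Graph n) (free : Free (Book r k) G) where

  module _ {m} (A : Fin n → Bool) (c : Fin n → Fin m) where

    edgeᴬ innᴬ crossᴬ : Fin n → Fin n → ℕ
    edgeᴬ u v = ⟦ (A u ∧ A v) ∧ adj G u v ⟧
    innᴬ u v = ⟦ (A u ∧ A v) ∧ ((c u == c v) ∧ adj G u v) ⟧
    crossᴬ u v = ⟦ (A u ∧ A v) ∧ not (c u == c v) ⟧

  -- Colour 0 is given to the non-neighbours W in A of a vertex x of maximal degree in A; the edges of A
  -- meeting W, those inside W counted twice, then number at most |W| · |A ∩ N(x)|.
  furedi : ∀ m {t} (Q : Fin t → Fin n) → Clique G Q → (A : Fin n → Bool) → Joined G Q A → t + suc m ≡ r →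
    Σ[ c ∈ (Fin n → Fin (suc m)) ] sum₂ (λ u v → edgeᴬ A c u v + innᴬ A c u v) ≤ sum₂ (crossᴬ A c) + 2 * (n * k)
  -- With one colour left, `Q` together with any vertex of `A` is a full spine, so a vertex of `A`
  -- with `k` neighbours in `A` would give a book.
  furedi zero {t} Q K A j e = c , (begin
    sum₂ (λ u v → edgeᴬ A c u v + innᴬ A c u v)    ≤⟨ sum₂-mono (λ u v → +-monoʳ-≤ (edgeᴬ A c u v) (inn≤edge u v)) ⟩
    sum₂ (λ u v → edgeᴬ A c u v + edgeᴬ A c u v)   ≡⟨ sum₂-+ (edgeᴬ A c) (edgeᴬ A c) ⟩
    sum₂ (edgeᴬ A c) + sum₂ (edgeᴬ A c)            ≤⟨ +-mono-≤ total total ⟩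
    n * k + n * k                                  ≡⟨ cong (n * k +_) (sym (+-identityʳ _)) ⟩
    2 * (n * k)                                    ≤⟨ m≤n+m _ (sum₂ (crossᴬ A c)) ⟩
    sum₂ (crossᴬ A c) + 2 * (n * k)                ∎)
    where
    open ≤-Reasoning
    c : Fin n → Fin 1
    c _ = zero
    inn≤edge : ∀ u v → innᴬ A c u v ≤ edgeᴬ A c u v
    inn≤edge u v = ≤-refl
    row : ∀ u → sum (edgeᴬ A c u) ≤ k
    row u with A u in Au
    ... | false = ≤-trans (≤-reflexive (sum-zero λ _ → refl)) z≤n
    ... | true with k ≤? count (λ v → A v ∧ adj G u v)
    ...   | no k≰ = ≰⇒≥ k≰
    ...   | yes k≤ = ⊥-elim (free (subst (λ r → Contains G (Book r k)) (trans (+-comm 1 t) e)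
                       (book-embedding G k (u ◂ Q) (clique-cons G K (j u Au)) _ (joined-cons G j) k≤)))
    total : sum₂ (edgeᴬ A c) ≤ n * k
    total = ≤-trans (sum-mono row) (≤-reflexive (sum-const n k))
  furedi (suc m) {t} Q K A j e with argmax (λ x → count (λ v → A v ∧ adj G x v)) A
  ... | inj₂ none = (λ _ → zero) ,
        ≤-trans (≤-reflexive (sum-zero λ u → sum-zero λ v → cong (λ a → ⟦ (a ∧ A v) ∧ adj G u v ⟧ + ⟦ (a ∧ A v) ∧ adj G u v ⟧) (none u))) z≤n
  ... | inj₁ (x , Ax , max) = c′ , (begin
    sum₂ (λ u v → edgeᴬ A c′ u v + innᴬ A c′ u v)                                             ≡⟨ sum₂-cong edges-split ⟩
    sum₂ (λ u v → (edgeᴬ B c u v + innᴬ B c u v) + (deg-term u v + deg-term v u))             ≡⟨ sum₂-+ _ (λ u v → deg-term u v + deg-term v u) ⟩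
    sum₂ (λ u v → edgeᴬ B c u v + innᴬ B c u v) + sum₂ (λ u v → deg-term u v + deg-term v u)  ≤⟨ +-mono-≤ bound degrees ⟩
    sum₂ (crossᴬ B c) + 2 * (n * k) + sum₂ (λ u v → W u * ⟦ B v ⟧ + W v * ⟦ B u ⟧)            ≡⟨ swap-last (sum₂ (crossᴬ B c)) _ _ ⟩
    sum₂ (crossᴬ B c) + sum₂ (λ u v → W u * ⟦ B v ⟧ + W v * ⟦ B u ⟧) + 2 * (n * k)
      ≡⟨ cong (_+ 2 * (n * k)) (sym (trans (sum₂-cong cross-split) (sum₂-+ (crossᴬ B c) _))) ⟩
    sum₂ (crossᴬ A c′) + 2 * (n * k)                                                          ∎)
    where
    open ≤-Reasoning
    B : Fin n → Bool
    B v = A v ∧ adj G x v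
    ih = furedi m (x ◂ Q) (clique-cons G K (j x Ax)) B (joined-cons G j) (trans (sym (+-suc t (suc m))) e)
    c = proj₁ ih
    bound = proj₂ ih
    c′ : Fin n → Fin (suc (suc m))
    c′ v = if A v ∧ adj G x v then suc (c v) else zero
    W : Fin n → ℕ
    W u = ⟦ A u ∧ not (adj G x u) ⟧
    -- An edge inside W is charged from both of its ends, which pays for it once as an edge and once
    -- as a monochromatic edge.
    deg-term : Fin n → Fin n → ℕ
    deg-term u v = W u * ⟦ A v ∧ adj G u v ⟧
    swap-last : ∀ a b d → a + b + d ≡ a + d + b
    swap-last = solve-∀
    edges-split : ∀ u v → edgeᴬ A c′ u v + innᴬ A c′ u v ≡ (edgeᴬ B c u v + innᴬ B c u v) + (deg-term u v + deg-term v u)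
    edges-split u v rewrite adjSym G v u | sym (==-suc (c u) (c v)) with A u | A v | adj G x u | adj G x v | adj G u v
    ... | false | false | _ | _ | _ = refl
    ... | false | true | _ | true | _ = refl
    ... | false | true | _ | false | _ = refl
    ... | true | false | true | _ | _ = refl
    ... | true | false | false | _ | _ = refl
    ... | true | true | true | true | true = sym (+-identityʳ _)
    ... | true | true | true | true | false = sym (+-identityʳ _)
    ... | true | true | true | false | true = refl
    ... | true | true | true | false | false = refl
    ... | true | true | false | true | true = refl
    ... | true | true | false | true | false = refl
    ... | true | true | false | false | true = refl
    ... | true | true | false | false | false = refl
    cross-split : ∀ u v → crossᴬ A c′ u v ≡ crossᴬ B c u v + (W u * ⟦ B v ⟧ + W v * ⟦ B u ⟧)
    cross-split u v rewrite sym (==-suc (c u) (c v)) with A u | A v | adj G x u | adj G x v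
    ... | false | false | _ | _ = refl
    ... | false | true | _ | true = refl
    ... | false | true | _ | false = refl
    ... | true | false | true | _ = refl
    ... | true | false | false | _ = refl
    ... | true | true | true | true = sym (+-identityʳ _)
    ... | true | true | true | false = refl
    ... | true | true | false | true = refl
    ... | true | true | false | false = refl
    -- By the maximality of `x`, no vertex of W has more neighbours in `A` than the `count B`
    -- neighbours of `x`.
    half : sum₂ deg-term ≤ sum₂ (λ u v → W u * ⟦ B v ⟧)
    half = sum-mono λ u → ≤-trans (≤-reflexive (sym (sum-*ˡ (W u) _))) (≤-trans (weighted u) (≤-reflexive (sum-*ˡ (W u) _)))
      where
      weighted : ∀ u → W u * count (λ v → A v ∧ adj G u v) ≤ W u * count B
      weighted u with A u in Au
      ... | false = z≤n
      ... | true = *-monoʳ-≤ ⟦ not (adj G x u) ⟧ (max u Au)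
    degrees : sum₂ (λ u v → deg-term u v + deg-term v u) ≤ sum₂ (λ u v → W u * ⟦ B v ⟧ + W v * ⟦ B u ⟧)
    degrees = begin
      sum₂ (λ u v → deg-term u v + deg-term v u)                              ≡⟨ sum₂-sym deg-term ⟩
      sum₂ deg-term + sum₂ deg-term                                           ≤⟨ +-mono-≤ half half ⟩
      sum₂ (λ u v → W u * ⟦ B v ⟧) + sum₂ (λ u v → W u * ⟦ B v ⟧)             ≡⟨ sym (sum₂-sym (λ u v → W u * ⟦ B v ⟧)) ⟩
      sum₂ (λ u v → W u * ⟦ B v ⟧ + W v * ⟦ B u ⟧)                            ∎

  -- `furedi` started with the empty clique on all vertices. Adding the equally coloured pairs
  -- completes the cross pairs to `n * n`, ready for comparison with the density hypothesis.
  few-inner : ∀ m → suc m ≡ r → Σ[ c ∈ (Fin n → Fin (suc m)) ]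
    sum₂ (λ u v → ⟦ adj G u v ⟧) + Coloured.I₂ G c + sum₂ (λ u v → ⟦ c u == c v ⟧) ≤ n * n + 2 * (n * k)
  few-inner m e with furedi m (λ ()) (clique-∅ G) (λ _ → true) (λ _ _ ()) e
  ... | c , bound = c , (begin
    sum₂ (λ u v → ⟦ adj G u v ⟧) + Coloured.I₂ G c + same             ≡⟨ cong (_+ same) (sym (sum₂-+ _ _)) ⟩
    sum₂ (λ u v → ⟦ adj G u v ⟧ + Coloured.inn G c u v) + same        ≤⟨ +-monoˡ-≤ same bound ⟩
    sum₂ cross + 2 * (n * k) + same                                   ≡⟨ shuffle (sum₂ cross) (2 * (n * k)) same ⟩
    sum₂ cross + same + 2 * (n * k)
      ≡⟨ cong (_+ 2 * (n * k)) (trans (sym (sum₂-+ _ _)) (trans (sum₂-cong one) (trans (sum₂-const n n 1) (cong (n *_) (*-identityʳ n))))) ⟩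
    n * n + 2 * (n * k)                                               ∎)
    where
    open ≤-Reasoning
    same = sum₂ (λ u v → ⟦ c u == c v ⟧)
    cross = λ u v → ⟦ not (c u == c v) ⟧
    shuffle : ∀ a b d → a + b + d ≡ a + d + b
    shuffle = solve-∀
    one : ∀ u v → ⟦ not (c u == c v) ⟧ + ⟦ c u == c v ⟧ ≡ 1
    one u v with c u == c v
    ... | true = refl
    ... | false = refl

-- Locally optimal colourings

module _ {n r : ℕ} (G : Graph n) where

  open Coloured

  Optimal : (Fin n → Fin r) → Set
  Optimal c = ∀ v j → deg G c (c v) v ≤ deg G c j v

  same : (Fin n → Fin r) → Fin n → Fin n → ℕ
  same c u v = ⟦ c u == c v ⟧

  -- The exact balance behind all later estimates: relative to the complete multipartite graph on
  -- the colour classes, edges are gained by monochromatic pairs and lost by missing ones.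
  edges-identity : ∀ c → sum₂ (λ u v → ⟦ adj G u v ⟧) + M₂ G c + sum₂ (same c) ≡ n * n + I₂ G c
  edges-identity c = begin
    sum₂ a + M₂ G c + sum₂ (same c)                        ≡⟨ cong (_+ sum₂ (same c)) (sym (sum₂-+ a (mis G c))) ⟩
    sum₂ (λ u v → a u v + mis G c u v) + sum₂ (same c)     ≡⟨ sym (sum₂-+ _ (same c)) ⟩
    sum₂ (λ u v → a u v + mis G c u v + same c u v)        ≡⟨ sum₂-cong pointwise ⟩
    sum₂ (λ u v → 1 + inn G c u v)                         ≡⟨ sum₂-+ (λ _ _ → 1) (inn G c) ⟩
    sum₂ {n} {n} (λ _ _ → 1) + I₂ G c                      ≡⟨ cong (_+ I₂ G c) (trans (sum₂-const n n 1) (cong (n *_) (*-identityʳ n))) ⟩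
    n * n + I₂ G c                                         ∎
    where
    open ≡-Reasoning
    a = λ u v → ⟦ adj G u v ⟧
    pointwise : ∀ u v → a u v + mis G c u v + same c u v ≡ 1 + inn G c u v
    pointwise u v with adj G u v | c u == c v
    ... | true | true = refl
    ... | true | false = refl
    ... | false | true = refl
    ... | false | false = refl

  same-sizes : ∀ c → sum₂ (same c) ≡ sum (λ i → size G c i * size G c i)
  same-sizes c = begin
    sum₂ (same c)                                                       ≡⟨ sum₂-cong expand ⟩
    sum₂ (λ u v → sum (λ i → ⟦ c u == i ⟧ * ⟦ c v == i ⟧))              ≡⟨ sum-cong (λ u → sum-comm (λ v i → ⟦ c u == i ⟧ * ⟦ c v == i ⟧)) ⟩
    sum₂ (λ u i → sum (λ v → ⟦ c u == i ⟧ * ⟦ c v == i ⟧))              ≡⟨ sum-comm (λ u i → sum (λ v → ⟦ c u == i ⟧ * ⟦ c v == i ⟧)) ⟩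
    sum (λ i → sum₂ (λ u v → ⟦ c u == i ⟧ * ⟦ c v == i ⟧))              ≡⟨ sum-cong (λ i → sum₂-* (λ u → ⟦ c u == i ⟧) (λ v → ⟦ c v == i ⟧)) ⟩
    sum (λ i → size G c i * size G c i)                                 ∎
    where
    open ≡-Reasoning
    expand : ∀ u v → same c u v ≡ sum (λ i → ⟦ c u == i ⟧ * ⟦ c v == i ⟧)
    expand u v = trans (cong ⟦_⟧ (==-comm (c u) (c v))) (trans (sym (sum-δ (c u) (λ i → ⟦ c v == i ⟧)))
                   (sum-cong λ i → cong (λ b → ⟦ b ⟧ * ⟦ c v == i ⟧) (==-comm i (c u))))

  sizes-total : ∀ (c : Fin n → Fin r) → sum (size G c) ≡ n
  sizes-total c = trans (sum-comm (λ i v → ⟦ c v == i ⟧)) (trans (sum-cong λ v → trans (sum-cong λ i → cong ⟦_⟧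
      (==-comm (c v) i)) (sum-δ₁ (c v))) (trans (sum-const n 1) (*-identityʳ n)))

  inner-degree : ∀ (c : Fin n → Fin r) v → sum (inn G c v) ≡ deg G c (c v) v
  inner-degree c v = sum-cong λ y → cong (λ b → ⟦ b ∧ adj G v y ⟧) (==-comm (c v) (c y))

  recolour : (Fin n → Fin r) → Fin n → Fin r → Fin n → Fin r
  recolour c v j u = if u == v then j else c u

  -- Only pairs containing `v` change, and each is counted in both orders. The row and column of `v`
  -- are added on both sides (`star`), so that the comparison is pointwise and free of subtraction.
  recolour-I₂ : ∀ c v j → I₂ G (recolour c v j) + 2 * deg G c (c v) v ≡ I₂ G c + 2 * deg G c j v
  recolour-I₂ c v j = trans (sym (collect (inn G c′) (λ y → ⟦ (c y == c v) ∧ adj G v y ⟧))) (trans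
      (sum₂-cong pointwise) (collect (inn G c) (λ y → ⟦ (c y == j) ∧ adj G v y ⟧)))
    where
    c′ = recolour c v j
    star : (Fin n → ℕ) → Fin n → Fin n → ℕ
    star f x y = δ v x * f y + δ v y * f x
    collect : ∀ g f → sum₂ (λ x y → g x y + star f x y) ≡ sum₂ g + 2 * sum f
    collect g f = trans (sum₂-+ g (star f)) (cong (sum₂ g +_) (trans (sum₂-sym (λ x y → δ v x * f y))
                    (cong₂ _+_ (row f) (trans (row f) (sym (+-identityʳ _))))))
      where
      row : ∀ f → sum₂ (λ x y → δ v x * f y) ≡ sum f
      row f = trans (sum₂-* (δ v) f) (trans (cong (_* sum f) (sum-δ₁ v)) (*-identityˡ _))
    drop : ∀ {b} i → b ≡ false → ⟦ i ∧ b ⟧ ≡ 0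
    drop true refl = refl
    drop false _ = refl
    pointwise : ∀ x y → inn G c′ x y + star (λ y → ⟦ (c y == c v) ∧ adj G v y ⟧) x y ≡ inn G c x y + star (λ y → ⟦ (c y == j) ∧ adj G v y ⟧) x y
    pointwise x y with x ≟ᶠ v | y ≟ᶠ v
    ... | no _ | no _ = refl
    ... | yes refl | yes refl rewrite adjIrrefl G v = trans (cong₂ _+_ (drop (j == j) refl) (cong (λ z → z + 0 + (z + 0)) (drop (c v == c v) refl)))
                                          (sym (cong₂ _+_ (drop (c v == c v) refl) (cong (λ z → z + 0 + (z + 0)) (drop (c v == j) refl))))
    ... | yes refl | no _ rewrite ==-comm j (c y) | ==-comm (c v) (c y) = flip-sum ⟦ (c y == j) ∧ adj G v y ⟧ ⟦ (c y == c v) ∧ adj G v y ⟧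
      where
      flip-sum : ∀ a b → a + (b + 0 + 0) ≡ b + (a + 0 + 0)
      flip-sum = solve-∀
    ... | no _ | yes refl rewrite adjSym G x v = flip-sum ⟦ (c x == j) ∧ adj G v x ⟧ ⟦ (c x == c v) ∧ adj G v x ⟧
      where
      flip-sum : ∀ a b → a + (b + 0) ≡ b + (a + 0)
      flip-sum = solve-∀

  optimise : ∀ c → Acc _<_ (I₂ G c) → Σ[ c′ ∈ (Fin n → Fin r) ] I₂ G c′ ≤ I₂ G c × Optimal c′
  optimise c (acc rec) with Finₚ.any? (λ v → Finₚ.any? (λ j → deg G c j v <? deg G c (c v) v))
  ... | no none = c , ≤-refl , λ v j → ≮⇒≥ λ h → none (v , j , h)
  ... | yes (v , j , less) = let c′ , le , opt = optimise (recolour c v j) (rec drops) in c′ , ≤-trans le (<⇒≤ drops) , opt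
    where
    drops : I₂ G (recolour c v j) < I₂ G c
    drops = +-cancelʳ-≤ (2 * deg G c (c v) v) _ _ (begin
      suc (I₂ G (recolour c v j)) + 2 * deg G c (c v) v   ≡⟨ cong suc (recolour-I₂ c v j) ⟩
      suc (I₂ G c + 2 * deg G c j v)                      ≡⟨ sym (+-suc _ _) ⟩
      I₂ G c + suc (2 * deg G c j v)                      ≤⟨ +-monoʳ-≤ (I₂ G c) (*-monoʳ-< 2 less) ⟩
      I₂ G c + 2 * deg G c (c v) v                        ∎)
      where open ≤-Reasoning

-- The structure of a graph close to complete multipartite

module _ {n} (f : Fin n → Fin n → ℕ) (f-sym : ∀ x y → f x y ≡ f y x) (f-irrefl : ∀ x → f x x ≡ 0)
         {u w : Fin n} (u≢w : u ≢ w) (fuw : f u w ≡ 0) where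

  private
    rows : ∀ v → sum (λ x → f x v) ≡ sum (f v)
    rows v = sum-cong λ x → f-sym x v

  -- The rows and columns of `u` and `w` overlap only in positions where `f` vanishes.
  two-rows : 2 * (sum (f u) + sum (f w)) ≤ sum₂ f
  two-rows = begin
    2 * (sum (f u) + sum (f w))                                                    ≡⟨ twice (sum (f u)) (sum (f w)) ⟩
    sum (f u) + sum (f w) + (sum (f u) + sum (f w))
      ≡⟨ sym (cong₂ _+_ (trans (sum-+ _ _) (cong₂ _+_ (sum-δ u _) (sum-δ w _))) (trans (sum-+ _ _) (cong₂ _+_ (rows u) (rows w)))) ⟩
    sum (λ x → δ u x * sum (f x) + δ w x * sum (f x)) + sum (λ x → f x u + f x w)  ≡⟨ sym (sum-+ _ _) ⟩
    sum (λ x → δ u x * sum (f x) + δ w x * sum (f x) + (f x u + f x w))            ≤⟨ sum-mono pointwise ⟩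
    sum₂ f                                                                         ∎
    where
    open ≤-Reasoning
    twice : ∀ a b → 2 * (a + b) ≡ a + b + (a + b)
    twice = solve-∀
    one : ∀ a → a + 0 + 0 + 0 ≡ a
    one = solve-∀
    pointwise : ∀ x → δ u x * sum (f x) + δ w x * sum (f x) + (f x u + f x w) ≤ sum (f x)
    pointwise x with x ≟ᶠ u | x ≟ᶠ w
    ... | yes refl | yes refl = contradiction refl u≢w
    ... | yes refl | no _ rewrite f-irrefl x | fuw = ≤-reflexive (one (sum (f x)))
    ... | no _ | yes refl rewrite f-irrefl x | f-sym x u | fuw = ≤-reflexive (trans (+-identityʳ _) (+-identityʳ _))
    ... | no _ | no _ = sum-two (f x) u≢w

  -- The overlaps with the row and column of `z` consist of four further entries that may be
  -- nonzero, each at most one; hence the 4.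
  three-rows : (∀ x y → f x y ≤ 1) → ∀ {z} → u ≢ z → w ≢ z → 2 * (sum (f u) + sum (f w) + sum (f z)) ≤ sum₂ f + 4
  three-rows f≤1 {z} u≢z w≢z = begin
    2 * (sum (f u) + sum (f w) + sum (f z))                                       ≡⟨ twice (sum (f u)) (sum (f w)) (sum (f z)) ⟩
    sum (f u) + sum (f w) + sum (f z) + (sum (f u) + sum (f w) + sum (f z))
      ≡⟨ sym (cong₂ _+_ (picks (λ x → sum (f x)) ) (trans (sum-+ _ _) (cong₂ _+_ (trans (sum-+ _ _) (cong₂ _+_ (rows u) (rows w))) (rows z)))) ⟩
    sum (pick λ x → sum (f x)) + sum (λ x → f x u + f x w + f x z)                ≡⟨ sym (sum-+ _ _) ⟩
    sum (λ x → pick (λ x → sum (f x)) x + (f x u + f x w + f x z))                ≤⟨ sum-mono pointwise ⟩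
    sum (λ x → sum (f x) + (δ u x + δ w x + 2 * δ z x))                           ≡⟨ sum-+ _ _ ⟩
    sum₂ f + sum (λ x → δ u x + δ w x + 2 * δ z x)
      ≡⟨ cong (sum₂ f +_) (trans (sum-+ _ _) (cong₂ _+_ (trans (sum-+ _ _) (cong₂ _+_ (sum-δ₁ u) (sum-δ₁ w))) (trans (sym (sum-*ˡ 2 _)) (cong (2 *_) (sum-δ₁ z))))) ⟩
    sum₂ f + 4                                                                    ∎
    where
    open ≤-Reasoning
    twice : ∀ a b d → 2 * (a + b + d) ≡ a + b + d + (a + b + d)
    twice = solve-∀
    pick : (Fin n → ℕ) → Fin n → ℕ
    pick g x = δ u x * g x + δ w x * g x + δ z x * g x
    picks : ∀ g → sum (pick g) ≡ g u + g w + g z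
    picks g = trans (sum-+ _ _) (cong₂ _+_ (trans (sum-+ _ _) (cong₂ _+_ (sum-δ u g) (sum-δ w g))) (sum-δ z g))
    case-u : ∀ m a → m + 0 + 0 + 0 + (0 + 0 + a) + 1 + 0 ≡ m + (1 + 0 + 0) + a
    case-u = solve-∀
    case-w : ∀ m a → m + 0 + 0 + (0 + 0 + a) + 1 + 0 ≡ m + (1 + 0) + a
    case-w = solve-∀
    case-z : ∀ m a b → m + 0 + (a + b + 0) + 2 + 0 ≡ m + 2 + (a + b)
    case-z = solve-∀
    pointwise : ∀ x → pick (λ x → sum (f x)) x + (f x u + f x w + f x z) ≤ sum (f x) + (δ u x + δ w x + 2 * δ z x)
    pointwise x with x ≟ᶠ u | x ≟ᶠ w | x ≟ᶠ z
    ... | yes refl | yes refl | _ = contradiction refl u≢w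
    ... | yes refl | _ | yes refl = contradiction refl u≢z
    ... | _ | yes refl | yes refl = contradiction refl w≢z
    ... | yes refl | no _ | no _ rewrite f-irrefl x | fuw = lin 0 (f≤1 x z) (case-u (sum (f x)) (f x z))
    ... | no _ | yes refl | no _ rewrite f-irrefl x | f-sym x u | fuw = lin 0 (f≤1 x z) (case-w (sum (f x)) (f x z))
    ... | no _ | no _ | yes refl rewrite f-irrefl x = lin 0 (+-mono-≤ (f≤1 x u) (f≤1 x w)) (case-z (sum (f x)) (f x u) (f x w))
    ... | no _ | no _ | no _ = ≤-trans (sum-three (f x) u≢w u≢z w≢z) (≤-reflexive (sym (+-identityʳ _)))

-- `s` and `N` drive the greedy choice, and `T` candidates per part make it succeed. The threshold
-- `h` is such that two vertices missing less than `h` each leave more than `T` common neighbours in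
-- every part; at most `H` vertices reach it.
module Structure {ρ n k} (G : Graph n) (free : Free (Book (3 + ρ) k) G) (1≤k : 1 ≤ k)
  (c : Fin n → Fin (3 + ρ)) (opt : Optimal G c)
  (s N h H T : ℕ) (few : count (λ v → s ≤ᵇ Coloured.miss G c v) ≤ N) (few-heavy : count (λ v → h ≤ᵇ Coloured.miss G c v) ≤ H)
  (T-large : (2 + ρ) * s + (N + k) ≤ T)
  (size-h : ∀ j → 2 * h + T ≤ Coloured.size G c j)
  (size-Γ : ∀ j → 3 * ((H + 1) * T + 2) + T + 1 ≤ Coloured.size G c j) where

  open Coloured G c

  -- Bounds the misses that remain possible once `u` and `w` together miss nearly all of `V_j`; the
  -- summand 2 is half the overlap in `three-rows`.
  Γ : ℕ
  Γ = (H + 1) * T + 2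

  missᶜ : Fin (3 + ρ) → Fin n → ℕ
  missᶜ j x = count λ y → (c y == j) ∧ not (adj G x y)

  mis-sym : ∀ x y → mis x y ≡ mis y x
  mis-sym x y = cong₂ (λ a b → ⟦ not a ∧ not b ⟧) (==-comm (c x) (c y)) (adjSym G x y)

  mis-irrefl : ∀ x → mis x x ≡ 0
  mis-irrefl x rewrite ==-true {x = c x} refl = refl

  missᶜ≤miss : ∀ {j x} → c x ≢ j → missᶜ j x ≤ miss x
  missᶜ≤miss {j} {x} ne = sum-mono pointwise
    where
    pointwise : ∀ y → ⟦ (c y == j) ∧ not (adj G x y) ⟧ ≤ mis x y
    pointwise y with c y ≟ᶠ j
    ... | no _ = z≤n
    ... | yes refl rewrite ==-false ne = ≤-refl

  missᶜ₂≤miss : ∀ {j l x} → c x ≢ j → c x ≢ l → j ≢ l → missᶜ j x + missᶜ l x ≤ miss x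
  missᶜ₂≤miss {j} {l} {x} ne ne′ j≢l = ≤-trans (≤-reflexive (sym (sum-+ _ _))) (sum-mono pointwise)
    where
    pointwise : ∀ y → ⟦ (c y == j) ∧ not (adj G x y) ⟧ + ⟦ (c y == l) ∧ not (adj G x y) ⟧ ≤ mis x y
    pointwise y with c y ≟ᶠ j | c y ≟ᶠ l
    ... | yes refl | yes refl = contradiction refl j≢l
    ... | yes refl | no _ rewrite ==-false ne = ≤-reflexive (+-identityʳ _)
    ... | no _ | yes refl rewrite ==-false ne′ = ≤-refl
    ... | no _ | no _ = z≤n

  common₂ : Fin n → Fin n → Fin n → Bool
  common₂ x y v = adj G x v ∧ adj G y v

  clique₁ : ∀ x → Clique G (x ◂ ∅)
  clique₁ x zero zero ne = contradiction refl ne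

  joined₁ : ∀ x → Joined G (x ◂ ∅) (adj G x)
  joined₁ x v e zero = e

  clique₂ : ∀ {x y} → adj G x y ≡ true → Clique G (y ◂ (x ◂ ∅))
  clique₂ {x} e = clique-cons G (clique₁ x) λ { zero → e ; (suc ()) }

  clique₃ : ∀ {x y z} → adj G x y ≡ true → adj G x z ≡ true → adj G y z ≡ true → Clique G (z ◂ (y ◂ (x ◂ ∅)))
  clique₃ e₁ e₂ e₃ = clique-cons G (clique₂ e₁) λ { zero → e₃ ; (suc zero) → e₂ ; (suc (suc ())) }

  no-book : ∀ t {m} (Q : Fin m → Fin n) → Clique G Q → (A : Fin n → Bool) → Joined G Q A →
            (js : Fin (suc t) → Fin (3 + ρ)) → Injective _≡_ _≡_ js → m + t ≡ 3 + ρ → t ≤ 2 + ρ →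
            ¬ (∀ a → T ≤ count (λ v → A v ∧ (c v == js a)))
  no-book t Q K A j js inj e t≤ large =
    free (greedy-book s N 1≤k few t Q K A j js inj (λ a → ≤-trans (+-monoˡ-≤ (N + k) (*-monoˡ-≤ s t≤)) (≤-trans T-large (large a))) e)

  -- By optimality a vertex with `T` neighbours in its own part has `T` in every part. It is then a
  -- spine vertex; of the `3 + ρ` colours, its own included, all but one supply the rest of the
  -- spine and the last one the pages.
  inner-small : ∀ v → deg (c v) v < T
  inner-small v = ≰⇒> λ T≤ → no-book (2 + ρ) (v ◂ ∅) (clique₁ v) (adj G v) (joined₁ v) id id refl ≤-refl
    λ j → ≤-trans T≤ (≤-trans (opt v j) (≤-reflexive (sum-cong λ y → cong ⟦_⟧ (∧-comm (c y == j) (adj G v y)))))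

  -- Otherwise `u` and `w` start a spine, and the `2 + ρ` other colours supply the `1 + ρ` remaining
  -- spine vertices and the pages.
  few-common : ∀ {u w} → c u ≡ c w → adj G u w ≡ true → ∃[ j ] j ≢ c u × count (λ y → common₂ u w y ∧ (c y == j)) < T
  few-common {u} {w} cuw e with Finₚ.any? (λ a → count (λ y → common₂ u w y ∧ (c y == punchIn (c u) a)) <? T)
  ... | yes (a , lt) = punchIn (c u) a , Finₚ.punchInᵢ≢i (c u) a , lt
  ... | no none = ⊥-elim (no-book (1 + ρ) (w ◂ (u ◂ ∅)) (clique₂ e) (common₂ u w) (joined-cons G (joined₁ u)) (punchIn (c u))
                    (λ {a} {b} → Finₚ.punchIn-injective (c u) a b) refl (n≤1+n _) λ a → ≮⇒≥ λ lt → none (a , lt))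

  size≤missᶜ : ∀ j u w → size j ≤ missᶜ j u + missᶜ j w + count (λ y → common₂ u w y ∧ (c y == j))
  size≤missᶜ j u w = ≤-trans (sum-mono pointwise) (≤-reflexive (trans (sum-+ _ _) (cong (_+ count (λ y → common₂ u w y ∧ (c y == j))) (sum-+ _ _))))
    where
    pointwise : ∀ y → ⟦ c y == j ⟧ ≤ ⟦ (c y == j) ∧ not (adj G u y) ⟧ + ⟦ (c y == j) ∧ not (adj G w y) ⟧ + ⟦ common₂ u w y ∧ (c y == j) ⟧
    pointwise y with c y == j | adj G u y | adj G w y
    ... | false | _ | _ = z≤n
    ... | true | false | _ = s≤s z≤n
    ... | true | true | false = s≤s z≤n
    ... | true | true | true = ≤-refl

  inner-miss : ∀ {u w} → c u ≡ c w → adj G u w ≡ true → ∃[ j ] size j ≤ miss u + miss w + T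
  inner-miss {u} {w} cuw e with few-common cuw e
  ... | j , j≢ , lt = j , ≤-trans (size≤missᶜ j u w) (+-mono-≤ (+-mono-≤ (missᶜ≤miss (j≢ ∘ sym)) (missᶜ≤miss (j≢ ∘ sym ∘ trans cuw))) (<⇒≤ lt))

  -- By `inner-miss` and `size-h` some end of every monochromatic edge misses `h` or more. There are
  -- at most `H` such vertices, each with fewer than `T` neighbours in its own part.
  I₂-small : I₂ ≤ 2 * (H * T)
  I₂-small = begin
    I₂                                                     ≤⟨ sum₂-mono pointwise ⟩
    sum₂ (λ u w → heavy-inn u w + heavy-inn w u)           ≡⟨ sum₂-sym heavy-inn ⟩
    sum₂ heavy-inn + sum₂ heavy-inn                        ≤⟨ +-mono-≤ half half ⟩
    H * T + H * T                                          ≡⟨ cong (H * T +_) (sym (+-identityʳ _)) ⟩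
    2 * (H * T)                                            ∎
    where
    open ≤-Reasoning
    heavy : Fin n → Bool
    heavy v = h ≤ᵇ miss v
    heavy-inn : Fin n → Fin n → ℕ
    heavy-inn u w = ⟦ heavy u ⟧ * inn u w
    light : ∀ v → heavy v ≡ false → miss v < h
    light v e = ≰⇒> λ le → subst Data.Bool.T e (≤⇒≤ᵇ le)
    heavy-end : ∀ u w → c u ≡ c w → adj G u w ≡ true → 1 ≤ ⟦ heavy u ⟧ + ⟦ heavy w ⟧
    heavy-end u w cuw e with heavy u in eu | heavy w in ew
    ... | true | _ = s≤s z≤n
    ... | false | true = s≤s z≤n
    ... | false | false with inner-miss cuw e
    ...   | j , le = contradiction (≤-trans (size-h j) (≤-trans le (+-monoˡ-≤ T (+-monoʳ-≤ (miss u) (<⇒≤ (light w ew))))))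
                       (<⇒≱ (≤-trans (+-monoˡ-< T (+-monoˡ-< h (light u eu))) (≤-reflexive (cong (λ a → h + a + T) (sym (+-identityʳ h))))))
    pointwise : ∀ u w → inn u w ≤ heavy-inn u w + heavy-inn w u
    pointwise u w with c u ≟ᶠ c w | adj G u w in e
    ... | no _ | _ = z≤n
    ... | yes _ | false = z≤n
    ... | yes cuw | true rewrite ==-true (sym cuw) | trans (adjSym G w u) e =
      ≤-trans (heavy-end u w cuw e) (≤-reflexive (sym (cong₂ _+_ (*-identityʳ ⟦ heavy u ⟧) (*-identityʳ ⟦ heavy w ⟧))))
    half : sum₂ heavy-inn ≤ H * T
    half = begin
      sum₂ heavy-inn
        ≡⟨ sum-cong (λ u → trans (sym (sum-*ˡ ⟦ heavy u ⟧ (inn u))) (cong (⟦ heavy u ⟧ *_) (inner-degree G c u))) ⟩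
      sum (λ u → ⟦ heavy u ⟧ * deg (c u) u)                ≤⟨ sum-mono (λ u → *-monoʳ-≤ ⟦ heavy u ⟧ (<⇒≤ (inner-small u))) ⟩
      sum (λ u → ⟦ heavy u ⟧ * T)                          ≡⟨ sym (sum-*ʳ T _) ⟩
      count heavy * T                                      ≤⟨ *-monoˡ-≤ T few-heavy ⟩
      H * T                                                ∎

  -- `M₂-small` carries the density into this module. Undoubled, it says that the missing cross
  -- pairs are fewer than the monochromatic edges plus |V_j|.
  module InnerEdge {u w} (cuw : c u ≡ c w) (uw : adj G u w ≡ true) {j} (j≢i : j ≢ c u)
    (common-small : count (λ y → common₂ u w y ∧ (c y == j)) < T) (M₂-small : M₂ < I₂ + 2 * size j) where

    i : Fin (3 + ρ)
    i = c u

    u≢w : u ≢ w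
    u≢w = adj-≢ G uw

    wu : adj G w u ≡ true
    wu = trans (adjSym G w u) uw

    private
      muw : mis u w ≡ 0
      muw rewrite ==-true cuw = refl

    missᶜ≤missᵘ : missᶜ j u ≤ miss u
    missᶜ≤missᵘ = missᶜ≤miss (j≢i ∘ sym)

    missᶜ≤missʷ : missᶜ j w ≤ miss w
    missᶜ≤missʷ = missᶜ≤miss (j≢i ∘ sym ∘ trans cuw)

    M₂-budget : M₂ < 2 * (H * T) + 2 * (missᶜ j u + missᶜ j w + T)
    M₂-budget = ≤-trans (M₂-small) (+-mono-≤ I₂-small (*-monoʳ-≤ 2 (≤-trans (size≤missᶜ j u w) (+-monoʳ-≤ _ (<⇒≤ common-small)))))

    -- The misses of `u` and `w` enter `M₂` twice, while `M₂` is at most slightly above twice their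
    -- misses inside `V_j`. So almost all their misses lie in `V_j`.
    pair-budget : miss u + miss w < missᶜ j u + missᶜ j w + (H + 1) * T
    pair-budget = *-cancelˡ-< 2 _ _ (≤-trans (s≤s (two-rows mis mis-sym mis-irrefl u≢w muw)) (≤-trans M₂-budget (≤-reflexive (arith H T (missᶜ j u + missᶜ j w)))))
      where
      arith : ∀ H T m → 2 * (H * T) + 2 * (m + T) ≡ 2 * (m + (H + 1) * T)
      arith = solve-∀

    -- The rows of `u` and `w` nearly exhaust `M₂`, and a third row shares at most four entries with
    -- them.
    other-miss : ∀ {z} → u ≢ z → w ≢ z → miss z ≤ Γ
    other-miss {z} u≢z w≢z = *-cancelˡ-≤ 2 (lin 1 (+-mono-≤ (+-mono-≤ (three-rows mis mis-sym mis-irrefl u≢w muw mis≤1 u≢z w≢z) M₂-budget)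
                               (*-monoʳ-≤ 2 (+-mono-≤ missᶜ≤missᵘ missᶜ≤missʷ)))
                               (arith (miss u) (miss w) (miss z) (missᶜ j u) (missᶜ j w) M₂ H T))
      where
      mis≤1 : ∀ x y → mis x y ≤ 1
      mis≤1 x y = ⟦⟧≤1 _
      arith : ∀ a b m a′ b′ M H T →
        2 * m + (M + 4 + (2 * (H * T) + 2 * (a′ + b′ + T)) + 2 * (a + b)) + 1 ≡
        2 * ((H + 1) * T + 2) + (2 * (a + b + m) + suc M + 2 * (a′ + b′))
      arith = solve-∀

    -- Misses in `V_j` and in `V_l` are disjoint parts of `miss u`, and `pair-budget` leaves little
    -- besides the former.
    outside-u : ∀ {l} → l ≢ i → l ≢ j → missᶜ l u ≤ Γ
    outside-u l≢i l≢j = lin 3 (+-mono-≤ (+-mono-≤ (missᶜ₂≤miss (j≢i ∘ sym) (l≢i ∘ sym) (l≢j ∘ sym)) missᶜ≤missʷ) pair-budget)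
                          (arith (missᶜ j u) (missᶜ _ u) (missᶜ j w) (miss u) (miss w) H T)
      where
      arith : ∀ a l b u w H T → l + (u + w + (a + b + (H + 1) * T)) + 3 ≡ (H + 1) * T + 2 + (a + l + b + suc (u + w))
      arith = solve-∀

    outside-w : ∀ {l} → l ≢ i → l ≢ j → missᶜ l w ≤ Γ
    outside-w l≢i l≢j = lin 3 (+-mono-≤ (+-mono-≤ (missᶜ₂≤miss (j≢i ∘ sym ∘ trans cuw) (l≢i ∘ sym ∘ trans cuw) (l≢j ∘ sym)) missᶜ≤missᵘ) pair-budget)
                          (arith (missᶜ j w) (missᶜ _ w) (missᶜ j u) (miss w) (miss u) H T)
      where
      arith : ∀ a l b u w H T → l + (u + w + (b + a + (H + 1) * T)) + 3 ≡ (H + 1) * T + 2 + (a + l + b + suc (w + u))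
      arith = solve-∀

    Two : Fin n → Set
    Two x = c x ≡ i ⊎ c x ≡ j

    near : ∀ {l x} → Two x → l ≢ i → l ≢ j → missᶜ l x ≤ Γ
    near {l} {x} two l≢i l≢j with x ≟ᶠ u | x ≟ᶠ w
    ... | yes refl | _ = outside-u l≢i l≢j
    ... | no _ | yes refl = outside-w l≢i l≢j
    ... | no x≢u | no x≢w = ≤-trans (missᶜ≤miss λ e → [ (λ p → l≢i (trans (sym e) p)) , (λ p → l≢j (trans (sym e) p)) ]′ two) (other-miss (x≢u ∘ sym) (x≢w ∘ sym))

    -- Three spine vertices in two parts are one more than a greedy choice would take there. Each
    -- misses at most `Γ` of any third part, so `size-Γ` leaves `T` common neighbours in each of the
    -- `1 + ρ` other parts: `ρ` of these complete the spine and the last supplies the pages.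
    triangle-free : ∀ {x y z} → Two x → Two y → Two z → adj G x y ≡ true → adj G x z ≡ true → adj G y z ≡ false
    triangle-free {x} {y} {z} tx ty tz xy xz with adj G y z in yz
    ... | false = refl
    ... | true = ⊥-elim (no-book ρ _ (clique₃ xy xz yz) common₃ (joined-cons G (joined-cons G (joined₁ x))) js js-inj refl (m≤n+m ρ 2) large)
      where
      common₃ : Fin n → Bool
      common₃ v = (adj G x v ∧ adj G y v) ∧ adj G z v
      -- `js` enumerates the colours other than `i` and `j` by skipping first `j`, seen among the
      -- colours different from `i`, and then `i`.
      j′ = punchOut (j≢i ∘ sym)
      js : Fin (suc ρ) → Fin (3 + ρ)
      js a = punchIn i (punchIn j′ a)
      js-inj : Injective _≡_ _≡_ js
      js-inj {a} {b} e = Finₚ.punchIn-injective j′ a b (Finₚ.punchIn-injective i _ _ e)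
      js≢j : ∀ a → js a ≢ j
      js≢j a e = Finₚ.punchInᵢ≢i j′ a (Finₚ.punchIn-injective i _ _ (trans e (sym (Finₚ.punchIn-punchOut (j≢i ∘ sym)))))
      large : ∀ a → T ≤ count (λ v → common₃ v ∧ (c v == js a))
      large a = lin 1 (+-mono-≤ (≤-trans (size-Γ l) cover) (+-mono-≤ (+-mono-≤ (close tx) (close ty)) (close tz)))
                  (arith Γ T (missᶜ l x) (missᶜ l y) (missᶜ l z) (count (λ v → common₃ v ∧ (c v == js a))))
        where
        l = js a
        close : ∀ {x} → Two x → missᶜ l x ≤ Γ
        close t = near t (Finₚ.punchInᵢ≢i i _) (js≢j a)
        arith : ∀ Γ T x y z d → T + (x + y + z + d + (Γ + Γ + Γ)) + 1 ≡ d + (3 * Γ + T + 1 + (x + y + z))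
        arith = solve-∀
        pointwise : ∀ v → ⟦ c v == l ⟧ ≤ ⟦ (c v == l) ∧ not (adj G x v) ⟧ + ⟦ (c v == l) ∧ not (adj G y v) ⟧ + ⟦ (c v == l) ∧ not (adj G z v) ⟧
                                        + ⟦ common₃ v ∧ (c v == l) ⟧
        pointwise v with c v == l | adj G x v | adj G y v | adj G z v
        ... | false | _ | _ | _ = z≤n
        ... | true | false | _ | _ = s≤s z≤n
        ... | true | true | false | _ = s≤s z≤n
        ... | true | true | true | false = s≤s z≤n
        ... | true | true | true | true = ≤-refl
        cover : size l ≤ missᶜ l x + missᶜ l y + missᶜ l z + count (λ v → common₃ v ∧ (c v == l))
        cover = ≤-trans (sum-mono pointwise) (≤-reflexive (trans (sum-+ _ _) (cong (_+ count (λ v → common₃ v ∧ (c v == l)))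
                  (trans (sum-+ _ _) (cong (_+ missᶜ l z) (sum-+ _ _))))))

    End : Fin n → Set
    End x = x ≡ u ⊎ x ≡ w

    end? : ∀ x → Dec (End x)
    end? x = (x ≟ᶠ u) ⊎-dec (x ≟ᶠ w)

    end-colour : ∀ {x} → End x → c x ≡ i
    end-colour (inj₁ refl) = refl
    end-colour (inj₂ refl) = sym cuw

    -- Two vertices different from `u` and `w` miss at most `2 * Γ` together, too little for a part
    -- to have fewer than `T` of their common neighbours.
    inner-ends : ∀ {x y} → c x ≡ c y → adj G x y ≡ true → End x ⊎ End y
    inner-ends {x} {y} e xy with end? x | end? y
    ... | yes ex | _ = inj₁ ex
    ... | no _ | yes ey = inj₂ ey
    ... | no nx | no ny with inner-miss e xy
    ...   | l , le = contradiction (≤-trans (size-Γ l) (≤-trans le (+-monoˡ-≤ T (+-mono-≤ (other x nx) (other y ny))))) (<⇒≱ (lin (Γ) ≤-refl (arith Γ T)))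
      where
      other : ∀ x → ¬ End x → miss x ≤ Γ
      other x nx = other-miss (nx ∘ inj₁ ∘ sym) (nx ∘ inj₂ ∘ sym)
      arith : ∀ Γ T → suc (Γ + Γ + T) + 0 + Γ ≡ 3 * Γ + T + 1 + 0
      arith = solve-∀

    -- A common neighbour of `u` and `w` in `V_j` would close a triangle, so the error term `T` of
    -- the earlier bound disappears.
    size≤ends : size j ≤ missᶜ j u + missᶜ j w
    size≤ends = ≤-trans (size≤missᶜ j u w) (≤-reflexive (trans (cong (missᶜ j u + missᶜ j w +_) (sum-zero none)) (+-identityʳ _)))
      where
      none : ∀ y → ⟦ common₂ u w y ∧ (c y == j) ⟧ ≡ 0
      none y with c y ≟ᶠ j | adj G u y in uy | adj G w y in wy
      ... | no _ | false | _ = refl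
      ... | no _ | true | false = refl
      ... | no _ | true | true = refl
      ... | yes _ | false | _ = refl
      ... | yes _ | true | false = refl
      ... | yes cy | true | true = case trans (sym wy) (triangle-free (inj₁ refl) (inj₁ (sym cuw)) (inj₂ cy) uw uy) of λ ()

    rest : Fin n → Bool
    rest x = (c x == i) ∧ not ⌊ end? x ⌋

    -- By `inner-ends`, the sum of `extra` counts all monochromatic edges other than `uw`, each
    -- once.
    extra : Fin n → ℕ
    extra x = ⟦ rest x ⟧ * (⟦ adj G x u ⟧ + ⟦ adj G x w ⟧)

    -- A further inner edge at an end v forces two misses, as its other endpoint x misses all of N(v) ∩ V_j.
    two-missing : ∀ {v v′ x} → Two x → c v ≡ i → adj G v v′ ≡ true → c v′ ≡ i → v′ ≢ x → c x ≡ i → adj G v x ≡ true → 2 ≤ missᶜ j x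
    two-missing {v} {v′} {x} tx cv vv′ cv′ v′≢x cx vx = begin
      2                                                                         ≡⟨ sym (cong₂ _+_ (inner-one cv′ vv′) (inner-one cx vx)) ⟩
      inner v′ + inner x                                                        ≤⟨ sum-two inner v′≢x ⟩
      deg (c v) v                                                               ≤⟨ opt v j ⟩
      deg j v                                                                   ≤⟨ sum-mono pointwise ⟩
      missᶜ j x                                                                 ∎
      where
      open ≤-Reasoning
      inner : Fin n → ℕ
      inner y = ⟦ (c y == c v) ∧ adj G v y ⟧
      inner-one : ∀ {y} → c y ≡ i → adj G v y ≡ true → inner y ≡ 1
      inner-one e vy rewrite vy | ==-true (trans e (sym cv)) = refl
      pointwise : ∀ y → ⟦ (c y == j) ∧ adj G v y ⟧ ≤ ⟦ (c y == j) ∧ not (adj G x y) ⟧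
      pointwise y with c y ≟ᶠ j | adj G v y in vy
      ... | no _ | _ = z≤n
      ... | yes _ | false = z≤n
      ... | yes cy | true rewrite triangle-free (inj₁ cv) tx (inj₂ cy) vx vy = ≤-refl

    -- `x` is adjacent to at most one of `u` and `w`, as there are no triangles, and that one edge
    -- costs two misses. The factor 2 is what makes further monochromatic edges a net loss.
    extra≤miss : ∀ {x} → c x ≡ i → ¬ End x → 2 * (⟦ adj G x u ⟧ + ⟦ adj G x w ⟧) ≤ missᶜ j x
    extra≤miss {x} cx nx with adj G x u in xu | adj G x w in xw
    ... | false | false = z≤n
    ... | true | false = two-missing (inj₁ cx) refl uw (sym cuw) (nx ∘ inj₂ ∘ sym) cx (trans (adjSym G u x) xu)
    ... | false | true = two-missing (inj₁ cx) (sym cuw) wu refl (nx ∘ inj₁ ∘ sym) cx (trans (adjSym G w x) xw)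
    ... | true | true = case trans (sym uw) (triangle-free (inj₁ cx) (inj₁ refl) (inj₁ (sym cuw)) xu xw) of λ ()

    -- Counts only the missing pairs between `V_i` and `V_j`: those at `u` and `w` cover `V_j`, and
    -- each other vertex of `V_i` adds twice its `extra`.
    M₂-lower : 2 * (size j + 2 * sum extra) ≤ M₂
    M₂-lower = begin
      2 * (size j + 2 * sum extra)                                            ≤⟨ *-monoʳ-≤ 2 (+-monoˡ-≤ (2 * sum extra) size≤ends) ⟩
      2 * (missᶜ j u + missᶜ j w + 2 * sum extra)
        ≡⟨ cong (2 *_) (sym (trans (sum-+ _ _) (cong₂ _+_ (trans (sum-+ _ _) (cong₂ _+_ (sum-δ u _) (sum-δ w _))) (sym (sum-*ˡ 2 extra))))) ⟩
      2 * sum (λ x → δ u x * missᶜ j x + δ w x * missᶜ j x + 2 * extra x)     ≤⟨ *-monoʳ-≤ 2 (sum-mono pointwise) ⟩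
      2 * sum (λ x → ⟦ c x == i ⟧ * missᶜ j x)                                ≡⟨ cong (2 *_) (sum-cong λ x → sum-*ˡ ⟦ c x == i ⟧ _) ⟩
      2 * sum₂ across                                                         ≡⟨ cong (sum₂ across +_) (+-identityʳ _) ⟩
      sum₂ across + sum₂ across                                               ≡⟨ sym (sum₂-sym across) ⟩
      sum₂ (λ x y → across x y + across y x)                                  ≤⟨ sum₂-mono across≤mis ⟩
      M₂                                                                      ∎
      where
      open ≤-Reasoning
      across : Fin n → Fin n → ℕ
      across x y = ⟦ c x == i ⟧ * ⟦ (c y == j) ∧ not (adj G x y) ⟧
      across≤mis : ∀ x y → across x y + across y x ≤ mis x y
      across≤mis x y rewrite adjSym G y x with c x ≟ᶠ i | c y ≟ᶠ j | c x ≟ᶠ j | c y ≟ᶠ i | c x ≟ᶠ c y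
      ... | _ | yes cy | _ | yes cy′ | _ = contradiction (trans (sym cy) cy′) j≢i
      ... | yes cx | _ | yes cx′ | _ | _ = contradiction (trans (sym cx′) cx) j≢i
      ... | yes cx | yes cy | _ | _ | yes e = contradiction (trans (sym cy) (trans (sym e) cx)) j≢i
      ... | _ | _ | yes cx | yes cy | yes e = contradiction (trans (sym cx) (trans e cy)) j≢i
      ... | no _ | _ | yes _ | yes _ | no _ = ≤-reflexive (+-identityʳ _)
      ... | no _ | _ | yes _ | no _ | _ = z≤n
      ... | no _ | _ | no _ | yes _ | _ = z≤n
      ... | no _ | _ | no _ | no _ | _ = z≤n
      ... | yes _ | yes _ | no _ | no _ | no _ = ≤-reflexive (trans (+-identityʳ _) (+-identityʳ _))
      ... | yes _ | no _ | no _ | no _ | _ = z≤n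
      ... | yes _ | no _ | no _ | yes _ | _ = z≤n
      pointwise : ∀ x → δ u x * missᶜ j x + δ w x * missᶜ j x + 2 * extra x ≤ ⟦ c x == i ⟧ * missᶜ j x
      pointwise x with x ≟ᶠ u | x ≟ᶠ w
      ... | yes refl | yes refl = contradiction refl u≢w
      ... | yes refl | no _ rewrite ==-true {x = i} refl = ≤-reflexive (trans (+-identityʳ _) (+-identityʳ _))
      ... | no _ | yes refl rewrite ==-true (sym cuw) = ≤-reflexive (+-identityʳ _)
      ... | no x≢u | no x≢w with c x ≟ᶠ i
      ...   | no _ = z≤n
      ...   | yes cx = ≤-trans (≤-reflexive (cong (2 *_) (+-identityʳ (⟦ adj G x u ⟧ + ⟦ adj G x w ⟧)))) (≤-trans
          (extra≤miss cx [ x≢u , x≢w ]′) (≤-reflexive (sym (+-identityʳ (missᶜ j x)))))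

    rest-true : ∀ {x} → c x ≡ i → ¬ End x → rest x ≡ true
    rest-true {x} cx nx rewrite ==-true cx with end? x
    ... | yes ex = contradiction ex nx
    ... | no _ = refl

    spoke : Fin n → Fin n → ℕ
    spoke x y = ⟦ rest x ⟧ * (δ u y * ⟦ adj G x y ⟧ + δ w y * ⟦ adj G x y ⟧)

    spoke≥1 : ∀ {x y} → c x ≡ i → ¬ End x → End y → adj G x y ≡ true → 1 ≤ spoke x y
    spoke≥1 cx nx (inj₁ refl) xy rewrite rest-true cx nx | xy | δ-refl u = s≤s z≤n
    spoke≥1 cx nx (inj₂ refl) xy rewrite rest-true cx nx | xy | δ-refl w = ≤-trans (m≤n+m 1 _) (≤-reflexive (sym (+-identityʳ _)))

    sum-spoke : sum₂ spoke ≡ sum extra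
    sum-spoke = sum-cong λ x → trans (sym (sum-*ˡ ⟦ rest x ⟧ _)) (cong (⟦ rest x ⟧ *_) (trans (sum-+ _ _) (cong₂ _+_ (sum-δ u _) (sum-δ w _))))

    bridge : Fin n → Fin n → ℕ
    bridge x y = δ u x * δ w y

    -- `bridge` accounts for the edge `uw` and `spoke` for edges from an end to the rest of `V_i`;
    -- `inner-ends` leaves no other kind.
    I₂-upper : I₂ ≤ 2 + 2 * sum extra
    I₂-upper = begin
      I₂                                                                        ≤⟨ sum₂-mono pointwise ⟩
      sum₂ (λ x y → (bridge x y + bridge y x) + (spoke x y + spoke y x))        ≡⟨ trans (sum₂-+ _ _) (cong₂ _+_ (sum₂-sym bridge) (sum₂-sym spoke)) ⟩
      sum₂ bridge + sum₂ bridge + (sum₂ spoke + sum₂ spoke)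
        ≡⟨ cong₂ _+_ (cong₂ _+_ one one) (cong₂ _+_ sum-spoke (trans sum-spoke (sym (+-identityʳ _)))) ⟩
      2 + 2 * sum extra                                                         ∎
      where
      open ≤-Reasoning
      one : sum₂ bridge ≡ 1
      one = trans (sum₂-* (δ u) (δ w)) (cong₂ _*_ (sum-δ₁ u) (sum-δ₁ w))
      covered : ∀ {x y} → c x ≡ c y → adj G x y ≡ true → Dec (End x) → Dec (End y) → 1 ≤ (bridge x y + bridge y x) + (spoke x y + spoke y x)
      covered e xy (yes (inj₁ refl)) (yes (inj₁ refl)) = contradiction refl (adj-≢ G xy)
      covered e xy (yes (inj₁ refl)) (yes (inj₂ refl)) rewrite δ-refl u | δ-refl w = s≤s z≤n
      covered e xy (yes (inj₂ refl)) (yes (inj₁ refl)) rewrite δ-refl u | δ-refl w = ≤-trans (m≤n+m 1 (bridge w u)) (m≤m+n _ _)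
      covered e xy (yes (inj₂ refl)) (yes (inj₂ refl)) = contradiction refl (adj-≢ G xy)
      covered {x} {y} e xy (yes ex) (no ny) =
        ≤-trans (spoke≥1 (trans (sym e) (end-colour ex)) ny ex (trans (adjSym G y x) xy)) (≤-trans (m≤n+m _ (spoke x y)) (m≤n+m _ (bridge x y + bridge y x)))
      covered {x} {y} e xy (no nx) (yes ey) =
        ≤-trans (spoke≥1 (trans e (end-colour ey)) nx ey xy) (≤-trans (m≤m+n _ (spoke y x)) (m≤n+m _ (bridge x y + bridge y x)))
      covered e xy (no nx) (no ny) = contradiction (inner-ends e xy) [ nx , ny ]′
      pointwise : ∀ x y → inn x y ≤ (bridge x y + bridge y x) + (spoke x y + spoke y x)
      pointwise x y = ⟦∧⟧≤ λ e xy → covered (==-sound e) xy (end? x) (end? y)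

    -- With e for the sum of `extra`, `2 * size j + 4 * e ≤ M₂ < I₂ + 2 * size j ≤ 2 * size j + 2 +
    -- 2 * e`, so `2 * e < 2`.
    no-extra : sum extra ≡ 0
    no-extra = n<1⇒n≡0 (*-cancelˡ-< 2 _ _ (lin 0 (+-mono-≤ (+-mono-≤ M₂-lower (M₂-small)) I₂-upper) (arith (sum extra) (size j) M₂ I₂)))
      where
      arith : ∀ e a M I → suc (2 * e) + (M + (I + 2 * a) + (2 + 2 * e)) + 0 ≡ 2 * 1 + (2 * (a + 2 * e) + suc M + I)
      arith = solve-∀

    I₂≤2 : I₂ ≤ 2
    I₂≤2 = ≤-trans I₂-upper (≤-reflexive (cong (λ e → 2 + 2 * e) no-extra))

    sizes≤M₂ : 2 * size j ≤ M₂
    sizes≤M₂ = ≤-trans (*-monoʳ-≤ 2 (m≤m+n (size j) (2 * sum extra))) M₂-lower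

    M₂-upper : M₂ < 2 + 2 * size j
    M₂-upper = ≤-trans (M₂-small) (+-monoˡ-≤ (2 * size j) I₂≤2)

    only-inner : ∀ {x y} → c x ≡ c y → adj G x y ≡ true → End x × End y
    only-inner {x} {y} e xy with end? x | end? y
    ... | yes ex | yes ey = ex , ey
    ... | no nx | no ny = contradiction (inner-ends e xy) [ nx , ny ]′
    ... | yes ex | no ny = contradiction (≤-trans (spoke≥1 (trans (sym e) (end-colour ex)) ny ex (trans
        (adjSym G y x) xy)) (≤-trans (spoke≤ y x) (≤-reflexive no-extra))) 1+n≰n
      where
      spoke≤ : ∀ x y → spoke x y ≤ sum extra
      spoke≤ x y = ≤-trans (sum-≥ (spoke x) y) (≤-trans (sum-≥ (λ x → sum (spoke x)) x) (≤-reflexive sum-spoke))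
    ... | no nx | yes ey = contradiction (≤-trans (spoke≥1 (trans e (end-colour ey)) nx ey xy) (≤-trans (spoke≤ x y) (≤-reflexive no-extra))) 1+n≰n
      where
      spoke≤ : ∀ x y → spoke x y ≤ sum extra
      spoke≤ x y = ≤-trans (sum-≥ (spoke x) y) (≤-trans (sum-≥ (λ x → sum (spoke x)) x) (≤-reflexive sum-spoke))

    -- The expected missing pairs, from `u` or `w` into `V_j`, in one order only.
    gap : Fin n → Fin n → ℕ
    gap x y = ⟦ ⌊ end? x ⌋ ⟧ * ⟦ (c y == j) ∧ not (adj G x y) ⟧

    sum-gap : sum₂ gap ≡ missᶜ j u + missᶜ j w
    sum-gap = trans (sum-cong λ x → trans (sym (sum-*ˡ ⟦ ⌊ end? x ⌋ ⟧ _)) (split x)) (trans (sum-+ _ _) (cong₂ _+_ (sum-δ u _) (sum-δ w _)))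
      where
      split : ∀ x → ⟦ ⌊ end? x ⌋ ⟧ * missᶜ j x ≡ δ u x * missᶜ j x + δ w x * missᶜ j x
      split x with x ≟ᶠ u | x ≟ᶠ w
      ... | yes refl | yes refl = contradiction refl u≢w
      ... | yes refl | no _ = sym (+-identityʳ _)
      ... | no _ | yes refl = refl
      ... | no _ | no _ = refl

    gap-sym : Fin n → Fin n → ℕ
    gap-sym x y = gap x y + gap y x

    gap≤mis : ∀ x y → gap-sym x y ≤ mis x y
    gap≤mis x y rewrite adjSym G y x with end? x | end? y
    ... | yes ex | yes ey rewrite end-colour ex | end-colour ey | ==-false (j≢i ∘ sym) = z≤n
    ... | no _ | no _ = z≤n
    ... | no _ | yes ey with c x ≟ᶠ j
    ...   | no _ = z≤n
    ...   | yes refl rewrite end-colour ey | ==-false j≢i = ≤-reflexive (+-identityʳ _)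
    gap≤mis x y | yes ex | no _ with c y ≟ᶠ j
    ...   | no _ = z≤n
    ...   | yes refl rewrite end-colour ex | ==-false (j≢i ∘ sym) = ≤-reflexive (trans (+-identityʳ _) (+-identityʳ _))

    sum-gap-sym : 2 * size j ≤ sum₂ gap-sym
    sum-gap-sym = ≤-trans (*-monoʳ-≤ 2 size≤ends) (≤-reflexive (trans (cong (2 *_) (sym sum-gap)) (trans (cong (sum₂ gap +_) (+-identityʳ _)) (sym (sum₂-sym gap)))))

    -- The expected missing pairs already contribute `2 * size j` to `M₂`. Any other would add 2,
    -- one for each order, which `M₂-upper` excludes.
    only-missing : ∀ {x y} → c x ≢ c y → ¬ (End x × c y ≡ j) → ¬ (End y × c x ≡ j) → adj G x y ≡ true
    only-missing {x} {y} ne nxy nyx with adj G x y in xy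
    ... | true = refl
    ... | false = contradiction (≤-trans (+-monoʳ-≤ 2 sum-gap-sym) (sum-strict₂ (λ x → sum-mono (gap≤mis x)) (ne ∘ cong c)
                    (sum-strict (gap≤mis x) y strict-xy) (sum-strict (gap≤mis y) x strict-yx))) (<⇒≱ M₂-upper)
      where
      no-gap : ∀ {x y} → ¬ (End x × c y ≡ j) → gap x y ≡ 0
      no-gap {x} {y} nxy with end? x | c y ≟ᶠ j
      ... | no _ | _ = refl
      ... | yes _ | no _ = refl
      ... | yes ex | yes cy = contradiction (ex , cy) nxy
      strict-xy : gap-sym x y < mis x y
      strict-xy rewrite no-gap nxy | no-gap nyx | ==-false ne | xy = ≤-refl
      strict-yx : gap-sym y x < mis y x
      strict-yx rewrite no-gap nxy | no-gap nyx | ==-false (ne ∘ sym) | trans (adjSym G y x) xy = ≤-refl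

    -- Two adjacencies close a triangle with `uw`. Two misses give `suc (size j)` pairs in `gap`,
    -- hence `2 + 2 * size j` in `M₂`, against `M₂-upper`.
    exactly-one : ∀ {y} → c y ≡ j → adj G w y ≡ not (adj G u y)
    exactly-one {y} cy with adj G u y in uy
    ... | true = triangle-free (inj₁ refl) (inj₁ (sym cuw)) (inj₂ cy) uw uy
    ... | false with adj G w y in wy
    ...   | true = refl
    ...   | false = contradiction (≤-trans (*-monoʳ-≤ 2 doubly) (≤-trans (*-monoʳ-≤ 2 (≤-reflexive (trans (sum-+ _ _) (sym sum-gap)))) (≤-trans
        (≤-reflexive (trans (cong (sum₂ gap +_) (+-identityʳ _)) (sym (sum₂-sym gap)))) (sum₂-mono gap≤mis))))
                      (<⇒≱ (≤-trans M₂-upper (≤-reflexive (sym (*-suc 2 (size j))))))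
      where
      pointwise : ∀ y → ⟦ c y == j ⟧ ≤ ⟦ (c y == j) ∧ not (adj G u y) ⟧ + ⟦ (c y == j) ∧ not (adj G w y) ⟧
      pointwise y with c y ≟ᶠ j | adj G u y in uy | adj G w y in wy
      ... | no _ | _ | _ = z≤n
      ... | yes _ | false | _ = s≤s z≤n
      ... | yes _ | true | false = s≤s z≤n
      ... | yes cy | true | true = case trans (sym wy) (triangle-free (inj₁ refl) (inj₁ (sym cuw)) (inj₂ cy) uw uy) of λ ()
      at-y : ⟦ c y == j ⟧ < ⟦ (c y == j) ∧ not (adj G u y) ⟧ + ⟦ (c y == j) ∧ not (adj G w y) ⟧
      at-y rewrite ==-true cy | uy | wy = ≤-refl
      doubly : suc (size j) ≤ sum (λ y → ⟦ (c y == j) ∧ not (adj G u y) ⟧ + ⟦ (c y == j) ∧ not (adj G w y) ⟧)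
      doubly = sum-strict pointwise y at-y

    -- By optimality a vertex with a neighbour in its own part has one in `V_j`. Applied to both `u`
    -- and `w`, this makes both classes into which `V_j` splits nonempty.
    end-neighbour : ∀ {v v′} → c v′ ≡ c v → adj G v v′ ≡ true → ∃[ y ] c y ≡ j × adj G v y ≡ true
    end-neighbour {v} {v′} e vv′ = let y , Py = count-witness (λ y → (c y == j) ∧ adj G v y) (≤-trans one (opt v j)) in
      y , ==-sound (proj₁ (∧-true Py)) , proj₂ (∧-true {c y == j} Py)
      where
      at : ⟦ (c v′ == c v) ∧ adj G v v′ ⟧ ≡ 1
      at rewrite ==-true e | vv′ = refl
      one : 1 ≤ deg (c v) v
      one = ≤-trans (≤-reflexive (sym at)) (sum-≥ (λ y → ⟦ (c y == c v) ∧ adj G v y ⟧) v′)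

-- Part sizes

-- `d` is the distance of `b` from the set {q, q + 1}, and `d * (d + 1)` is the product (b - q)(b -
-- q - 1) in natural numbers. The bound `q ≤ b + d` is used to show that no part is small.
square-excess : ∀ q b → Σ[ d ∈ ℕ ] b * b + q * (q + 1) ≡ (2 * q + 1) * b + d * (d + 1) × q ≤ b + d × (d ≡ 0 → b ≡ q ⊎ b ≡ q + 1)
square-excess q b with ≤-total b q
... | inj₁ b≤q with m≤n⇒∃[o]m+o≡n b≤q
...   | d , refl = d , arith b d , ≤-refl , λ { refl → inj₁ (sym (+-identityʳ b)) }
  where
  arith : ∀ b d → b * b + (b + d) * (b + d + 1) ≡ (2 * (b + d) + 1) * b + d * (d + 1)
  arith = solve-∀
square-excess q b | inj₂ q≤b with m≤n⇒∃[o]m+o≡n q≤b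
... | zero , refl = 0 , arith q , ≤-trans (m≤m+n q 0) (m≤m+n (q + 0) 0) , λ _ → inj₁ (+-identityʳ q)
  where
  arith : ∀ q → (q + 0) * (q + 0) + q * (q + 1) ≡ (2 * q + 1) * (q + 0) + 0
  arith = solve-∀
... | suc d , refl = d , arith q d , ≤-trans (m≤m+n q (suc d)) (m≤m+n (q + suc d) d) , λ { refl → inj₂ refl }
  where
  arith : ∀ q d → (q + suc d) * (q + suc d) + q * (q + 1) ≡ (2 * q + 1) * (q + suc d) + d * (d + 1)
  arith = solve-∀

excess : ℕ → ℕ → ℕ
excess q b = proj₁ (square-excess q b)

sum-excess : ∀ q {r} (b : Fin r → ℕ) →
  sum (λ i → b i * b i) + r * (q * (q + 1)) ≡ (2 * q + 1) * sum b + sum (λ i → excess q (b i) * (excess q (b i) + 1))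
sum-excess q {r} b = begin
  sum (λ i → b i * b i) + r * (q * (q + 1))                                            ≡⟨ cong (sum (λ i → b i * b i) +_) (sym (sum-const r _)) ⟩
  sum (λ i → b i * b i) + sum {r} (λ _ → q * (q + 1))                                  ≡⟨ sym (sum-+ _ _) ⟩
  sum (λ i → b i * b i + q * (q + 1))                                                  ≡⟨ sum-cong (λ i → proj₁ (proj₂ (square-excess q (b i)))) ⟩
  sum (λ i → (2 * q + 1) * b i + excess q (b i) * (excess q (b i) + 1))                ≡⟨ sum-+ _ _ ⟩
  sum (λ i → (2 * q + 1) * b i) + sum (λ i → excess q (b i) * (excess q (b i) + 1))
    ≡⟨ cong (_+ sum (λ i → excess q (b i) * (excess q (b i) + 1))) (sym (sum-*ˡ (2 * q + 1) b)) ⟩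
  (2 * q + 1) * sum b + sum (λ i → excess q (b i) * (excess q (b i) + 1))              ∎
  where open ≡-Reasoning

-- The size of the part containing the end of the missing edges counts one more, which makes the optimum balanced.
virtual-squares : ∀ {r} (a : Fin r → ℕ) j → sum (λ l → (a l + δ j l) * (a l + δ j l)) ≡ sum (λ l → a l * a l) + (2 * a j + 1)
virtual-squares a j = trans (sum-cong pointwise) (trans (sum-+ _ _) (cong (sum (λ l → a l * a l) +_) (sum-δ j (λ l → 2 * a l + 1))))
  where
  one : ∀ a → (a + 1) * (a + 1) ≡ a * a + (2 * a + 1 + 0)
  one = solve-∀
  zer : ∀ a → (a + 0) * (a + 0) ≡ a * a + 0
  zer = solve-∀
  pointwise : ∀ l → (a l + δ j l) * (a l + δ j l) ≡ a l * a l + δ j l * (2 * a l + 1)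
  pointwise l with l ≟ᶠ j
  ... | yes _ = one (a l)
  ... | no _ = zer (a l)

virtual-total : ∀ {r} (a : Fin r → ℕ) j → sum (λ l → a l + δ j l) ≡ sum a + 1
virtual-total a j = trans (sum-+ a (δ j)) (cong (sum a +_) (sum-δ₁ j))

edge-sum : ∀ {n} → Graph n → ℕ
edge-sum G = sum₂ λ u v → ⟦ adj G u v ⟧

-- For n = qr + p, Extremal is the claimed value of ex_{r+1}(n, B_{r,k}), doubled and written without subtraction.
Dense Extremal : ∀ {n} → ℕ → ℕ → Graph n → Set
Dense {n} r q G = n * n + 3 + r * (q * (q + 1)) ≤ edge-sum G + (2 * q + 1) * (n + 1)
Extremal {n} r q G = n * n + 3 + r * (q * (q + 1)) ≡ edge-sum G + (2 * q + 1) * (n + 1)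

Balanced : ℕ → ℕ → Set
Balanced q b = b ≡ q ⊎ b ≡ q + 1

record NearPartite {n} (r q : ℕ) (G : Graph n) : Set where
  field
    c : Fin n → Fin r
    u w : Fin n
    j : Fin r
    cuw : c u ≡ c w
    uw : adj G u w ≡ true
    j≢i : j ≢ c u
    only-inner : ∀ {x y} → c x ≡ c y → adj G x y ≡ true → (x ≡ u ⊎ x ≡ w) × (y ≡ u ⊎ y ≡ w)
    only-missing : ∀ {x y} → c x ≢ c y → ¬ ((x ≡ u ⊎ x ≡ w) × c y ≡ j) → ¬ ((y ≡ u ⊎ y ≡ w) × c x ≡ j) → adj G x y ≡ true
    exactly-one : ∀ {y} → c y ≡ j → adj G w y ≡ not (adj G u y)
    u-neighbour : ∃[ y ] c y ≡ j × adj G u y ≡ true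
    w-neighbour : ∃[ y ] c y ≡ j × adj G w y ≡ true
    balanced : ∀ l → Balanced q (Coloured.size G c l + δ j l)

-- From density to the near-partite structure

module Stability {ρ n k q} (G : Graph n) (1≤k : 1 ≤ k) (adm : Admissible (3 + ρ) (Book (3 + ρ) k) G) (dense : Dense (3 + ρ) q G) where

  private
    r = 3 + ρ
    E = edge-sum G

  module Excess (c : Fin n → Fin r) where

    open Coloured G c

    identity : E + M₂ + sum (λ l → size l * size l) ≡ n * n + I₂
    identity = trans (cong (E + M₂ +_) (sym (same-sizes G c))) (edges-identity G c)

    -- Applied with `I₂` as `y`, to bound the monochromatic edges, and with `M₂` as `y`, to bound
    -- missing pairs and unbalanced parts. The term `2 * q` arises because the sizes sum to `n`,
    -- while `Dense` is stated for `n + 1`.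
    total : ∀ {x y} → E + sum (λ l → size l * size l) + y ≤ n * n + x → sum (λ l → excess q (size l) * (excess q (size l) + 1)) + 2 + y ≤ x + 2 * q
    total {x} {y} h = lin 0 (+-mono-≤ (+-mono-≤ h dense) (≤-reflexive (sym balance))) (arith E (sum λ l → size l * size l) D n x y q (r * (q * (q + 1))))
      where
      D = sum (λ l → excess q (size l) * (excess q (size l) + 1))
      balance : sum (λ l → size l * size l) + r * (q * (q + 1)) ≡ (2 * q + 1) * n + D
      balance = trans (sum-excess q size) (cong (λ m → (2 * q + 1) * m + D) (sizes-total G c))
      arith : ∀ E S D n x y q R → D + 2 + y + (n * n + x + (E + (2 * q + 1) * (n + 1)) + (S + R)) + 0 ≡ x + 2 * q +
          (E + S + y + (n * n + 3 + R) + ((2 * q + 1) * n + D))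
      arith = solve-∀

    module Virtual (j : Fin r) where

      b : Fin r → ℕ
      b l = size l + δ j l

      -- Raising the size of `V_j` by one brings the total to `n + 1`, so the bound loses no
      -- multiple of `q`: `x = 0` is contradictory, and `x = 2` forces every excess to vanish.
      virtual : ∀ {x} → E + sum (λ l → size l * size l) + 2 * size j ≤ n * n + x → sum (λ l → excess q (b l) * (excess q (b l) + 1)) + 2 ≤ x
      virtual {x} h = lin 0 (+-mono-≤ (+-mono-≤ h dense) (≤-reflexive (sym balance))) (arith E S (size j) D n x q (r * (q * (q + 1))))
        where
        S = sum (λ l → size l * size l)
        D = sum (λ l → excess q (b l) * (excess q (b l) + 1))
        balance : S + (2 * size j + 1) + r * (q * (q + 1)) ≡ (2 * q + 1) * (n + 1) + D
        balance = trans (cong (_+ r * (q * (q + 1))) (sym (virtual-squares size j))) (trans (sum-excess q b)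
                    (cong (λ m → (2 * q + 1) * m + D) (trans (virtual-total size j) (cong (_+ 1) (sizes-total G c)))))
        arith : ∀ E S a D n x q R → D + 2 + (n * n + x + (E + (2 * q + 1) * (n + 1)) + (S + (2 * a + 1) + R)) + 0
                                  ≡ x + (E + S + 2 * a + (n * n + 3 + R) + ((2 * q + 1) * (n + 1) + D))
        arith = solve-∀

  -- Local improvement never raises `I₂`, so the bound for the greedy colouring survives it.
  good-colouring : Σ[ c ∈ (Fin n → Fin r) ] Coloured.I₂ G c ≤ 2 * (n * k) + 2 * q × Optimal G c
  good-colouring with few-inner (2 + ρ) refl
    where open Füredi {r = r} G (proj₂ adm)
  ... | c₀ , bound = let c , le , opt = optimise G c₀ (<-wellFounded _) in c , ≤-trans le few₀ , opt
    where
    open Coloured G c₀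
    shuffle : ∀ a b d → a + b + d ≡ a + d + b
    shuffle = solve-∀
    few₀ : I₂ ≤ 2 * (n * k) + 2 * q
    few₀ = ≤-trans (m≤n+m I₂ _) (Excess.total c₀ (≤-trans (≤-reflexive (trans (shuffle E _ I₂) (cong (E + I₂ +_) (sym (same-sizes G c₀))))) bound))

  module Constants (c : Fin n → Fin r) (I₂-few : Coloured.I₂ G c ≤ 2 * (n * k) + 2 * q) (opt : Optimal G c)
      (s h C H N T : ℕ) {{_ : NonZero s}} {{_ : NonZero h}} (C-large : 2 * (n * k) + 2 * q + 2 * q ≤ C * q)
    (Cq≤Ns : C * q ≤ N * s) (Cq≤Hh : C * q ≤ H * h) (Cq<16hh : C * q < 16 * (h * h)) (8h≤q : 8 * h ≤ q)
    (T-large : (2 + ρ) * s + (N + k) ≤ T) (T-small : (3 * H + 4) * T + 7 ≤ h) where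

    open Coloured G c
    open Excess c

    D : Fin r → ℕ
    D l = excess q (size l) * (excess q (size l) + 1)

    budget : sum D + 2 + M₂ ≤ C * q
    budget = begin
      sum D + 2 + M₂                    ≤⟨ total (≤-reflexive (trans (shuffle E _ M₂) identity)) ⟩
      I₂ + 2 * q                        ≤⟨ +-monoˡ-≤ (2 * q) I₂-few ⟩
      2 * (n * k) + 2 * q + 2 * q       ≤⟨ C-large ⟩
      C * q                             ∎
      where
      open ≤-Reasoning
      shuffle : ∀ a b d → a + b + d ≡ a + d + b
      shuffle = solve-∀

    M₂≤Cq : M₂ ≤ C * q
    M₂≤Cq = ≤-trans (m≤n+m M₂ _) budget

    -- As `q` is at least `8 * h`, a part below `4 * h` has excess at least `4 * h`, whose square
    -- exceeds the linear budget.
    large-parts : ∀ l → 4 * h ≤ size l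
    large-parts l = ≮⇒≥ λ small → <⇒≱ Cq<16hh (begin
        16 * (h * h)              ≡⟨ arith₁ h ⟩
        4 * h * (4 * h)           ≤⟨ *-mono-≤ (4h≤d small) (≤-trans (4h≤d small) (m≤m+n d 1)) ⟩
        d * (d + 1)               ≤⟨ sum-≥ D l ⟩
        sum D                     ≤⟨ ≤-trans (m≤m+n _ 2) (m≤m+n _ M₂) ⟩
        sum D + 2 + M₂            ≤⟨ budget ⟩
        C * q                     ∎)
      where
      open ≤-Reasoning
      d = excess q (size l)
      arith₁ : ∀ h → 16 * (h * h) ≡ 4 * h * (4 * h)
      arith₁ = solve-∀
      arith₂ : ∀ h d a q → 4 * h + (q + (a + d) + 4 * h) + 1 ≡ d + (8 * h + q + suc a)
      arith₂ = solve-∀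
      4h≤d : size l < 4 * h → 4 * h ≤ d
      4h≤d small = lin 1 (+-mono-≤ (+-mono-≤ 8h≤q (proj₁ (proj₂ (proj₂ (square-excess q (size l)))))) small) (arith₂ h d (size l) q)

    size-h : ∀ l → 2 * h + T ≤ size l
    size-h l = ≤-trans (lin (h + ((3 * H + 3) * T + 7)) T-small (arith h H T)) (large-parts l)
      where
      arith : ∀ h H T → 2 * h + T + h + (h + ((3 * H + 3) * T + 7)) ≡ 4 * h + ((3 * H + 4) * T + 7)
      arith = solve-∀

    -- `3 * Γ + T + 1` expands to `(3 * H + 4) * T + 7`, the origin of the constants in `T-small`.
    size-Γ : ∀ l → 3 * ((H + 1) * T + 2) + T + 1 ≤ size l
    size-Γ l = ≤-trans (lin (3 * h) T-small (arith h H T)) (large-parts l)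
      where
      arith : ∀ h H T → 3 * ((H + 1) * T + 2) + T + 1 + h + 3 * h ≡ 4 * h + ((3 * H + 4) * T + 7)
      arith = solve-∀

    inner-edge : ∃[ u ] ∃[ w ] c u ≡ c w × adj G u w ≡ true
    inner-edge with Finₚ.any? (λ u → Finₚ.any? (λ w → (c u ≟ᶠ c w) ×-dec (adj G u w ≟ᵇ true)))
    ... | yes found = found
    ... | no none = ⊥-elim (proj₁ adm (c , λ u w uw e → none (u , w , e , uw)))

    module S = Structure G (proj₂ adm) 1≤k c opt s N h H T (markov miss s N (≤-trans M₂≤Cq Cq≤Ns)) (markov miss h H (≤-trans M₂≤Cq Cq≤Hh)) T-large size-h size-Γ

    squares : ℕ
    squares = sum λ l → size l * size l

    -- Otherwise `virtual` applies with `x = 0` and yields 2 ≤ 0.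
    M₂<I₂ : ∀ j → M₂ < I₂ + 2 * size j
    M₂<I₂ j = ≰⇒> impossible
      where
      arith : ∀ E S a M I m → E + S + 2 * a + (M + (m + I)) + 0 ≡ m + 0 + (I + 2 * a + (E + M + S))
      arith = solve-∀
      impossible : ¬ (I₂ + 2 * size j ≤ M₂)
      impossible le with ≤-trans (m≤n+m 2 _) (Virtual.virtual j (lin {a = E + squares + 2 * size j} {b = n * n + 0} 0
          (+-mono-≤ le (≤-reflexive identity)) (arith E squares (size j) M₂ I₂ (n * n))))
      ... | ()

    few-edges : ∀ j → I₂ ≤ 2 → 2 * size j ≤ M₂ → E + squares + 2 * size j ≤ n * n + 2
    few-edges j I≤ M≥ = lin 0 (+-mono-≤ (+-mono-≤ I≤ M≥) (≤-reflexive identity)) (arith E squares (size j) M₂ I₂ (n * n))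
      where
      arith : ∀ E S a M I m → E + S + 2 * a + (2 + M + (m + I)) + 0 ≡ m + 2 + (I + 2 * a + (E + M + S))
      arith = solve-∀

    module _ {u w} (cuw : c u ≡ c w) (uw : adj G u w ≡ true) {j} (j≢i : j ≢ c u)
      (small : count (λ y → S.common₂ u w y ∧ (c y == j)) < T) where

      private
        module Edge = S.InnerEdge cuw uw j≢i small (M₂<I₂ j)
        open Virtual j

      no-excess : sum (λ l → excess q (b l) * (excess q (b l) + 1)) ≤ 0
      no-excess = +-cancelʳ-≤ 2 _ 0 (virtual (few-edges j Edge.I₂≤2 Edge.sizes≤M₂))

      balanced : ∀ l → Balanced q (size l + δ j l)
      balanced l = proj₂ (proj₂ (proj₂ (square-excess q (b l)))) (no-square (n≤0⇒n≡0 (≤-trans (sum-≥ (λ l → excess q (b l) * (excess q (b l) + 1)) l) no-excess)))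
        where
        no-square : ∀ {d} → d * (d + 1) ≡ 0 → d ≡ 0
        no-square {zero} _ = refl

      from-edge : NearPartite r q G
      from-edge = record
        { c = c ; u = u ; w = w ; j = j ; cuw = cuw ; uw = uw ; j≢i = j≢i
        ; only-inner = Edge.only-inner ; only-missing = Edge.only-missing ; exactly-one = Edge.exactly-one
        ; u-neighbour = Edge.end-neighbour (sym cuw) uw ; w-neighbour = Edge.end-neighbour cuw Edge.wu
        ; balanced = balanced }

    near-partite : NearPartite r q G
    near-partite = let u , w , cuw , uw = inner-edge in let j , j≢i , small = S.few-common cuw uw in from-edge cuw uw j≢i small

-- The scales s ≪ h ≪ q of the stability argument

record Scales (r′ k q n : ℕ) : Set where
  field
    s h C H N T : ℕ
    s>0 : 0 < s
    h>0 : 0 < h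
    C-large : 2 * (n * k) + 2 * q + 2 * q ≤ C * q
    Cq≤Ns : C * q ≤ N * s
    Cq≤Hh : C * q ≤ H * h
    Cq<16hh : C * q < 16 * (h * h)
    8h≤q : 8 * h ≤ q
    T-large : r′ * s + (N + k) ≤ T
    T-small : (3 * H + 4) * T + 7 ≤ h

-- `suc r′` is the number of colours. The `C` comes from `n ≤ 2 * (q * suc r′)`; with `h = Y * s`
-- and `X = 8 * Y`, the bound `q ≤ 2 * X * s` reads `q ≤ 16 * h`, which gives `H` and `N`; `Y` is
-- what `T-small` requires when `T ≤ suc r′ * s`. No constant depends on `s`, so `s` may exceed them
-- all. They are variables with equations, hence atoms for the arithmetic.
scales : ∀ {r′ k q n} C H Y X N s → C ≡ 4 * (suc r′ * k) + 4 → H ≡ 16 * C → Y ≡ (3 * H + 4) * suc r′ + 7 → X ≡ 8 * Y → N ≡ C * (2 * X) →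
  n ≤ 2 * (q * suc r′) → X * s ≤ q → q ≤ 2 * X * s → N + k + C + 1 ≤ s → Scales r′ k q n
scales {r′} {k} {q} {n} C H Y X N s C≡ H≡ Y≡ X≡ N≡ n≤ Xs≤q q≤2Xs s-large = record
  { s = s ; h = h ; C = C ; H = H ; N = N ; T = r′ * s + (N + k)
  ; s>0 = s>0
  ; h>0 = ≤-trans s>0 s≤h
  ; C-large = ≤-trans (+-monoˡ-≤ (2 * q) (+-monoˡ-≤ (2 * q) (*-monoʳ-≤ 2 (*-monoˡ-≤ k n≤)))) (≤-reflexive (trans (arith₁ q (suc r′) k) (cong (_* q) (sym C≡))))
  ; Cq≤Ns = ≤-trans (*-monoʳ-≤ C q≤2Xs) (≤-reflexive (trans (sym (*-assoc C (2 * X) s)) (cong (_* s) (sym N≡))))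
  ; Cq≤Hh = ≤-trans Cq≤16Ch (≤-reflexive (trans (sym (*-assoc 16 C h)) (cong (_* h) (sym H≡))))
  ; Cq<16hh = ≤-trans (s≤s Cq≤16Ch) (*-monoʳ-< 16 (*-monoˡ-< h {{>-nonZero (≤-trans s>0 s≤h)}} (≤-trans C<s s≤h)))
  ; 8h≤q = ≤-trans (≤-reflexive (trans (sym (*-assoc 8 Y s)) (cong (_* s) (sym X≡)))) Xs≤q
  ; T-large = ≤-refl
  ; T-small = T-small
  }
  where
  h = Y * s
  s>0 : 1 ≤ s
  s>0 = ≤-trans (m≤n+m 1 (N + k + C)) s-large
  Y>0 : 1 ≤ Y
  Y>0 = ≤-trans (≤-trans (s≤s z≤n) (m≤n+m 7 ((3 * H + 4) * suc r′))) (≤-reflexive (sym Y≡))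
  s≤h : s ≤ h
  s≤h = ≤-trans (≤-reflexive (sym (*-identityˡ s))) (*-monoˡ-≤ s Y>0)
  C<s : C < s
  C<s = ≤-trans (≤-trans (m≤n+m (suc C) (N + k)) (≤-reflexive (arith₃ (N + k) C))) s-large
    where
    arith₃ : ∀ m C → m + suc C ≡ m + C + 1
    arith₃ = solve-∀
  arith₁ : ∀ q r k → 2 * (2 * (q * r) * k) + 2 * q + 2 * q ≡ (4 * (r * k) + 4) * q
  arith₁ = solve-∀
  Cq≤16Ch : C * q ≤ 16 * (C * h)
  Cq≤16Ch = ≤-trans (*-monoʳ-≤ C (≤-trans q≤2Xs (≤-reflexive (cong (λ X → 2 * X * s) X≡)))) (≤-reflexive (arith₂ C Y s))
    where
    arith₂ : ∀ C Y s → C * (2 * (8 * Y) * s) ≡ 16 * (C * (Y * s))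
    arith₂ = solve-∀
  N+k≤s : N + k ≤ s
  N+k≤s = ≤-trans (≤-trans (m≤m+n (N + k) C) (m≤m+n _ 1)) s-large
  T-small : (3 * H + 4) * (r′ * s + (N + k)) + 7 ≤ h
  T-small = begin
    (3 * H + 4) * (r′ * s + (N + k)) + 7    ≤⟨ +-mono-≤ (*-monoʳ-≤ (3 * H + 4) (+-monoʳ-≤ (r′ * s) N+k≤s)) (*-monoʳ-≤ 7 s>0) ⟩
    (3 * H + 4) * (r′ * s + s) + 7 * s      ≡⟨ arith (3 * H + 4) r′ s ⟩
    ((3 * H + 4) * suc r′ + 7) * s          ≡⟨ cong (_* s) (sym Y≡) ⟩
    h                                       ∎
    where
    open ≤-Reasoning
    arith : ∀ a r s → a * (r * s + s) + 7 * s ≡ (a * suc r + 7) * s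
    arith = solve-∀

-- Rounding `q / X` down loses less than `X`, hence at most a factor of two once the quotient is
-- positive.
divide : ∀ X s₀ q → 0 < X → 0 < s₀ → s₀ * X ≤ q → Σ[ s ∈ ℕ ] X * s ≤ q × q ≤ 2 * X * s × s₀ ≤ s
divide X s₀ q X>0 s₀>0 large = s , ≤-trans (≤-reflexive (*-comm X s)) (m/n*n≤m q X) , q≤ , s₀≤s
  where
  instance
    X-nonZero : NonZero X
    X-nonZero = >-nonZero X>0
  s = q / X
  s₀≤s : s₀ ≤ s
  s₀≤s = ≤-trans (≤-reflexive (sym (m*n/n≡m s₀ X))) (/-monoˡ-≤ X large)
  q≤ : q ≤ 2 * X * s
  q≤ = begin
    q                  ≡⟨ m≡m%n+[m/n]*n q X ⟩
    q % X + s * X      ≤⟨ +-monoˡ-≤ (s * X) (<⇒≤ (m%n<n q X)) ⟩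
    X + s * X          ≤⟨ +-monoˡ-≤ (s * X) (≤-trans (≤-reflexive (sym (*-identityˡ X))) (*-monoˡ-≤ X (≤-trans s₀>0 s₀≤s))) ⟩
    s * X + s * X      ≡⟨ arith s X ⟩
    2 * X * s          ∎
    where
    open ≤-Reasoning
    arith : ∀ s X → s * X + s * X ≡ 2 * X * s
    arith = solve-∀

scales-exist : ∀ r′ k → Σ[ q₀ ∈ ℕ ] (∀ {q n} → q₀ ≤ q → n ≤ 2 * (q * suc r′) → Scales r′ k q n)
scales-exist r′ k = from _ refl _ refl _ refl _ refl _ refl
  where
  from : ∀ C → C ≡ 4 * (suc r′ * k) + 4 → ∀ H → H ≡ 16 * C → ∀ Y → Y ≡ (3 * H + 4) * suc r′ + 7 → ∀ X → X ≡ 8 * Y → ∀ N → N ≡ C * (2 * X) →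
         Σ[ q₀ ∈ ℕ ] (∀ {q n} → q₀ ≤ q → n ≤ 2 * (q * suc r′) → Scales r′ k q n)
  from C C≡ H H≡ Y Y≡ X X≡ N N≡ = (N + k + C + 1) * X , λ {q} {n} large n≤ →
    let s , le , ge , s₀≤ = divide X (N + k + C + 1) q X>0 (m≤n+m 1 _) large in
    scales C H Y X N s C≡ H≡ Y≡ X≡ N≡ n≤ le ge s₀≤
    where
    X>0 : 0 < X
    X>0 = ≤-trans (≤-trans (≤-trans (s≤s z≤n) (m≤n+m 7 ((3 * H + 4) * suc r′))) (m≤m+n _ _)) (≤-reflexive (sym (trans X≡ (cong (8 *_) Y≡))))

stability : ∀ ρ k → 1 ≤ k → Σ[ q₀ ∈ ℕ ] (∀ {q n} (G : Graph n) → q₀ ≤ q → n ≤ 2 * (q * (3 + ρ)) →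
  Admissible (3 + ρ) (Book (3 + ρ) k) G → Dense (3 + ρ) q G → NearPartite (3 + ρ) q G)
stability ρ k 1≤k = let q₀ , sc = scales-exist (2 + ρ) k in q₀ , λ G large n≤ adm dense → conclude G adm dense (sc large n≤)
  where
  conclude : ∀ {q n} (G : Graph n) → Admissible (3 + ρ) (Book (3 + ρ) k) G → Dense (3 + ρ) q G → Scales (2 + ρ) k q n → NearPartite (3 + ρ) q G
  conclude {q} G adm dense sc = let c , few , opt = St.good-colouring in
    St.Constants.near-partite c few opt s h C H N T {{>-nonZero s>0}} {{>-nonZero h>0}} C-large Cq≤Ns Cq≤Hh Cq<16hh 8h≤q T-large T-small
    where
    open Scales sc
    module St = Stability {q = q} G 1≤k adm dense

-- Blow-ups of C₅ ∨ K_m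

Label : ℕ → Set
Label m = Fin 5 ⊎ Fin m

-- An equality test of labels that reduces on constructors, so that identities between class counts
-- can be checked label by label.
tag : ∀ {m} → Label m → Label m → Bool
tag (inj₁ i) (inj₁ i′) = i′ == i
tag (inj₂ l) (inj₂ l′) = l′ == l
tag (inj₁ _) (inj₂ _) = false
tag (inj₂ _) (inj₁ _) = false

classSize-count : ∀ {n m} (π : Fin n → Label m) x → classSize π x ≡ count (λ v → tag x (π v))
classSize-count π x = trans (length-filter-tabulate (λ v → Sumₚ.≡-dec _≟ᶠ_ _≟ᶠ_ (π v) x) id) (sum-cong λ v → cong ⟦_⟧ (agree x (π v)))
  where
  agree : ∀ {m} (x y : Label m) → ⌊ Sumₚ.≡-dec _≟ᶠ_ _≟ᶠ_ y x ⌋ ≡ tag x y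
  agree (inj₁ i) (inj₁ i′) with i′ ≟ᶠ i
  ... | yes _ = refl
  ... | no _ = refl
  agree (inj₂ l) (inj₂ l′) with l′ ≟ᶠ l
  ... | yes _ = refl
  ... | no _ = refl
  agree (inj₁ _) (inj₂ _) = refl
  agree (inj₂ _) (inj₁ _) = refl

tag-sound : ∀ {m} (x y : Label m) → tag x y ≡ true → y ≡ x
tag-sound (inj₁ i) (inj₁ i′) e = cong inj₁ (==-sound e)
tag-sound (inj₂ l) (inj₂ l′) e = cong inj₂ (==-sound e)

joinPat-sym : ∀ m (x y : Label m) → joinPat m x y ≡ joinPat m y x
joinPat-sym m (inj₁ i) (inj₁ i′) = ∨-comm (suc (toℕ i) % 5 ≡ᵇ toℕ i′) _
joinPat-sym m (inj₁ _) (inj₂ _) = refl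
joinPat-sym m (inj₂ _) (inj₁ _) = refl
joinPat-sym m (inj₂ l) (inj₂ l′) = cong not (==-comm l l′)

joinPat-irrefl : ∀ m (x : Label m) → joinPat m x x ≡ false
joinPat-irrefl m (inj₁ i) = toWitness {a? = Finₚ.all? λ i → c5Adj i i ≟ᵇ false} _ i
joinPat-irrefl m (inj₂ l) = cong not (==-true {x = l} refl)

joinPat-parts : ∀ m {l l′ : Fin m} → l ≢ l′ → joinPat m (inj₂ l) (inj₂ l′) ≡ true
joinPat-parts m ne = cong not (==-false ne)

-- I₃ = {w} and I₄ = {u} lie in the part of I₁; this part and I₂ ∪ I₅ are the two parts carrying the 5-cycle.
part : ∀ {m} → Label m → Fin (2 + m)
part (inj₁ 0F) = 0F
part (inj₁ 1F) = 1F
part (inj₁ 2F) = 0F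
part (inj₁ 3F) = 0F
part (inj₁ 4F) = 1F
part (inj₂ l) = suc (suc l)

record BlowUp {n} (q m : ℕ) (G : Graph n) : Set where
  field
    π : Fin n → Label m
    adjacency : ∀ u v → adj G u v ≡ joinPat m (π u) (π v)

  class : Label m → ℕ
  class x = count λ v → tag x (π v)

  field
    class₃ : class (inj₁ 2F) ≡ 1
    class₄ : class (inj₁ 3F) ≡ 1
    class₂ : 1 ≤ class (inj₁ 1F)
    class₅ : 1 ≤ class (inj₁ 4F)
    balanced₁ : Balanced q (class (inj₁ 0F) + 2)
    balanced₂ : Balanced q (class (inj₁ 1F) + class (inj₁ 4F) + 1)
    balancedᵗ : ∀ l → Balanced q (class (inj₂ l))

balanced-≥ : ∀ {q b} → Balanced q b → q ≤ b
balanced-≥ (inj₁ refl) = ≤-refl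
balanced-≥ (inj₂ refl) = m≤m+n _ 1

balanced-≤ : ∀ {q b} → Balanced q b → b ≤ q + 1
balanced-≤ (inj₁ refl) = m≤m+n _ 1
balanced-≤ (inj₂ refl) = ≤-refl

balanced-square : ∀ {q b} → Balanced q b → b * b + q * (q + 1) ≡ (2 * q + 1) * b
balanced-square {q} (inj₁ refl) = arith q
  where
  arith : ∀ q → q * q + q * (q + 1) ≡ (2 * q + 1) * q
  arith = solve-∀
balanced-square {q} (inj₂ refl) = arith q
  where
  arith : ∀ q → (q + 1) * (q + 1) + q * (q + 1) ≡ (2 * q + 1) * (q + 1)
  arith = solve-∀

module BlowUpProperties {n q m} (G : Graph n) (B : BlowUp q m G) where

  open BlowUp B

  c : Fin n → Fin (2 + m)
  c v = part (π v)

  open Coloured G c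

  private
    t : Fin 5 → Fin n → ℕ
    t i v = ⟦ tag (inj₁ i) (π v) ⟧

  size₀ : size 0F ≡ class (inj₁ 0F) + 2
  size₀ = trans (sum-cong λ v → split (π v)) (trans (sum-+ _ _) (cong (class (inj₁ 0F) +_) (trans (sum-+ _ _) (cong₂ _+_ class₃ class₄))))
    where
    split : ∀ x → ⟦ part x == 0F ⟧ ≡ ⟦ tag (inj₁ 0F) x ⟧ + (⟦ tag (inj₁ 2F) x ⟧ + ⟦ tag (inj₁ 3F) x ⟧)
    split (inj₁ 0F) = refl
    split (inj₁ 1F) = refl
    split (inj₁ 2F) = refl
    split (inj₁ 3F) = refl
    split (inj₁ 4F) = refl
    split (inj₂ l) = refl

  size₁ : size 1F ≡ class (inj₁ 1F) + class (inj₁ 4F)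
  size₁ = trans (sum-cong λ v → split (π v)) (sum-+ _ _)
    where
    split : ∀ x → ⟦ part x == 1F ⟧ ≡ ⟦ tag (inj₁ 1F) x ⟧ + ⟦ tag (inj₁ 4F) x ⟧
    split (inj₁ 0F) = refl
    split (inj₁ 1F) = refl
    split (inj₁ 2F) = refl
    split (inj₁ 3F) = refl
    split (inj₁ 4F) = refl
    split (inj₂ l) = refl

  sizeᵗ : ∀ l → size (suc (suc l)) ≡ class (inj₂ l)
  sizeᵗ l = sum-cong λ v → cong ⟦_⟧ (split (π v))
    where
    split : ∀ x → (part x == suc (suc l)) ≡ tag (inj₂ l) x
    split (inj₁ 0F) = refl
    split (inj₁ 1F) = refl
    split (inj₁ 2F) = refl
    split (inj₁ 3F) = refl
    split (inj₁ 4F) = refl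
    split (inj₂ l′) = trans (==-suc (suc l′) (suc l)) (==-suc l′ l)

  class-total : class (inj₁ 0F) + 2 + (class (inj₁ 1F) + class (inj₁ 4F) + sum (λ l → class (inj₂ l))) ≡ n
  class-total = trans (cong₂ _+_ (sym size₀) (trans (cong₂ _+_ (sym size₁) (sum-cong λ l → sym (sizeᵗ l))) (sym (sum-suc (λ l → size (suc l))))))
                  (trans (sym (sum-suc size)) (sizes-total G c))

  -- The only adjacent labels in the same part are I₃ and I₄, both of size one.
  I₂≡2 : I₂ ≡ 2
  I₂≡2 = trans (sum₂-cong λ u v → trans (cong (λ b → ⟦ (c u == c v) ∧ b ⟧) (adjacency u v)) (on-labels (π u) (π v)))
           (trans (sum₂-sym (λ u v → t 2F u * t 3F v)) (cong (λ a → a + a) (trans (sum₂-* (t 2F) (t 3F)) (cong₂ _*_ class₃ class₄))))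
    where
    on-labels : ∀ x y → ⟦ (part x == part y) ∧ joinPat m x y ⟧ ≡ ⟦ tag (inj₁ 2F) x ⟧ * ⟦ tag (inj₁ 3F) y ⟧ + ⟦ tag (inj₁ 2F) y ⟧ * ⟦ tag (inj₁ 3F) x ⟧
    on-labels (inj₁ i) (inj₁ i′) = toWitness {a? = Finₚ.all? λ i → Finₚ.all? λ i′ →
      ⟦ (part {m} (inj₁ i) == part {m} (inj₁ i′)) ∧ joinPat m (inj₁ i) (inj₁ i′) ⟧ ≟ⁿ ⟦ i == 2F ⟧ * ⟦ i′ == 3F ⟧ + ⟦ i′ == 2F ⟧ * ⟦ i == 3F ⟧} _ i i′
    on-labels (inj₁ i) (inj₂ l) = trans (cong (λ b → ⟦ b ∧ true ⟧) (cross i)) (sym (trans (+-identityʳ _) (*-zeroʳ ⟦ i == 2F ⟧)))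
      where
      cross : ∀ i → (part (inj₁ i) == suc (suc l)) ≡ false
      cross 0F = refl
      cross 1F = refl
      cross 2F = refl
      cross 3F = refl
      cross 4F = refl
    on-labels (inj₂ l) (inj₁ i) = trans (cong (λ b → ⟦ b ∧ true ⟧) (cross i)) (sym (*-zeroʳ ⟦ i == 2F ⟧))
      where
      cross : ∀ i → (suc (suc l) == part (inj₁ i)) ≡ false
      cross 0F = refl
      cross 1F = refl
      cross 2F = refl
      cross 3F = refl
      cross 4F = refl
    on-labels (inj₂ l) (inj₂ l′) rewrite ==-suc (Fin.suc l) (suc l′) | ==-suc l l′ with l ≟ᶠ l′
    ... | yes _ = refl
    ... | no _ = refl

  -- The non-adjacent labels in different parts are I₂ with I₄ and I₅ with I₃, so each vertex of I₂
  -- ∪ I₅ misses exactly one vertex.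
  M₂≡2size : M₂ ≡ 2 * size 1F
  M₂≡2size = begin
    M₂
      ≡⟨ sum₂-cong (λ u v → trans (cong (λ b → ⟦ not (c u == c v) ∧ not b ⟧) (adjacency u v)) (on-labels (π u) (π v))) ⟩
    sum₂ (λ u v → gap u v + gap v u)                                         ≡⟨ sum₂-sym gap ⟩
    sum₂ gap + sum₂ gap
      ≡⟨ cong (λ a → a + a) (trans (sum₂-+ _ _) (cong₂ _+_ (trans (sum₂-* (t 1F) (t 3F)) (cong (class (inj₁ 1F) *_) class₄))
         (trans (sum₂-* (t 4F) (t 2F)) (cong (class (inj₁ 4F) *_) class₃)))) ⟩
    class (inj₁ 1F) * 1 + class (inj₁ 4F) * 1 + (class (inj₁ 1F) * 1 + class (inj₁ 4F) * 1)  ≡⟨ arith (class (inj₁ 1F)) (class (inj₁ 4F)) ⟩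
    2 * (class (inj₁ 1F) + class (inj₁ 4F))                                  ≡⟨ cong (2 *_) (sym size₁) ⟩
    2 * size 1F                                                              ∎
    where
    open ≡-Reasoning
    gap : Fin n → Fin n → ℕ
    gap u v = t 1F u * t 3F v + t 4F u * t 2F v
    arith : ∀ a b → a * 1 + b * 1 + (a * 1 + b * 1) ≡ 2 * (a + b)
    arith = solve-∀
    gapᴸ : Label m → Label m → ℕ
    gapᴸ x y = ⟦ tag (inj₁ 1F) x ⟧ * ⟦ tag (inj₁ 3F) y ⟧ + ⟦ tag (inj₁ 4F) x ⟧ * ⟦ tag (inj₁ 2F) y ⟧
    none : ∀ i l → gapᴸ (inj₁ i) (inj₂ l) ≡ 0
    none i l = cong₂ _+_ (*-zeroʳ ⟦ i == 1F ⟧) (*-zeroʳ ⟦ i == 4F ⟧)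
    on-labels : ∀ x y → ⟦ not (part x == part y) ∧ not (joinPat m x y) ⟧ ≡ gapᴸ x y + gapᴸ y x
    on-labels (inj₁ i) (inj₁ i′) = toWitness {a? = Finₚ.all? λ i → Finₚ.all? λ i′ →
      ⟦ not (part {m} (inj₁ i) == part {m} (inj₁ i′)) ∧ not (joinPat m (inj₁ i) (inj₁ i′)) ⟧ ≟ⁿ gapᴸ (inj₁ i) (inj₁ i′) + gapᴸ (inj₁ i′) (inj₁ i)} _ i i′
    on-labels (inj₁ i) (inj₂ l) = trans (cong ⟦_⟧ (∧-comm (not (part (inj₁ i) == part (inj₂ l))) false)) (sym (trans (+-identityʳ _) (none i l)))
    on-labels (inj₂ l) (inj₁ i) = trans (cong ⟦_⟧ (∧-comm (not (part (inj₂ l) == part (inj₁ i))) false)) (sym (none i l))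
    on-labels (inj₂ l) (inj₂ l′) rewrite ==-suc (Fin.suc l) (suc l′) | ==-suc l l′ with l ≟ᶠ l′
    ... | yes _ = refl
    ... | no _ = refl

  balanced : ∀ l → Balanced q (size l + δ 1F l)
  balanced 0F = subst (Balanced q) (trans (sym size₀) (sym (+-identityʳ _))) balanced₁
  balanced 1F = subst (Balanced q) (cong (_+ 1) (sym size₁)) balanced₂
  balanced (suc (suc l)) = subst (Balanced q) (trans (sym (sizeᵗ l)) (sym (+-identityʳ _))) (balancedᵗ l)

  -- `edges-identity` with `I₂ = 2` and `M₂ = 2 * size 1F`, every excess being zero.
  extremal : Extremal (2 + m) q G
  extremal = +-cancelʳ-≡ (S + 2 * size 1F) _ _ (begin
    n * n + 3 + (2 + m) * (q * (q + 1)) + (S + 2 * size 1F)                 ≡⟨ arith₁ (n * n) S (size 1F) ((2 + m) * (q * (q + 1))) ⟩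
    n * n + 2 + (S + (2 * size 1F + 1) + (2 + m) * (q * (q + 1)))           ≡⟨ cong₂ _+_ (sym identity) squares ⟩
    E + 2 * size 1F + S + (2 * q + 1) * (n + 1)                             ≡⟨ arith₂ E (size 1F) S ((2 * q + 1) * (n + 1)) ⟩
    E + (2 * q + 1) * (n + 1) + (S + 2 * size 1F)                           ∎)
    where
    open ≡-Reasoning
    E = edge-sum G
    S = sum λ l → size l * size l
    b : Fin (2 + m) → ℕ
    b l = size l + δ 1F l
    arith₁ : ∀ N S a R → N + 3 + R + (S + 2 * a) ≡ N + 2 + (S + (2 * a + 1) + R)
    arith₁ = solve-∀
    arith₂ : ∀ E a S Q → E + 2 * a + S + Q ≡ E + Q + (S + 2 * a)
    arith₂ = solve-∀
    identity : E + 2 * size 1F + S ≡ n * n + 2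
    identity = trans (cong₂ (λ a b → E + a + b) (sym M₂≡2size) (sym (same-sizes G c))) (trans (edges-identity G c) (cong (n * n +_) I₂≡2))
    squares : S + (2 * size 1F + 1) + (2 + m) * (q * (q + 1)) ≡ (2 * q + 1) * (n + 1)
    squares = begin
      S + (2 * size 1F + 1) + (2 + m) * (q * (q + 1))              ≡⟨ cong (_+ (2 + m) * (q * (q + 1))) (sym (virtual-squares size 1F)) ⟩
      sum (λ l → b l * b l) + (2 + m) * (q * (q + 1))              ≡⟨ cong (sum (λ l → b l * b l) +_) (sym (sum-const (2 + m) _)) ⟩
      sum (λ l → b l * b l) + sum {2 + m} (λ _ → q * (q + 1))      ≡⟨ sym (sum-+ _ _) ⟩
      sum (λ l → b l * b l + q * (q + 1))                          ≡⟨ sum-cong (λ l → balanced-square (balanced l)) ⟩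
      sum (λ l → (2 * q + 1) * b l)                                ≡⟨ sym (sum-*ˡ (2 * q + 1) b) ⟩
      (2 * q + 1) * sum b                                          ≡⟨ cong ((2 * q + 1) *_) (trans (virtual-total size 1F) (cong (_+ 1) (sizes-total G c))) ⟩
      (2 * q + 1) * (n + 1)                                        ∎

  private
    r = 2 + m

  -- Proper colourings of the labels without I₃, respectively without I₅.
  γ : Bool → Label m → Fin r
  γ b (inj₁ 0F) = 0F
  γ b (inj₁ 1F) = 1F
  γ b (inj₁ 2F) = 0F
  γ b (inj₁ 3F) = if b then 1F else 0F
  γ b (inj₁ 4F) = 1F
  γ b (inj₂ l) = suc (suc l)

  avoided : Bool → Fin 5
  avoided true = 4F
  avoided false = 2F

  conflict : ∀ b x y → joinPat m x y ≡ true → γ b x ≡ γ b y → x ≡ inj₁ (avoided b) ⊎ y ≡ inj₁ (avoided b)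
  conflict b (inj₁ i) (inj₁ i′) e g = [ inj₁ ∘ cong inj₁ , inj₂ ∘ cong inj₁ ]′ (table b i i′ e g)
    where
    table : ∀ b i i′ → c5Adj i i′ ≡ true → γ b (inj₁ i) ≡ γ b (inj₁ i′) → i ≡ avoided b ⊎ i′ ≡ avoided b
    table true = toWitness {a? = Finₚ.all? λ i → Finₚ.all? λ i′ → (c5Adj i i′ ≟ᵇ true) →-dec ((γ true
        (inj₁ i) ≟ᶠ γ true (inj₁ i′)) →-dec ((i ≟ᶠ 4F) ⊎-dec (i′ ≟ᶠ 4F)))} _
    table false = toWitness {a? = Finₚ.all? λ i → Finₚ.all? λ i′ → (c5Adj i i′ ≟ᵇ true) →-dec ((γ false
        (inj₁ i) ≟ᶠ γ false (inj₁ i′)) →-dec ((i ≟ᶠ 2F) ⊎-dec (i′ ≟ᶠ 2F)))} _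
  conflict b (inj₁ i) (inj₂ l) e g = contradiction g (apart b i)
    where
    apart : ∀ b i → γ b (inj₁ i) ≢ suc (suc l)
    apart b 0F ()
    apart b 1F ()
    apart b 2F ()
    apart true 3F ()
    apart false 3F ()
    apart b 4F ()
  conflict b (inj₂ l) (inj₁ i) e g = contradiction (sym g) (apart b i)
    where
    apart : ∀ b i → γ b (inj₁ i) ≢ suc (suc l)
    apart b 0F ()
    apart b 1F ()
    apart b 2F ()
    apart true 3F ()
    apart false 3F ()
    apart b 4F ()
  conflict b (inj₂ l) (inj₂ l′) e g with Finₚ.suc-injective (Finₚ.suc-injective g)
  ... | refl = case trans (sym e) (joinPat-irrefl m (inj₂ l)) of λ ()

  -- Each of the two colourings `γ b` repeats a colour on `r + 1` vertices, so a clique of that size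
  -- meets both I₃ and I₅, which are not adjacent.
  no-clique : (K : Fin (suc r) → Fin n) → ¬ Clique G K
  no-clique K clique = final (Finₚ.any? (λ a → tag (inj₁ 4F) (π (K a)) ≟ᵇ true))
    where
    edge : ∀ a b → a ≢ b → joinPat m (π (K a)) (π (K b)) ≡ true
    edge a b ne = trans (sym (adjacency (K a) (K b))) (clique a b ne)
    bad : ∀ b → ∃[ a ] π (K a) ≡ inj₁ (avoided b)
    bad b with Finₚ.pigeonhole (n<1+n r) (λ a → γ b (π (K a)))
    ... | x , y , x<y , e with conflict b (π (K x)) (π (K y)) (edge x y (Finₚ.<⇒≢ x<y)) e
    ...   | inj₁ p = x , p
    ...   | inj₂ p = y , p
    non-adjacent : ∀ {a a′} → π (K a) ≡ inj₁ 2F → π (K a′) ≡ inj₁ 4F → ⊥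
    non-adjacent {a} {a′} e e′ with a ≟ᶠ a′
    ... | yes refl = case trans (sym e) e′ of λ ()
    ... | no ne = case trans (sym (edge a a′ ne)) (cong₂ (joinPat m) e e′) of λ ()
    final : Dec (∃[ a ] tag (inj₁ 4F) (π (K a)) ≡ true) → ⊥
    final (yes (a , e)) = non-adjacent (proj₂ (bad false)) (tag-sound (inj₁ 4F) (π (K a)) e)
    final (no none) = none (proj₁ (bad true) , trans (cong (tag (inj₁ 4F)) (proj₂ (bad true))) refl)

  -- Since `k ≥ 1`, the spine and one page form a clique on `r + 1` vertices.
  book-free : ∀ {k} → 1 ≤ k → Free (Book r k) G
  book-free {k} 1≤k (f , f-inj , f-hom) = no-clique (λ a → f (inject≤ a r+1≤)) λ a b ne → f-hom _ _ (book-edge a b ne)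
    where
    r+1≤ : suc r ≤ r + k
    r+1≤ = ≤-trans (≤-reflexive (+-comm 1 r)) (+-monoʳ-≤ r 1≤k)
    ≮r⇒≡ : ∀ (a : Fin (suc r)) → ¬ (toℕ (inject≤ a r+1≤) < r) → toℕ (inject≤ a r+1≤) ≡ r
    ≮r⇒≡ a h = ≤-antisym (≤-trans (≤-reflexive (Finₚ.toℕ-inject≤ a r+1≤)) (s≤s⁻¹ (Finₚ.toℕ<n a))) (≮⇒≥ h)
    book-edge : ∀ a b → a ≢ b → bookAdj r k (inject≤ a r+1≤) (inject≤ b r+1≤) ≡ true
    book-edge a b ne with toℕ (inject≤ a r+1≤) ≟ⁿ toℕ (inject≤ b r+1≤)
    ... | yes e = contradiction (Finₚ.toℕ-injective (trans (sym (Finₚ.toℕ-inject≤ a r+1≤)) (trans e (Finₚ.toℕ-inject≤ b r+1≤)))) ne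
    ... | no ne′ with toℕ (inject≤ a r+1≤) <? r | toℕ (inject≤ b r+1≤) <? r
    ...   | yes _ | _ = refl
    ...   | no _ | yes _ = refl
    ...   | no p | no p′ = contradiction (trans (≮r⇒≡ a p) (sym (≮r⇒≡ b p′))) ne′

  module _ (3≤q : 3 ≤ q) where

    class-nonempty : ∀ x → 1 ≤ class x
    class-nonempty (inj₁ 0F) = +-cancelʳ-≤ 2 1 _ (≤-trans 3≤q (balanced-≥ balanced₁))
    class-nonempty (inj₁ 1F) = class₂
    class-nonempty (inj₁ 2F) = ≤-reflexive (sym class₃)
    class-nonempty (inj₁ 3F) = ≤-reflexive (sym class₄)
    class-nonempty (inj₁ 4F) = class₅
    class-nonempty (inj₂ l) = ≤-trans (≤-trans (s≤s z≤n) 3≤q) (balanced-≥ (balancedᵗ l))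

    rep : ∀ x → ∃[ v ] π v ≡ x
    rep x = let v , e = count-witness (λ v → tag x (π v)) (class-nonempty x) in v , tag-sound x (π v) e

    module _ (f : Fin n → Fin r) (proper : ∀ u v → adj G u v ≡ true → f u ≢ f v) where

      g : Label m → Fin r
      g x = f (proj₁ (rep x))

      g-proper : ∀ x y → joinPat m x y ≡ true → g x ≢ g y
      g-proper x y e = proper _ _ (trans (adjacency _ _) (trans (cong₂ (joinPat m) (proj₂ (rep x)) (proj₂ (rep y))) e))

      -- The Turán parts are joined to the cycle and to one another, so three colours on the cycle
      -- add up with `m` further ones to `r + 1`.
      too-many : ∀ i₁ i₂ i₃ → g (inj₁ i₁) ≢ g (inj₁ i₂) → g (inj₁ i₁) ≢ g (inj₁ i₃) → g (inj₁ i₂) ≢ g (inj₁ i₃) → ⊥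
      too-many i₁ i₂ i₃ ne₁₂ ne₁₃ ne₂₃ with Finₚ.pigeonhole (n<1+n r) h
        where
        h : Fin (suc r) → Fin r
        h 0F = g (inj₁ i₁)
        h 1F = g (inj₁ i₂)
        h 2F = g (inj₁ i₃)
        h (suc (suc (suc l))) = g (inj₂ l)
      ... | 0F , 1F , _ , e = ne₁₂ e
      ... | 0F , 2F , _ , e = ne₁₃ e
      ... | 1F , 2F , _ , e = ne₂₃ e
      ... | 0F , suc (suc (suc l)) , _ , e = g-proper (inj₁ i₁) (inj₂ l) refl e
      ... | 1F , suc (suc (suc l)) , _ , e = g-proper (inj₁ i₂) (inj₂ l) refl e
      ... | 2F , suc (suc (suc l)) , _ , e = g-proper (inj₁ i₃) (inj₂ l) refl e
      ... | suc (suc (suc l)) , suc (suc (suc l′)) , lt , e =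
        g-proper (inj₂ l) (inj₂ l′) (joinPat-parts m λ { refl → n≮n _ lt }) e
      ... | 1F , 1F , lt , e = n≮n _ lt
      ... | 2F , 2F , lt , e = n≮n _ lt
      ... | 1F , 0F , () , e
      ... | 2F , 0F , () , e
      ... | 2F , 1F , s≤s () , e
      ... | suc (suc (suc l)) , 1F , s≤s () , e
      ... | suc (suc (suc l)) , 2F , s≤s (s≤s ()) , e

      -- If I₁ and I₃ differ in colour, then I₁, I₂, I₃ use three colours. Otherwise I₅ differs from
      -- I₁ and hence from I₃, and I₃, I₄, I₅ use three.
      not-proper : ⊥
      not-proper with g (inj₁ 0F) ≟ᶠ g (inj₁ 2F)
      ... | no ne = too-many 0F 1F 2F (g-proper (inj₁ 0F) (inj₁ 1F) refl) ne (g-proper (inj₁ 1F) (inj₁ 2F) refl)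
      ... | yes e = too-many 2F 3F 4F (g-proper (inj₁ 2F) (inj₁ 3F) refl) (λ e′ → g-proper (inj₁ 0F) (inj₁ 4F) refl (trans e e′)) (g-proper (inj₁ 3F) (inj₁ 4F) refl)

    admissible : ∀ {k} → 1 ≤ k → Admissible r (Book r k) G
    admissible 1≤k = (λ (f , proper) → not-proper f proper) , book-free 1≤k

-- Existence of blow-ups

sum-split : ∀ m {n} (f : Fin (m + n) → ℕ) → sum f ≡ sum (λ i → f (i ↑ˡ n)) + sum (λ i → f (m ↑ʳ i))
sum-split zero f = sym (cong (_+ sum f) (sum-empty _))
sum-split (suc m) {n} f = begin
  sum f                                                                                     ≡⟨ sum-suc f ⟩
  f zero + sum (f ∘ suc)                                                                    ≡⟨ cong (f zero +_) (sum-split m (f ∘ suc)) ⟩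
  f zero + (sum (λ i → f (suc (i ↑ˡ n))) + sum (λ i → f (suc (m ↑ʳ i))))                    ≡⟨ sym (+-assoc (f zero) _ _) ⟩
  f zero + sum (λ i → f (suc (i ↑ˡ n))) + sum (λ i → f (suc (m ↑ʳ i)))
    ≡⟨ cong (_+ sum (λ i → f (suc (m ↑ʳ i)))) (sym (sum-suc (λ i → f (i ↑ˡ n)))) ⟩
  sum (λ i → f (i ↑ˡ n)) + sum (λ i → f (suc m ↑ʳ i))                                       ∎
  where open ≡-Reasoning

realise : ∀ m (a : Fin m → ℕ) {n} → sum a ≡ n → Σ[ π ∈ (Fin n → Fin m) ] (∀ i → count (λ v → π v == i) ≡ a i)
realise zero a e with trans (sym (sum-empty a)) e
... | refl = (λ ()) , λ ()
realise (suc m) a e with trans (sym (sum-suc a)) e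
... | refl = π , sizes
  where
  rec = realise m (a ∘ suc) refl
  π : Fin (a zero + sum (a ∘ suc)) → Fin (suc m)
  π v = [ (λ _ → zero) , (λ v → suc (proj₁ rec v)) ]′ (splitAt (a zero) v)
  on-left : ∀ v → π (v ↑ˡ sum (a ∘ suc)) ≡ zero
  on-left v rewrite Finₚ.splitAt-↑ˡ (a zero) v (sum (a ∘ suc)) = refl
  on-right : ∀ v → π (a zero ↑ʳ v) ≡ suc (proj₁ rec v)
  on-right v rewrite Finₚ.splitAt-↑ʳ (a zero) (sum (a ∘ suc)) v = refl
  sizes : ∀ i → count (λ v → π v == i) ≡ a i
  sizes i = trans (sum-split (a zero) (λ v → ⟦ π v == i ⟧)) (trans (cong₂ _+_ (sum-cong λ v → cong (λ x → ⟦ x == i ⟧)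
      (on-left v)) (sum-cong λ v → cong (λ x → ⟦ x == i ⟧) (on-right v))) (values i))
    where
    values : ∀ i → sum {a zero} (λ _ → ⟦ zero == i ⟧) + sum (λ v → ⟦ suc (proj₁ rec v) == i ⟧) ≡ a i
    values zero = trans (cong₂ _+_ (trans (sum-const (a zero) 1) (*-identityʳ _)) (sum-zero λ _ → refl)) (+-identityʳ _)
    values (suc i) = trans (cong₂ _+_ (sum-zero {a zero} λ _ → refl) (sum-cong λ v → cong ⟦_⟧ (==-suc (proj₁ rec v) i))) (proj₂ rec i)

count-below : ∀ M p → p ≤ M → count {M} (λ l → toℕ l <ᵇ p) ≡ p
count-below M zero _ = sum-zero {M} λ _ → refl
count-below (suc M) (suc p) (s≤s le) = trans (sum-suc _) (cong suc (count-below M p le))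

tag-splitAt : ∀ {m} (x : Label m) w → tag x (splitAt 5 w) ≡ (w == Fin.join 5 m x)
tag-splitAt {m} x w with w ≟ᶠ Fin.join 5 m x
... | yes refl = trans (cong (tag x) (Finₚ.splitAt-join 5 m x)) (tag-refl x)
  where
  tag-refl : ∀ {m} (x : Label m) → tag x x ≡ true
  tag-refl (inj₁ i) = ==-true {x = i} refl
  tag-refl (inj₂ l) = ==-true {x = l} refl
... | no ne with tag x (splitAt 5 w) in e
...   | false = refl
...   | true = contradiction (trans (sym (Finₚ.join-splitAt 5 m w)) (cong (Fin.join 5 m) (tag-sound x (splitAt 5 w) e))) ne

-- The adjusted sizes sum to `n + 1`, so `p + 1` of them must be `q + 1`. The part I₂ ∪ I₅, with
-- `1 + (q - 1)` vertices, is always one; `bump` raises `p` of the other `suc m`, index 0 being the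
-- part of I₁ and `suc l` the Turán part `l`.
blow-up-exists : ∀ q m {n p} → 3 ≤ q → p ≤ suc m → n ≡ q * (2 + m) + p → Σ[ G ∈ Graph n ] BlowUp q m G
blow-up-exists q@(suc (suc (suc q′))) m {n} {p} (s≤s (s≤s (s≤s _))) p≤ n≡ = G , record
  { π = π ; adjacency = λ u v → refl
  ; class₃ = classes (inj₁ 2F) ; class₄ = classes (inj₁ 3F)
  ; class₂ = ≤-reflexive (sym (classes (inj₁ 1F))) ; class₅ = ≤-trans (s≤s z≤n) (≤-reflexive (sym (classes (inj₁ 4F))))
  ; balanced₁ = subst (Balanced q) (sym (trans (cong (_+ 2) (classes (inj₁ 0F))) (arith₁ q′ (bump 0)))) (bumped 0)
  ; balanced₂ = inj₂ (cong₂ (λ a b → a + b + 1) (classes (inj₁ 1F)) (classes (inj₁ 4F)))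
  ; balancedᵗ = λ l → subst (Balanced q) (sym (classes (inj₂ l))) (bumped (suc (toℕ l))) }
  where
  bump : ℕ → ℕ
  bump l = ⟦ l <ᵇ p ⟧
  bumped : ∀ l → Balanced q (q + bump l)
  bumped l with l <ᵇ p
  ... | true = inj₂ refl
  ... | false = inj₁ (+-identityʳ q)
  arith₁ : ∀ q′ b → suc q′ + b + 2 ≡ suc (suc (suc q′)) + b
  arith₁ = solve-∀
  sizes : Label m → ℕ
  sizes (inj₁ i) = vec5 (suc q′ + bump 0) 1 1 1 (suc (suc q′)) i
  sizes (inj₂ l) = q + bump (suc (toℕ l))
  sum₅ : (f : Fin 5 → ℕ) → sum f ≡ f 0F + (f 1F + (f 2F + (f 3F + (f 4F + 0))))
  sum₅ f = trans (sum-suc f) (cong (f 0F +_) (trans (sum-suc _) (cong (f 1F +_) (trans (sum-suc _) (cong (f 2F +_)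
             (trans (sum-suc _) (cong (f 3F +_) (trans (sum-suc _) (cong (f 4F +_) (sum-empty _))))))))))
  total : sum (λ i → sizes (splitAt 5 i)) ≡ n
  total = begin
    sum (λ i → sizes (splitAt 5 i))                                                ≡⟨ sum-split 5 _ ⟩
    sum (λ i → sizes (splitAt 5 (i ↑ˡ m))) + sum (λ l → sizes (splitAt 5 (5 ↑ʳ l)))
      ≡⟨ cong₂ _+_ (sum₅ (λ i → sizes (splitAt 5 (i ↑ˡ m)))) (trans (sum-cong (λ l → cong sizes (Finₚ.splitAt-↑ʳ 5 m l))) (sum-+ (λ _ → q) _)) ⟩
    suc q′ + bump 0 + (1 + (1 + (1 + (suc (suc q′) + 0)))) + (sum {m} (λ _ → q) + sum (λ l → bump (suc (toℕ l))))
                                                                                   ≡⟨ cong (λ a → suc q′ + bump 0 + (1 + (1 + (1 + (suc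
                                                                                      (suc q′) + 0)))) + (a + sum (λ l → bump (suc (toℕ l))))) (sum-const m q) ⟩
    suc q′ + bump 0 + (1 + (1 + (1 + (suc (suc q′) + 0)))) + (m * q + sum (λ l → bump (suc (toℕ {m} l))))
                                                                                   ≡⟨ arith₂ q′ m (bump 0) _ ⟩
    q * (2 + m) + (bump 0 + sum (λ l → bump (suc (toℕ {m} l))))
      ≡⟨ cong (q * (2 + m) +_) (trans (sym (sum-suc {m} (λ l → bump (toℕ l)))) (count-below (suc m) p p≤)) ⟩
    q * (2 + m) + p                                                                ≡⟨ sym n≡ ⟩
    n                                                                              ∎
    where
    open ≡-Reasoning
    arith₂ : ∀ q′ m b s → suc q′ + b + (1 + (1 + (1 + (suc (suc q′) + 0)))) + (m * (3 + q′) + s) ≡ (3 + q′) * (2 + m) + (b + s)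
    arith₂ = solve-∀
  real = realise (5 + m) (λ i → sizes (splitAt 5 i)) total
  π : Fin n → Label m
  π v = splitAt 5 (proj₁ real v)
  classes : ∀ x → count (λ v → tag x (π v)) ≡ sizes x
  classes x = trans (sum-cong λ v → cong ⟦_⟧ (tag-splitAt x (proj₁ real v))) (trans (proj₂ real (Fin.join 5 m x)) (cong sizes (Finₚ.splitAt-join 5 m x)))
  G : Graph n
  G = record { adj = λ u v → joinPat m (π u) (π v) ; adjSym = λ u v → joinPat-sym m (π u) (π v) ; adjIrrefl = λ u → joinPat-irrefl m (π u) }

-- From the near-partite structure to a labelling

module FromNearPartite {n q m} (G : Graph n) (P : NearPartite (2 + m) q G) where

  open NearPartite P
  open Coloured G c using (size)

  private
    r = 2 + m
    i = c u

    j′ : Fin (suc m)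
    j′ = punchOut (j≢i ∘ sym)

    other : Fin m → Fin r
    other a = punchIn i (punchIn j′ a)

    other≢i : ∀ a → other a ≢ i
    other≢i a = Finₚ.punchInᵢ≢i i (punchIn j′ a)

    other≢j : ∀ a → other a ≢ j
    other≢j a e = Finₚ.punchInᵢ≢i j′ a (Finₚ.punchIn-injective i _ _ (trans e (sym (Finₚ.punchIn-punchOut (j≢i ∘ sym)))))

    other-injective : ∀ {a b} → other a ≡ other b → a ≡ b
    other-injective {a} {b} e = Finₚ.punchIn-injective j′ a b (Finₚ.punchIn-injective i _ _ e)

    End : Fin n → Set
    End x = x ≡ u ⊎ x ≡ w

  locate : ∀ l → l ≡ i ⊎ l ≡ j ⊎ (∃[ a ] l ≡ other a)
  locate l with i ≟ᶠ l | j ≟ᶠ l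
  ... | yes e | _ = inj₁ (sym e)
  ... | no _ | yes e = inj₂ (inj₁ (sym e))
  ... | no i≢l | no j≢l = inj₂ (inj₂ (punchOut j′≢ , trans (sym (Finₚ.punchIn-punchOut i≢l)) (cong (punchIn i) (sym (Finₚ.punchIn-punchOut j′≢)))))
    where
    j′≢ : j′ ≢ punchOut i≢l
    j′≢ e = j≢l (Finₚ.punchOut-injective (j≢i ∘ sym) i≢l e)

  -- Inside `V_j`, I₂ is the neighbourhood of `w` and I₅ that of `u`. As a relation it lets
  -- adjacency and class sizes be checked by cases on labels, without unfolding `classify`.
  data Spec (v : Fin n) : Label m → Set where
    spec₁ : c v ≡ i → ¬ End v → Spec v (inj₁ 0F)
    spec₂ : c v ≡ j → adj G w v ≡ true → Spec v (inj₁ 1F)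
    spec₃ : v ≡ w → Spec v (inj₁ 2F)
    spec₄ : v ≡ u → Spec v (inj₁ 3F)
    spec₅ : c v ≡ j → adj G u v ≡ true → Spec v (inj₁ 4F)
    specᵗ : ∀ {a} → c v ≡ other a → Spec v (inj₂ a)

  classify : ∀ v → ∃[ x ] Spec v x
  classify v with locate (c v)
  ... | inj₂ (inj₂ (a , e)) = _ , specᵗ e
  ... | inj₂ (inj₁ e) with adj G u v in uv
  ...   | true = _ , spec₅ e uv
  ...   | false = _ , spec₂ e (trans (exactly-one e) (cong not uv))
  classify v | inj₁ e with v ≟ᶠ w | v ≟ᶠ u
  ... | yes v≡w | _ = _ , spec₃ v≡w
  ... | no _ | yes v≡u = _ , spec₄ v≡u
  ... | no v≢w | no v≢u = _ , spec₁ e [ v≢u , v≢w ]′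

  private
    cw : c w ≡ i
    cw = sym cuw

    end-colour : ∀ {v} → End v → c v ≡ i
    end-colour (inj₁ refl) = refl
    end-colour (inj₂ refl) = cw

    inner-false : ∀ {x y} → c x ≡ c y → ¬ (End x × End y) → adj G x y ≡ false
    inner-false {x} {y} e ne with adj G x y in xy
    ... | true = contradiction (only-inner e xy) ne
    ... | false = refl

    j-not-end : ∀ {v} → c v ≡ j → ¬ End v
    j-not-end e ev = j≢i (trans (sym e) (end-colour ev))

    uj : ∀ {y} → c y ≡ j → adj G w y ≡ true → adj G u y ≡ false
    uj {y} e wy with adj G u y | trans (sym wy) (exactly-one e)
    ... | false | _ = refl

    wj : ∀ {y} → c y ≡ j → adj G u y ≡ true → adj G w y ≡ false
    wj e uy = trans (exactly-one e) (cong not uy)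

    swap : ∀ {x y b} → adj G y x ≡ b → adj G x y ≡ b
    swap {x} {y} e = trans (adjSym G x y) e

    free-cross : ∀ {x y} → c x ≡ i → ¬ End x → c y ≡ j → adj G x y ≡ true
    free-cross cx nx cy = only-missing (λ e → j≢i (trans (sym cy) (trans (sym e) cx))) (nx ∘ proj₁) (j-not-end cy ∘ proj₁)

    other-cross : ∀ {x y a} → c x ≡ other a → c y ≢ other a → adj G x y ≡ true
    other-cross {a = a} cx ny = only-missing (λ e → ny (trans (sym e) cx)) (λ (ex , _) → other≢i a (trans
        (sym cx) (end-colour ex))) (λ (_ , e) → other≢j a (trans (sym cx) e))

    i≢other : ∀ {x a} → c x ≡ i → c x ≢ other a
    i≢other e e′ = other≢i _ (trans (sym e′) e)

    j≢other : ∀ {x a} → c x ≡ j → c x ≢ other a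
    j≢other e e′ = other≢j _ (trans (sym e′) e)

  spec-adj : ∀ {x y s t} → Spec x s → Spec y t → adj G x y ≡ joinPat m s t
  spec-adj (spec₁ e n₁) (spec₁ e′ _) = inner-false (trans e (sym e′)) (n₁ ∘ proj₁)
  spec-adj (spec₁ e n₁) (spec₂ e′ _) = free-cross e n₁ e′
  spec-adj (spec₁ e n₁) (spec₃ refl) = inner-false (trans e cuw) (n₁ ∘ proj₁)
  spec-adj (spec₁ e n₁) (spec₄ refl) = inner-false e (n₁ ∘ proj₁)
  spec-adj (spec₁ e n₁) (spec₅ e′ _) = free-cross e n₁ e′
  spec-adj (spec₂ e′ _) (spec₁ e n₁) = swap (free-cross e n₁ e′)
  spec-adj (spec₂ e _) (spec₂ e′ _) = inner-false (trans e (sym e′)) (j-not-end e ∘ proj₁)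
  spec-adj (spec₂ e a) (spec₃ refl) = swap a
  spec-adj (spec₂ e a) (spec₄ refl) = swap (uj e a)
  spec-adj (spec₂ e _) (spec₅ e′ _) = inner-false (trans e (sym e′)) (j-not-end e ∘ proj₁)
  spec-adj (spec₃ refl) (spec₁ e n₁) = inner-false (trans cw (sym e)) (n₁ ∘ proj₂)
  spec-adj (spec₃ refl) (spec₂ e a) = a
  spec-adj (spec₃ refl) (spec₃ refl) = adjIrrefl G w
  spec-adj (spec₃ refl) (spec₄ refl) = swap uw
  spec-adj (spec₃ refl) (spec₅ e a) = wj e a
  spec-adj (spec₄ refl) (spec₁ e n₁) = inner-false (sym e) (n₁ ∘ proj₂)
  spec-adj (spec₄ refl) (spec₂ e a) = uj e a
  spec-adj (spec₄ refl) (spec₃ refl) = uw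
  spec-adj (spec₄ refl) (spec₄ refl) = adjIrrefl G u
  spec-adj (spec₄ refl) (spec₅ e a) = a
  spec-adj (spec₅ e′ _) (spec₁ e n₁) = swap (free-cross e n₁ e′)
  spec-adj (spec₅ e _) (spec₂ e′ _) = inner-false (trans e (sym e′)) (j-not-end e ∘ proj₁)
  spec-adj (spec₅ e a) (spec₃ refl) = swap (wj e a)
  spec-adj (spec₅ e a) (spec₄ refl) = swap a
  spec-adj (spec₅ e _) (spec₅ e′ _) = inner-false (trans e (sym e′)) (j-not-end e ∘ proj₁)
  spec-adj (spec₁ e _) (specᵗ e′) = swap (other-cross e′ (i≢other e))
  spec-adj (spec₂ e _) (specᵗ e′) = swap (other-cross e′ (j≢other e))
  spec-adj (spec₃ refl) (specᵗ e′) = swap (other-cross e′ (i≢other cw))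
  spec-adj (spec₄ refl) (specᵗ e′) = swap (other-cross e′ (i≢other refl))
  spec-adj (spec₅ e _) (specᵗ e′) = swap (other-cross e′ (j≢other e))
  spec-adj (specᵗ e′) (spec₁ e _) = other-cross e′ (i≢other e)
  spec-adj (specᵗ e′) (spec₂ e _) = other-cross e′ (j≢other e)
  spec-adj (specᵗ e′) (spec₃ refl) = other-cross e′ (i≢other cw)
  spec-adj (specᵗ e′) (spec₄ refl) = other-cross e′ (i≢other refl)
  spec-adj (specᵗ e′) (spec₅ e _) = other-cross e′ (j≢other e)
  spec-adj (specᵗ {a} e) (specᵗ {b} e′) with a ≟ᶠ b
  ... | yes refl = inner-false (trans e (sym e′)) λ (ex , _) → other≢i a (trans (sym e) (end-colour ex))
  ... | no ne = other-cross e λ e″ → ne (other-injective (trans (sym e″) e′))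

  π : Fin n → Label m
  π v = proj₁ (classify v)

  class : Label m → ℕ
  class x = count λ v → tag x (π v)

  private
    u≢w : u ≢ w
    u≢w = adj-≢ G uw

    of-size : ∀ {l} (f : Label m → ℕ) → (∀ {v s} → Spec v s → f s ≡ ⟦ c v == l ⟧) → sum (λ v → f (π v)) ≡ size l
    of-size f h = sum-cong λ v → h (proj₂ (classify v))

  size-i : class (inj₁ 0F) + (class (inj₁ 2F) + class (inj₁ 3F)) ≡ size i
  size-i = trans (sym (trans (sum-+ _ _) (cong (class (inj₁ 0F) +_) (sum-+ _ _)))) (of-size (λ s → ⟦ tag
      (inj₁ 0F) s ⟧ + (⟦ tag (inj₁ 2F) s ⟧ + ⟦ tag (inj₁ 3F) s ⟧)) value)
    where
    value : ∀ {v s} → Spec v s → ⟦ tag (inj₁ 0F) s ⟧ + (⟦ tag (inj₁ 2F) s ⟧ + ⟦ tag (inj₁ 3F) s ⟧) ≡ ⟦ c v == i ⟧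
    value (spec₁ e _) = sym (cong ⟦_⟧ (==-true e))
    value (spec₂ e _) = sym (cong ⟦_⟧ (==-false λ e′ → j≢i (trans (sym e) e′)))
    value (spec₃ refl) = sym (cong ⟦_⟧ (==-true cw))
    value (spec₄ refl) = sym (cong ⟦_⟧ (==-true {x = i} refl))
    value (spec₅ e _) = sym (cong ⟦_⟧ (==-false λ e′ → j≢i (trans (sym e) e′)))
    value (specᵗ e) = sym (cong ⟦_⟧ (==-false λ e′ → other≢i _ (trans (sym e) e′)))

  size-j : class (inj₁ 1F) + class (inj₁ 4F) ≡ size j
  size-j = trans (sym (sum-+ _ _)) (of-size (λ s → ⟦ tag (inj₁ 1F) s ⟧ + ⟦ tag (inj₁ 4F) s ⟧) value)
    where
    value : ∀ {v s} → Spec v s → ⟦ tag (inj₁ 1F) s ⟧ + ⟦ tag (inj₁ 4F) s ⟧ ≡ ⟦ c v == j ⟧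
    value (spec₁ e _) = sym (cong ⟦_⟧ (==-false λ e′ → j≢i (trans (sym e′) e)))
    value (spec₂ e _) = sym (cong ⟦_⟧ (==-true e))
    value (spec₃ refl) = sym (cong ⟦_⟧ (==-false λ e′ → j≢i (trans (sym e′) cw)))
    value (spec₄ refl) = sym (cong ⟦_⟧ (==-false λ e′ → j≢i (sym e′)))
    value (spec₅ e _) = sym (cong ⟦_⟧ (==-true e))
    value (specᵗ e) = sym (cong ⟦_⟧ (==-false λ e′ → other≢j _ (trans (sym e) e′)))

  sizeᵗ : ∀ a → class (inj₂ a) ≡ size (other a)
  sizeᵗ a = of-size (λ s → ⟦ tag (inj₂ a) s ⟧) value
    where
    value : ∀ {v s} → Spec v s → ⟦ tag (inj₂ a) s ⟧ ≡ ⟦ c v == other a ⟧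
    value (spec₁ e _) = sym (cong ⟦_⟧ (==-false (i≢other e)))
    value (spec₂ e _) = sym (cong ⟦_⟧ (==-false (j≢other e)))
    value (spec₃ refl) = sym (cong ⟦_⟧ (==-false (i≢other cw)))
    value (spec₄ refl) = sym (cong ⟦_⟧ (==-false (i≢other refl)))
    value (spec₅ e _) = sym (cong ⟦_⟧ (==-false (j≢other e)))
    value (specᵗ {b} e) with b ≟ᶠ a
    ... | yes refl = sym (cong ⟦_⟧ (==-true e))
    ... | no ne = sym (cong ⟦_⟧ (==-false λ e′ → ne (other-injective (trans (sym e) e′))))

  class₃ : class (inj₁ 2F) ≡ 1
  class₃ = trans (sum-cong λ v → value (proj₂ (classify v))) (sum-δ₁ w)
    where
    value : ∀ {v s} → Spec v s → ⟦ tag (inj₁ 2F) s ⟧ ≡ δ w v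
    value (spec₁ _ n₁) = sym (δ-≢ (n₁ ∘ inj₂))
    value (spec₂ e _) = sym (δ-≢ (j-not-end e ∘ inj₂))
    value (spec₃ refl) = sym (δ-refl w)
    value (spec₄ refl) = sym (δ-≢ u≢w)
    value (spec₅ e _) = sym (δ-≢ (j-not-end e ∘ inj₂))
    value (specᵗ e) = sym (δ-≢ λ { refl → i≢other cw e })

  class₄ : class (inj₁ 3F) ≡ 1
  class₄ = trans (sum-cong λ v → value (proj₂ (classify v))) (sum-δ₁ u)
    where
    value : ∀ {v s} → Spec v s → ⟦ tag (inj₁ 3F) s ⟧ ≡ δ u v
    value (spec₁ _ n₁) = sym (δ-≢ (n₁ ∘ inj₁))
    value (spec₂ e _) = sym (δ-≢ (j-not-end e ∘ inj₁))
    value (spec₃ refl) = sym (δ-≢ (u≢w ∘ sym))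
    value (spec₄ refl) = sym (δ-refl u)
    value (spec₅ e _) = sym (δ-≢ (j-not-end e ∘ inj₁))
    value (specᵗ e) = sym (δ-≢ λ { refl → i≢other refl e })

  private
    in-class₂ : ∀ {y s} → Spec y s → c y ≡ j → adj G w y ≡ true → tag (inj₁ 1F) s ≡ true
    in-class₂ (spec₁ e _) e′ _ = contradiction (trans (sym e′) e) j≢i
    in-class₂ (spec₂ _ _) _ _ = refl
    in-class₂ (spec₃ refl) e′ _ = contradiction (inj₂ refl) (j-not-end e′)
    in-class₂ (spec₄ refl) e′ _ = contradiction (inj₁ refl) (j-not-end e′)
    in-class₂ (spec₅ e a) _ a′ = case trans (sym (wj e a)) a′ of λ ()
    in-class₂ (specᵗ e) e′ _ = contradiction e (j≢other e′)

    in-class₅ : ∀ {y s} → Spec y s → c y ≡ j → adj G u y ≡ true → tag (inj₁ 4F) s ≡ true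
    in-class₅ (spec₁ e _) e′ _ = contradiction (trans (sym e′) e) j≢i
    in-class₅ (spec₂ e a) _ a′ = case trans (sym (uj e a)) a′ of λ ()
    in-class₅ (spec₃ refl) e′ _ = contradiction (inj₂ refl) (j-not-end e′)
    in-class₅ (spec₄ refl) e′ _ = contradiction (inj₁ refl) (j-not-end e′)
    in-class₅ (spec₅ _ _) _ _ = refl
    in-class₅ (specᵗ e) e′ _ = contradiction e (j≢other e′)

    inhabited : ∀ x v → tag x (π v) ≡ true → 1 ≤ class x
    inhabited x v e = ≤-trans (≤-reflexive (sym (cong ⟦_⟧ e))) (sum-≥ (λ v → ⟦ tag x (π v) ⟧) v)

  blow-up : BlowUp q m G
  blow-up = record
    { π = π ; adjacency = λ x y → spec-adj (proj₂ (classify x)) (proj₂ (classify y))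
    ; class₃ = class₃ ; class₄ = class₄
    ; class₂ = let y , cy , wy = w-neighbour in inhabited (inj₁ 1F) y (in-class₂ (proj₂ (classify y)) cy wy)
    ; class₅ = let y , cy , uy = u-neighbour in inhabited (inj₁ 4F) y (in-class₅ (proj₂ (classify y)) cy uy)
    ; balanced₁ = subst (Balanced q) (trans (cong (size i +_) (δ-≢ (j≢i ∘ sym))) (trans (+-identityʳ _) (trans (sym size-i)
        (cong (class (inj₁ 0F) +_) (cong₂ _+_ class₃ class₄))))) (balanced i)
    ; balanced₂ = subst (Balanced q) (cong₂ _+_ (sym size-j) (δ-refl j)) (balanced j)
    ; balancedᵗ = λ a → subst (Balanced q) (trans (cong (size (other a) +_) (δ-≢ (other≢j a))) (trans (+-identityʳ _) (sym (sizeᵗ a)))) (balanced (other a))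
    }

-- The extremal families

-- A part below `q` keeps all parts at most `q`, and the sum falls below `q * m`; a part above
-- `q + 1` keeps all at least `q + 1`, and the sum exceeds `q * m + m`.
turan-balanced : ∀ {m} q {p} (s : Fin m → ℕ) → (∀ l l′ → s l ≤ suc (s l′)) → sum s ≡ q * m + p → p ≤ m → ∀ l → Balanced q (s l)
turan-balanced {m} q {p} s close total p≤m l with <-cmp (s l) q
... | tri≈ _ e _ = inj₁ e
... | tri< lt _ _ = contradiction (≤-trans (≤-trans (sum-strict (λ l′ → ≤-trans (close l′ l) lt) l lt) (≤-reflexive (trans (sum-const m q)
    (*-comm m q)))) (≤-trans (m≤m+n (q * m) p) (≤-reflexive (sym total)))) (<-irrefl refl)
... | tri> _ _ gt with <-cmp (s l) (suc q)
...   | tri< lt _ _ = contradiction (≤-trans lt gt) (<-irrefl refl)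
...   | tri≈ _ e _ = inj₂ (trans e (+-comm 1 q))
...   | tri> _ _ gt′ = contradiction (≤-trans (s≤s (≤-trans (≤-reflexive total) (≤-trans (+-monoʳ-≤ (q * m) p≤m)
    (≤-reflexive (trans (arith q m) (sym (sum-const m (suc q))))))))
                       (sum-strict (λ l′ → s≤s⁻¹ (≤-trans gt′ (close l l′))) l gt′)) (<-irrefl refl)
  where
  arith : ∀ q m → q * m + m ≡ m * suc q
  arith = solve-∀

module Families {n q₁ m : ℕ} (G : Graph n) where

  -- `q₀` and `q₁` are q - 1 and q - 2, so the truncated subtractions in the class sizes compute.
  q₀ q : ℕ
  q₀ = suc q₁
  q = suc q₀

  -- The common shape of the families: `a` is |I₁| and `x` is |I₂| + |I₅|; `t` runs over the
  -- splittings of `x` into two nonempty classes.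
  Family : ℕ → ℕ → ℕ → Set
  Family a x N = Σ[ t ∈ ℕ ] 1 ≤ t × t ≤ x ∸ 1 × IsC5JoinTuran G (vec5 a t 1 1 (x ∸ t)) m N

  module _ (B : BlowUp q m G) where

    open BlowUp B

    family : ∀ {a x N} → class (inj₁ 0F) ≡ a → class (inj₁ 1F) + class (inj₁ 4F) ≡ x → sum (λ l → class (inj₂ l)) ≡ N → Family a x N
    family {a} {x} {N} refl refl refl = class (inj₁ 1F) , class₂ , below , π , sizes , trans (sym (sum-sumFin _)) (sum-cong λ l → classSize-count π (inj₂ l)) ,
        (λ l l′ → subst₂ _≤_ (sym (classSize-count π (inj₂ l))) (cong suc (sym (classSize-count π (inj₂ l′))))
                    (≤-trans (balanced-≤ (balancedᵗ l)) (≤-trans (≤-reflexive (+-comm q 1)) (s≤s (balanced-≥ (balancedᵗ l′)))))) ,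
        adjacency
      where
      t = class (inj₁ 1F)
      b = class (inj₁ 4F)
      below : t ≤ t + b ∸ 1
      below = ≤-trans (≤-reflexive (sym (m+n∸n≡m t 1))) (∸-monoˡ-≤ 1 (+-monoʳ-≤ t class₅))
      sizes : ∀ i → classSize π (inj₁ i) ≡ vec5 (class (inj₁ 0F)) t 1 1 (t + b ∸ t) i
      sizes 0F = classSize-count π (inj₁ 0F)
      sizes 1F = classSize-count π (inj₁ 1F)
      sizes 2F = trans (classSize-count π (inj₁ 2F)) class₃
      sizes 3F = trans (classSize-count π (inj₁ 3F)) class₄
      sizes 4F = trans (classSize-count π (inj₁ 4F)) (sym (m+n∸m≡n t b))

  family⁻¹ : ∀ {a x N p} → 1 ≤ x → Balanced q (a + 2) → Balanced q (x + 1) → N ≡ q * m + p → p ≤ m → Family a x N → BlowUp q m G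
  family⁻¹ {a} {x} 1≤x bal₁ bal₂ N≡ p≤m (t , 1≤t , t≤ , π , sizes , total , close , adjacency) = record
    { π = π ; adjacency = adjacency
    ; class₃ = cls 2F ; class₄ = cls 3F
    ; class₂ = ≤-trans 1≤t (≤-reflexive (sym (cls 1F)))
    ; class₅ = ≤-trans (m<n⇒0<n∸m t<x) (≤-reflexive (sym (cls 4F)))
    ; balanced₁ = subst (λ y → Balanced q (y + 2)) (sym (cls 0F)) bal₁
    ; balanced₂ = subst (λ y → Balanced q (y + 1)) (sym (trans (cong₂ _+_ (cls 1F) (cls 4F)) (m+[n∸m]≡n (<⇒≤ t<x)))) bal₂
    ; balancedᵗ = λ l → subst (Balanced q) (classSize-count π (inj₂ l)) (turan-balanced q (λ l → classSize π
        (inj₂ l)) close (trans (sum-sumFin _) (trans total N≡)) p≤m l)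
    }
    where
    t<x : t < x
    t<x = ≤-trans (s≤s t≤) (≤-reflexive (m+[n∸m]≡n 1≤x))
    cls : ∀ i → count (λ v → tag (inj₁ i) (π v)) ≡ vec5 a t 1 1 (x ∸ t) i
    cls i = trans (sym (classSize-count π (inj₁ i))) (sizes i)

  half : ∀ x → 2 * x / 2 ≡ x
  half x = trans (cong (_/ 2) (*-comm 2 x)) (m*n/n≡m x 2)

  half₁ : (2 * q ∸ 1 ∸ 1) / 2 ≡ q₀
  half₁ = trans (cong (λ x → (x ∸ 1) / 2) (+-suc q₀ (q₀ + 0))) (half q₀)

  half₃ : (2 * q + 1 ∸ 1) / 2 ≡ q
  half₃ = trans (cong (_/ 2) (m+n∸n≡m (2 * q) 1)) (half q)

  -- In 𝒞₅², the class I₅ has size q − t − 1 = q₀ − t.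
  shift : ∀ t → q ∸ t ∸ 1 ≡ q₀ ∸ t
  shift t = trans (∸-+-assoc q t 1) (cong (q ∸_) (+-comm t 1))

  toC52 : ∀ {N} → Family q₀ q₀ N → InC52 G (2 * q) m N
  toC52 {N} (t , 1≤t , t≤ , join) = t , 1≤t , subst (λ h → t ≤ h ∸ 2) (sym (half q)) t≤ ,
    subst (λ h → IsC5JoinTuran G (vec5 (h ∸ 1) t 1 1 (h ∸ t ∸ 1)) m N) (sym (half q)) (subst (λ b → IsC5JoinTuran G (vec5 q₀ t 1 1 b) m N) (sym (shift t)) join)

  fromC52 : ∀ {N} → InC52 G (2 * q) m N → Family q₀ q₀ N
  fromC52 {N} (t , 1≤t , t≤ , join) = t , 1≤t , subst (λ h → t ≤ h ∸ 2) (half q) t≤ ,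
    subst (λ b → IsC5JoinTuran G (vec5 q₀ t 1 1 b) m N) (shift t) (subst (λ h → IsC5JoinTuran G (vec5 (h ∸ 1) t 1 1 (h ∸ t ∸ 1)) m N) (half q) join)

  private
    low₁ : Balanced q (q₁ + 2)
    low₁ = inj₁ (+-comm q₁ 2)
    high₁ : Balanced q (q₀ + 2)
    high₁ = inj₂ (+-suc q₀ 1)
    low₂ : Balanced q (q₀ + 1)
    low₂ = inj₁ (+-comm q₀ 1)
    high₂ : Balanced q (q + 1)
    high₂ = inj₂ refl

  module _ {p : ℕ} where

    InG1′ InG2′ InG3′ : Set
    InG1′ = InC53 G (2 * q ∸ 1) m (q * m + p + 1)
    InG2′ = InC51 G (2 * q) m (q * m + p) ⊎ InC52 G (2 * q) m (q * m + p)
    InG3′ = InC53 G (2 * q + 1) m (q * m + p ∸ 1)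

    fromG1 : p < m → InG1′ → BlowUp q m G
    fromG1 p<m F = family⁻¹ (s≤s z≤n) low₁ low₂ (trans (+-assoc (q * m) p 1) (cong (q * m +_) (+-comm p 1))) p<m
                     (subst (λ h → Family (h ∸ 1) h (q * m + p + 1)) half₁ F)

    fromG2 : p ≤ m → InG2′ → BlowUp q m G
    fromG2 p≤m (inj₁ F) = family⁻¹ (s≤s z≤n) low₁ high₂ refl p≤m (subst (λ h → Family (h ∸ 2) h (q * m + p)) (half q) F)
    fromG2 p≤m (inj₂ F) = family⁻¹ (s≤s z≤n) high₁ low₂ refl p≤m (fromC52 F)

    fromG3 : 1 ≤ p → p ≤ suc m → InG3′ → BlowUp q m G
    fromG3 1≤p p≤ F = family⁻¹ (s≤s z≤n) high₁ high₂ (+-∸-assoc (q * m) 1≤p) (∸-monoˡ-≤ 1 p≤) (subst (λ h → Family (h ∸ 1) h (q * m + p ∸ 1)) half₃ F)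

    -- The adjusted sizes of the two cycle parts decide: both `q` gives 𝒢₁, exactly one `q + 1`
    -- gives 𝒢₂, both `q + 1` gives 𝒢₃. What remains for the `m` Turán parts lies between `q * m`
    -- and `q * m + m`, whence the conditions on `p` that separate the cases of the theorem.
    toG : n ≡ q * (2 + m) + p → BlowUp q m G → (p < m × InG1′) ⊎ (p ≤ m × InG2′) ⊎ (1 ≤ p × InG3′)
    toG n≡ B = cases balanced₁ balanced₂
      where
      open BlowUp B
      open BlowUpProperties G B using (class-total)
      a = class (inj₁ 0F)
      x = class (inj₁ 1F) + class (inj₁ 4F)
      N = sum λ l → class (inj₂ l)
      N≤ : N ≤ q * m + m
      N≤ = ≤-trans (sum-mono λ l → balanced-≤ (balancedᵗ l)) (≤-reflexive (trans (sum-const m (q + 1)) (arith m q)))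
        where
        arith : ∀ m q → m * (q + 1) ≡ q * m + m
        arith = solve-∀
      N≥ : q * m ≤ N
      N≥ = ≤-trans (≤-reflexive (trans (*-comm q m) (sym (sum-const m q)))) (sum-mono λ l → balanced-≥ (balancedᵗ l))
      total : a + 2 + (x + N) ≡ q * (2 + m) + p
      total = trans class-total n≡
      key : a + 2 + (x + 1) + N ≡ q * (2 + m) + p + 1
      key = trans (arith (a + 2) x N) (cong (_+ 1) total)
        where
        arith : ∀ A x N → A + (x + 1) + N ≡ A + (x + N) + 1
        arith = solve-∀
      a-low : a + 2 ≡ q → a ≡ q₁
      a-low e = +-cancelʳ-≡ 2 a q₁ (trans e (sym (+-comm q₁ 2)))
      a-high : a + 2 ≡ q + 1 → a ≡ q₀
      a-high e = +-cancelʳ-≡ 2 a q₀ (trans e (sym (+-suc q₀ 1)))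
      x-low : x + 1 ≡ q → x ≡ q₀
      x-low e = +-cancelʳ-≡ 1 x q₀ (trans e (sym (+-comm q₀ 1)))
      x-high : x + 1 ≡ q + 1 → x ≡ q
      x-high = +-cancelʳ-≡ 1 x q
      remaining : ∀ {A X} → a + 2 ≡ A → x + 1 ≡ X → A + X + N ≡ q * (2 + m) + p + 1
      remaining refl refl = key
      N-low : q + q + N ≡ q * (2 + m) + p + 1 → N ≡ q * m + p + 1
      N-low e = +-cancelˡ-≡ (q + q) _ _ (trans e (arith q m p))
        where
        arith : ∀ q m p → q * (2 + m) + p + 1 ≡ q + q + (q * m + p + 1)
        arith = solve-∀
      N-mid : q + q + 1 + N ≡ q * (2 + m) + p + 1 → N ≡ q * m + p
      N-mid e = +-cancelˡ-≡ (q + q + 1) _ _ (trans e (arith q m p))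
        where
        arith : ∀ q m p → q * (2 + m) + p + 1 ≡ q + q + 1 + (q * m + p)
        arith = solve-∀
      N-high : q + 1 + (q + 1) + N ≡ q * (2 + m) + p + 1 → N + 1 ≡ q * m + p
      N-high e = +-cancelˡ-≡ (q + q + 1) _ _ (trans (arith₁ q N) (trans e (arith₂ q m p)))
        where
        arith₁ : ∀ q N → q + q + 1 + (N + 1) ≡ q + 1 + (q + 1) + N
        arith₁ = solve-∀
        arith₂ : ∀ q m p → q * (2 + m) + p + 1 ≡ q + q + 1 + (q * m + p)
        arith₂ = solve-∀
      p≤m : N ≡ q * m + p → p ≤ m
      p≤m e = +-cancelˡ-≤ (q * m) _ _ (≤-trans (≤-reflexive (sym e)) N≤)
      p<m : N ≡ q * m + p + 1 → p < m
      p<m e = +-cancelˡ-≤ (q * m) _ _ (≤-trans (≤-reflexive (trans (cong (q * m +_) (+-comm 1 p)) (trans (sym (+-assoc (q * m) p 1)) (sym e)))) N≤)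
      1≤p : N + 1 ≡ q * m + p → 1 ≤ p
      1≤p e = +-cancelˡ-≤ (q * m) _ _ (≤-trans (+-monoˡ-≤ 1 N≥) (≤-reflexive e))
      cases : Balanced q (a + 2) → Balanced q (x + 1) → (p < m × InG1′) ⊎ (p ≤ m × InG2′) ⊎ (1 ≤ p × InG3′)
      cases (inj₁ e) (inj₁ f) = let N≡ = N-low (remaining e f) in
        inj₁ (p<m N≡ , subst (λ h → Family (h ∸ 1) h (q * m + p + 1)) (sym half₁) (family B (a-low e) (x-low f) N≡))
      cases (inj₁ e) (inj₂ f) = let N≡ = N-mid (trans (cong (_+ N) (+-assoc q q 1)) (remaining e f)) in
        inj₂ (inj₁ (p≤m N≡ , inj₁ (subst (λ h → Family (h ∸ 2) h (q * m + p)) (sym (half q)) (family B (a-low e) (x-high f) N≡))))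
      cases (inj₂ e) (inj₁ f) = let N≡ = N-mid (trans (cong (_+ N) (arith q)) (remaining e f)) in
        inj₂ (inj₁ (p≤m N≡ , inj₂ (toC52 (family B (a-high e) (x-low f) N≡))))
        where
        arith : ∀ q → q + q + 1 ≡ q + 1 + q
        arith = solve-∀
      cases (inj₂ e) (inj₂ f) = let N≡ = N-high (remaining e f) in
        inj₂ (inj₂ (1≤p N≡ , subst (λ h → Family (h ∸ 1) h (q * m + p ∸ 1)) (sym half₃) (family B (a-high e)
            (x-high f) (trans (sym (m+n∸n≡m N 1)) (cong (_∸ 1) N≡)))))

-- The extremal number and the extremal graphs

edges-sum : ∀ {n} (G : Graph n) → 2 * edges G ≡ edge-sum G
edges-sum {n} G = begin
  2 * edges G                                       ≡⟨ cong (2 *_) (length-filter-product _) ⟩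
  2 * sum₂ up                                       ≡⟨ cong (sum₂ up +_) (+-identityʳ _) ⟩
  sum₂ up + sum₂ up                                 ≡⟨ sym (sum₂-sym up) ⟩
  sum₂ (λ u v → up u v + up v u)                    ≡⟨ sum₂-cong pointwise ⟩
  edge-sum G                                        ∎
  where
  open ≡-Reasoning
  up : Fin n → Fin n → ℕ
  up u v = ⟦ ⌊ (toℕ u <? toℕ v) ×-dec (adj G u v ≟ᵇ true) ⌋ ⟧
  pointwise : ∀ u v → up u v + up v u ≡ ⟦ adj G u v ⟧
  pointwise u v rewrite adjSym G v u with toℕ u <? toℕ v | toℕ v <? toℕ u | adj G u v in uv
  ... | yes lt | yes gt | _ = contradiction lt (<⇒≯ gt)
  ... | yes _ | no _ | true = refl
  ... | yes _ | no _ | false = refl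
  ... | no _ | yes _ | true = refl
  ... | no _ | yes _ | false = refl
  ... | no _ | no _ | false = refl
  ... | no ≮ | no ≯ | true = case trans (sym uv) (trans (cong (adj G u) (Finₚ.toℕ-injective (≤-antisym (≮⇒≥ ≮) (≮⇒≥ ≯)))) (adjIrrefl G u)) of λ ()

module Extremum {ρ k n q p} (1≤k : 1 ≤ k) (3≤q : 3 ≤ q) (n≡ : n ≡ q * (3 + ρ) + p) (p<r : p < 3 + ρ)
  (stable : (G : Graph n) → Admissible (3 + ρ) (Book (3 + ρ) k) G → Dense (3 + ρ) q G → NearPartite (3 + ρ) q G) where

  private
    r = 3 + ρ
    H = Book r k
    best = blow-up-exists q (suc ρ) 3≤q (s≤s⁻¹ p<r) n≡

  G₀ : Graph n
  G₀ = proj₁ best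

  B₀ : BlowUp q (suc ρ) G₀
  B₀ = proj₂ best

  extremal₀ : Extremal r q G₀
  extremal₀ = BlowUpProperties.extremal G₀ B₀

  admissible₀ : Admissible r H G₀
  admissible₀ = BlowUpProperties.admissible G₀ B₀ 3≤q 1≤k

  blow-up-edges : ∀ G → BlowUp q (suc ρ) G → edges G ≡ edges G₀
  blow-up-edges G B = *-cancelˡ-≡ _ _ 2 (trans (edges-sum G) (trans (+-cancelʳ-≡ ((2 * q + 1) * (n + 1)) _ _ (trans
      (sym (BlowUpProperties.extremal G B)) extremal₀)) (sym (edges-sum G₀))))

  -- `G₀` attains the bound exactly, so a graph with at least as many edges is dense enough for
  -- stability.
  large⇒blow-up : ∀ G → Admissible r H G → edges G₀ ≤ edges G → BlowUp q (suc ρ) G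
  large⇒blow-up G adm le = FromNearPartite.blow-up G (stable G adm (≤-trans (≤-reflexive extremal₀) (+-monoˡ-≤ ((2 * q + 1) * (n + 1))
    (subst₂ _≤_ (edges-sum G₀) (edges-sum G) (*-monoʳ-≤ 2 le)))))

  -- A graph with at least as many edges as `G₀` is itself a blow-up, and all blow-ups have equally
  -- many edges.
  maximum : ∀ G → Admissible r H G → edges G ≤ edges G₀
  maximum G adm = [ id , (λ le → ≤-reflexive (blow-up-edges G (large⇒blow-up G adm le))) ]′ (≤-total (edges G) (edges G₀))

  InEx⇒blow-up : ∀ G → InEx r H G → BlowUp q (suc ρ) G
  InEx⇒blow-up G (adm , max) = large⇒blow-up G adm (max G₀ admissible₀)

  blow-up⇒InEx : ∀ G → BlowUp q (suc ρ) G → InEx r H G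
  blow-up⇒InEx G B = BlowUpProperties.admissible G B 3≤q 1≤k , λ G′ adm → ≤-trans (maximum G′ adm) (≤-reflexive (sym (blow-up-edges G B)))

open import Data.Integer using (+_) renaming (_+_ to _+ᶻ_; _-_ to _-ᶻ_; ℤ to ℤ)
import Data.Integer.Tactic.RingSolver as ℤ-Solver

-- Multiplying the balance by `r` and substituting `n = q * r + p` eliminates `q`. The negative
-- terms of the formula are kept on the left until the passage to integers.
formula : ∀ r₁ n q p e → n ≡ q * suc r₁ + p → n * n + 3 + suc r₁ * (q * (q + 1)) ≡ 2 * e + (2 * q + 1) * (n + 1) →
  + (2 * suc r₁ * e) ≡ exFormula2r (suc r₁) n p
formula r₁ n q p e n≡ extremal = to-ℤ (2 * r * e) (r₁ * n * n) (2 * n) (p * (p + 2)) (r * p) (2 * r) (+-cancelʳ-≡ (r * ((2 * q + 1) * (n + 1))) _ _ (begin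
  2 * r * e + 2 * n + r * p + r * ((2 * q + 1) * (n + 1))       ≡⟨ arith₁ r e n p ((2 * q + 1) * (n + 1)) ⟩
  r * (2 * e + (2 * q + 1) * (n + 1)) + 2 * n + r * p           ≡⟨ cong (λ x → r * x + 2 * n + r * p) (sym extremal) ⟩
  r * (n * n + 3 + r * (q * (q + 1))) + 2 * n + r * p
    ≡⟨ subst (λ n → r * (n * n + 3 + r * (q * (q + 1))) + 2 * n + r * p ≡ r₁ * n * n + p * (p + 2) + 2 * r + r * ((2 * q + 1) * (n + 1))) (sym n≡) (arith₂ r₁ q p) ⟩
  r₁ * n * n + p * (p + 2) + 2 * r + r * ((2 * q + 1) * (n + 1)) ∎))
  where
  open ≡-Reasoning
  r = suc r₁
  arith₁ : ∀ r e n p Q → 2 * r * e + 2 * n + r * p + r * Q ≡ r * (2 * e + Q) + 2 * n + r * p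
  arith₁ = solve-∀
  arith₂ : ∀ r₁ q p → suc r₁ * ((q * suc r₁ + p) * (q * suc r₁ + p) + 3 + suc r₁ * (q * (q + 1))) + 2 * (q * suc r₁ + p) + suc r₁ * p
         ≡ r₁ * (q * suc r₁ + p) * (q * suc r₁ + p) + p * (p + 2) + 2 * suc r₁ + suc r₁ * ((2 * q + 1) * (q * suc r₁ + p + 1))
  arith₂ = solve-∀
  to-ℤ : ∀ X A B C D F → X + B + D ≡ A + C + F → + X ≡ (((+ A -ᶻ + B) +ᶻ + C) -ᶻ + D) +ᶻ + F
  to-ℤ X A B C D F e′ = trans (cancel (+ X) (+ B) (+ D)) (trans (cong (λ x → x -ᶻ + B -ᶻ + D) (cong +_ e′)) (rearrange (+ A) (+ B) (+ C) (+ D) (+ F)))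
    where
    cancel : ∀ (x b d : ℤ) → x ≡ x +ᶻ b +ᶻ d -ᶻ b -ᶻ d
    cancel = ℤ-Solver.solve-∀
    rearrange : ∀ (a b c d f : ℤ) → a +ᶻ c +ᶻ f -ᶻ b -ᶻ d ≡ a -ᶻ b +ᶻ c -ᶻ d +ᶻ f
    rearrange = ℤ-Solver.solve-∀

theorem1 : ∀ (r k : ℕ) → 3 ≤ r → 1 ≤ k →
    Σ ℕ λ n₀ → ∀ (n q p : ℕ) → n₀ ≤ n → n ≡ q * r + p → p < r →
    (Σ ℕ λ e → IsEx r (Book r k) n e × + (2 * r * e) ≡ exFormula2r r n p)
    × ((p ≡ 0 → ∀ (G : Graph n) → InEx r (Book r k) G ⇔ (InG1 G r q p ⊎ InG2 G r q p))
    × ((1 ≤ p → p ≤ r ∸ 3 → ∀ (G : Graph n) → InEx r (Book r k) G ⇔ (InG1 G r q p ⊎ (InG2 G r q p ⊎ InG3 G r q p)))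
    × ((p ≡ r ∸ 2 → ∀ (G : Graph n) → InEx r (Book r k) G ⇔ (InG2 G r q p ⊎ InG3 G r q p))
    × (p ≡ r ∸ 1 → ∀ (G : Graph n) → InEx r (Book r k) G ⇔ InG3 G r q p))))
-- This bound forces `q ≥ q₀ + 3`: `q₀` for stability, and 3 to make I₁, of size at least `q - 2`,
-- nonempty.
theorem1 (suc (suc (suc ρ))) k (s≤s (s≤s (s≤s _))) 1≤k = (q₀ + 3) * r , λ n q p n₀≤n n≡ p<r → conclude n q p n≡ p<r (q-large n q p n₀≤n n≡ p<r)
  where
  r = 3 + ρ
  q₀ = proj₁ (stability ρ k 1≤k)

  q-large : ∀ n q p → (q₀ + 3) * r ≤ n → n ≡ q * r + p → p < r → q₀ + 3 ≤ q
  q-large n q p n₀≤n n≡ p<r = s≤s⁻¹ (*-cancelʳ-< r (q₀ + 3) (suc q) (≤-trans (s≤s (≤-trans n₀≤n (≤-reflexive n≡)))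
      (≤-trans (+-monoʳ-< (q * r) p<r) (≤-reflexive (+-comm (q * r) r)))))

  conclude : ∀ n q p → n ≡ q * r + p → p < r → q₀ + 3 ≤ q →
    (Σ ℕ λ e → IsEx r (Book r k) n e × + (2 * r * e) ≡ exFormula2r r n p)
    × ((p ≡ 0 → ∀ (G : Graph n) → InEx r (Book r k) G ⇔ (InG1 G r q p ⊎ InG2 G r q p))
    × ((1 ≤ p → p ≤ r ∸ 3 → ∀ (G : Graph n) → InEx r (Book r k) G ⇔ (InG1 G r q p ⊎ (InG2 G r q p ⊎ InG3 G r q p)))
    × ((p ≡ r ∸ 2 → ∀ (G : Graph n) → InEx r (Book r k) G ⇔ (InG2 G r q p ⊎ InG3 G r q p))
    × (p ≡ r ∸ 1 → ∀ (G : Graph n) → InEx r (Book r k) G ⇔ InG3 G r q p))))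
  conclude n zero p n≡ p<r large = contradiction (≤-trans (m≤n+m 3 q₀) large) λ ()
  conclude n (suc zero) p n≡ p<r large = contradiction (≤-trans (m≤n+m 3 q₀) large) λ { (s≤s ()) }
  conclude n q@(suc (suc q₁)) p n≡ p<r large =
    (edges G₀ , ((G₀ , admissible₀ , refl) , maximum) , formula (2 + ρ) n q p (edges G₀) n≡ (trans extremal₀
        (cong (_+ (2 * q + 1) * (n + 1)) (sym (edges-sum G₀))))) ,
    (λ p≡0 G → mk⇔
      (λ ex → [ inj₁ ∘ proj₂ , [ inj₂ ∘ proj₂ , (λ (1≤p , _) → contradiction (≤-trans 1≤p (≤-reflexive p≡0)) λ ()) ]′ ]′ (families G ex))
      [ fromG1 G (≤-trans (s≤s (≤-reflexive p≡0)) (s≤s z≤n)) , fromG2 G (≤-trans (≤-reflexive p≡0) z≤n) ]′) ,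
    (λ 1≤p p≤ G → mk⇔
      (λ ex → [ inj₁ ∘ proj₂ , [ inj₂ ∘ inj₁ ∘ proj₂ , inj₂ ∘ inj₂ ∘ proj₂ ]′ ]′ (families G ex))
      [ fromG1 G (s≤s p≤) , [ fromG2 G (≤-trans p≤ (n≤1+n ρ)) , fromG3 G 1≤p ]′ ]′) ,
    (λ p≡ G → mk⇔
      (λ ex → [ (λ (p< , _) → contradiction p≡ (<⇒≢ p<)) , [ inj₁ ∘ proj₂ , inj₂ ∘ proj₂ ]′ ]′ (families G ex))
      [ fromG2 G (≤-reflexive p≡) , fromG3 G (≤-trans (s≤s z≤n) (≤-reflexive (sym p≡))) ]′) ,
    (λ p≡ G → mk⇔
      (λ ex → [ (λ (p< , _) → contradiction p≡ (<⇒≢ (m<n⇒m<1+n p<))) , [ (λ (p≤ , _) → contradiction p≡ (<⇒≢ (s≤s p≤))) , proj₂ ]′ ]′ (families G ex))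
      (fromG3 G (≤-trans (s≤s z≤n) (≤-reflexive (sym p≡)))))
    where
    r≤qr : r ≤ q * r
    r≤qr = m≤m+n r (suc q₁ * r)
    n≤ : n ≤ 2 * (q * r)
    n≤ = ≤-trans (≤-reflexive n≡) (≤-trans (+-monoʳ-≤ (q * r) (≤-trans (<⇒≤ p<r) r≤qr)) (≤-reflexive (cong (λ x → q * r + x) (sym (+-identityʳ _)))))
    open Extremum {q = q} {p = p} 1≤k (≤-trans (m≤n+m 3 q₀) large) n≡ p<r (λ G → proj₂ (stability ρ k 1≤k) G (≤-trans (m≤m+n q₀ 3) large) n≤)
    module F (G : Graph n) = Families {q₁ = q₁} {m = suc ρ} G
    families : ∀ G → InEx r (Book r k) G → (p < suc ρ × InG1 G r q p) ⊎ (p ≤ suc ρ × InG2 G r q p) ⊎ (1 ≤ p × InG3 G r q p)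
    families G ex = F.toG G {p} n≡ (InEx⇒blow-up G ex)
    fromG1 : ∀ G → p < suc ρ → InG1 G r q p → InEx r (Book r k) G
    fromG1 G h F = blow-up⇒InEx G (F.fromG1 G {p} h F)
    fromG2 : ∀ G → p ≤ suc ρ → InG2 G r q p → InEx r (Book r k) G
    fromG2 G h F = blow-up⇒InEx G (F.fromG2 G {p} h F)
    fromG3 : ∀ G → 1 ≤ p → InG3 G r q p → InEx r (Book r k) G
    fromG3 G h F = blow-up⇒InEx G (F.fromG3 G {p} h (s≤s⁻¹ p<r) F)
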